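{- Choose any decay factor $\alpha\in(0,1)$, failure probability $p\in(0,1)$, and any functions $\varepsilon(n)\in(0,1)$ and $m(n)\in\Omega(n)\cap O(n^2)$. Consider any (possibly randomized) algorithm in the arc-centric graph query model which, for an arbitrary directed graph $G$ with $O(m)$ edges and $O(n)$ nodes and any source node $s$ of $G$, with probability at least $1-p$ gives an estimate $\hat\pi(s,\cdot)$ of the PPR vector $\pi(s,\cdot)$ satisfying $|\hat\pi(s,v)-\pi(s,v)|\le\varepsilon$ for each node $v$. Then there exist a graph $\mathrm U$ and a source node $s$ such that (i) $\mathrm U$ contains $O(m)$ edges and $O(n)$ nodes; (ii) the algorithm requires $\Omega\!\left(\min\left(m,\frac{1}{\varepsilon^2}\right)\right)$ queries to succeed in expectation.
   Context: Graphs are directed, without parallel edges (self-loops allowed). Personalized PageRank (PPR): for a decay factor $\alpha\in(0,1)$, an $\alpha$-decay random walk from $s$ at each step stops at the current node with probability $\alpha$, and with probability $1-\alpha$ moves to a uniformly random out-neighbour of the current node. $\pi(s,t)$ is the probability that the walk started at $s$ terminates at $t$. It is assumed, without loss of generality, that graphs have no dangling nodes (nodes without out-neighbours). The parameters $\alpha,p$ are treated as constants in the asymptotic notation. Arc-centric graph query model: nodes carry labels in $\{1,\dots,|V|\}$; the out-edges (in-edges) of a node $v$ are indexed by $1,\dots,d_{out}(v)$ (resp. $1,\dots,d_{in}(v)$); a graph instance includes these labels. The algorithm is given $s$ (which is covered) and accesses $G$ only via unit-cost queries: JUMP() returns a uniformly random node and marks it covered; INDEG$(v)$/OUTDEG$(v)$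 return the in-/out-degree of a covered node $v$; ADJ$_{in}(v,i)$/ADJ$_{out}(v,i)$ return the $i$-th in-/out-neighbour of a covered node $v$ (which then becomes covered).
   Formalization: The bound is proved as c·min(m,1/ε²) − 1 expected queries: as stated it fails for bounded 1/ε² (for ε=1/2 the estimate 1/2 everywhere needs no query), so nothing is claimed when min(m,1/ε²) stays bounded. -}

module Defs where

open import Data.Bool.Base using (Bool; true; false; if_then_else_)
open import Data.Fin.Base using (Fin; fromℕ<)
import Data.Fin.Properties as Finₚ
open import Data.Integer.Base using (+_)
open import Data.List.Base using (List; []; _∷_; map; foldr; length; allFin; upTo)
import Data.List.Membership.DecPropositional as DecMembership
open import Data.Nat.Base as ℕ using (ℕ; zero; suc)
import Data.Nat.Properties as ℕₚ
open import Data.Product.Base using (Σ; ∃-syntax; _×_; _,_)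
open import Data.Rational.Base as ℚ using (ℚ; 0ℚ; 1ℚ; ½)
import Data.Rational.Properties as ℚₚ
import Data.Rational.Solver as ℚSolver
open import Data.Sum.Base using (inj₁; inj₂)
import Data.Vec.Functional as V
open import Function.Bundles using (_⇔_)
open import Function.Definitions using (Injective)
open import Relation.Binary.PropositionalEquality using (_≡_; refl; sym; trans; cong; cong₂; subst; subst₂)
open import Relation.Nullary.Decidable using (⌊_⌋; yes; no)

infix 4 _≤_ _<_
infixl 6 _+_ _-_
infixl 7 _*_ _⊓_
infix 8 -_

IsCauchy : (ℕ → ℚ) → Set
IsCauchy x = ∀ δ → 0ℚ ℚ.< δ →
  ∃[ N ] (∀ i j → N ℕ.≤ i → N ℕ.≤ j → ℚ.∣ x i ℚ.- x j ∣ ℚ.< δ)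

record ℝ : Set where
  constructor mkℝ
  field
    seq    : ℕ → ℚ
    cauchy : IsCauchy seq

open ℝ public

_<_ : ℝ → ℝ → Set
x < y = ∃[ δ ] (0ℚ ℚ.< δ × ∃[ N ] (∀ n → N ℕ.≤ n → seq x n ℚ.+ δ ℚ.≤ seq y n))

_≤_ : ℝ → ℝ → Set
x ≤ y = ∀ δ → 0ℚ ℚ.< δ → ∃[ N ] (∀ n → N ℕ.≤ n → seq x n ℚ.≤ seq y n ℚ.+ δ)

open ℚSolver.+-*-Solver using (solve; _:+_; _:*_; :-_; _:-_; _:=_)

half-pos : ∀ {δ} → 0ℚ ℚ.< δ → 0ℚ ℚ.< ½ ℚ.* δ
half-pos {δ} h = subst (ℚ._< ½ ℚ.* δ) (ℚₚ.*-zeroʳ ½) (ℚₚ.*-monoʳ-<-pos ½ h)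

half+half : ∀ δ → ½ ℚ.* δ ℚ.+ ½ ℚ.* δ ≡ δ
half+half δ = trans (sym (ℚₚ.*-distribʳ-+ δ ½ ½)) (ℚₚ.*-identityˡ δ)

*-pos : ∀ {p q} → 0ℚ ℚ.< p → 0ℚ ℚ.< q → 0ℚ ℚ.< p ℚ.* q
*-pos {p} {q} hp hq =
  subst (ℚ._< p ℚ.* q) (ℚₚ.*-zeroʳ p) (ℚₚ.*-monoʳ-<-pos p {{ℚ.positive hp}} hq)

*-mono-≤ : ∀ {a b c d} → 0ℚ ℚ.≤ c → 0ℚ ℚ.≤ b → a ℚ.≤ b → c ℚ.≤ d → a ℚ.* c ℚ.≤ b ℚ.* d
*-mono-≤ {a} {b} {c} {d} 0≤c 0≤b a≤b c≤d = ℚₚ.≤-trans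
  (ℚₚ.*-monoʳ-≤-nonNeg c {{ℚ.nonNegative 0≤c}} a≤b)
  (ℚₚ.*-monoˡ-≤-nonNeg b {{ℚ.nonNegative 0≤b}} c≤d)

recip : (q : ℚ) → .(0ℚ ℚ.< q) → ℚ
recip q h = (ℚ.1/ q) {{ℚₚ.pos⇒nonZero q {{ℚ.positive h}}}}

recip-inverse : ∀ q (h : 0ℚ ℚ.< q) → q ℚ.* recip q h ≡ 1ℚ
recip-inverse q h = ℚₚ.*-inverseʳ q {{ℚₚ.pos⇒nonZero q {{ℚ.positive h}}}}

recip-pos : ∀ q (h : 0ℚ ℚ.< q) → 0ℚ ℚ.< recip q h
recip-pos q h = ℚₚ.positive⁻¹ (recip q h) {{ℚₚ.1/pos⇒pos q {{ℚ.positive h}}}}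

recip-antimono : ∀ {p q} (hp : 0ℚ ℚ.< p) (hq : 0ℚ ℚ.< q) → p ℚ.≤ q → recip q hq ℚ.≤ recip p hp
recip-antimono {p} {q} hp hq p≤q = subst₂ ℚ._≤_ lhs rhs
  (ℚₚ.*-monoʳ-≤-nonNeg (p′ ℚ.* q′)
    {{ℚ.nonNegative (ℚₚ.<⇒≤ (*-pos (recip-pos p hp) (recip-pos q hq)))}} p≤q)
  where
  p′ = recip p hp
  q′ = recip q hq
  lhs : p ℚ.* (p′ ℚ.* q′) ≡ q′
  lhs = trans (sym (ℚₚ.*-assoc p p′ q′))
       (trans (cong (ℚ._* q′) (recip-inverse p hp)) (ℚₚ.*-identityˡ q′))
  rhs : q ℚ.* (p′ ℚ.* q′) ≡ p′
  rhs = trans (solve 3 (λ a b c → a :* (b :* c) := b :* (a :* c)) refl q p′ q′)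
       (trans (cong (p′ ℚ.*_) (recip-inverse q hq)) (ℚₚ.*-identityʳ p′))

divide : ∀ B δ → 0ℚ ℚ.< B → 0ℚ ℚ.< δ → ∃[ η ] (0ℚ ℚ.< η × B ℚ.* η ≡ δ)
divide B δ hB hδ = recip B hB ℚ.* δ , *-pos (recip-pos B hB) hδ ,
  trans (sym (ℚₚ.*-assoc B (recip B hB) δ))
    (trans (cong (ℚ._* δ) (recip-inverse B hB)) (ℚₚ.*-identityˡ δ))

dist-sym : ∀ p q → ℚ.∣ p ℚ.- q ∣ ≡ ℚ.∣ q ℚ.- p ∣
dist-sym p q = trans (sym (ℚₚ.∣-p∣≡∣p∣ (p ℚ.- q)))
  (cong ℚ.∣_∣ (solve 2 (λ a b → :- (a :- b) := b :- a) refl p q))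

p≤∣p∣ : ∀ p → p ℚ.≤ ℚ.∣ p ∣
p≤∣p∣ p with ℚₚ.≤-total 0ℚ p
... | inj₁ 0≤p = ℚₚ.≤-reflexive (sym (ℚₚ.0≤p⇒∣p∣≡p 0≤p))
... | inj₂ p≤0 = ℚₚ.≤-trans p≤0 (ℚₚ.0≤∣p∣ p)

dist<⇒< : ∀ p q {δ} → ℚ.∣ p ℚ.- q ∣ ℚ.< δ → p ℚ.< q ℚ.+ δ
dist<⇒< p q {δ} h = subst (ℚ._< q ℚ.+ δ)
  (solve 2 (λ a b → b :+ (a :- b) := a) refl p q)
  (ℚₚ.+-monoʳ-< q (ℚₚ.≤-<-trans (p≤∣p∣ (p ℚ.- q)) h))

<-shift : ∀ p q {δ} → p ℚ.< q ℚ.+ δ → p ℚ.- q ℚ.< δ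
<-shift p q {δ} h = subst (p ℚ.- q ℚ.<_)
  (solve 2 (λ b d → (b :+ d) :- b := d) refl q δ)
  (ℚₚ.+-monoˡ-< (ℚ.- q) h)

<⇒dist< : ∀ p q {δ} → p ℚ.< q ℚ.+ δ → q ℚ.< p ℚ.+ δ → ℚ.∣ p ℚ.- q ∣ ℚ.< δ
<⇒dist< p q {δ} h₁ h₂ with ℚₚ.∣p∣≡p∨∣p∣≡-p (p ℚ.- q)
... | inj₁ e = subst (ℚ._< δ) (sym e) (<-shift p q h₁)
... | inj₂ e = subst (ℚ._< δ)
  (trans (solve 2 (λ a b → b :- a := :- (a :- b)) refl p q) (sym e)) (<-shift q p h₂)

∣∣-dist : ∀ p q {δ} → ℚ.∣ p ℚ.- q ∣ ℚ.< δ → ℚ.∣ p ∣ ℚ.< ℚ.∣ q ∣ ℚ.+ δ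
∣∣-dist p q {δ} h = ℚₚ.≤-<-trans
  (subst (λ r → ℚ.∣ r ∣ ℚ.≤ ℚ.∣ q ∣ ℚ.+ ℚ.∣ p ℚ.- q ∣)
    (solve 2 (λ a b → b :+ (a :- b) := a) refl p q)
    (ℚₚ.∣p+q∣≤∣p∣+∣q∣ q (p ℚ.- q)))
  (ℚₚ.+-monoʳ-< ℚ.∣ q ∣ h)

⊓-dist : ∀ a b c d {δ} → a ℚ.< c ℚ.+ δ → b ℚ.< d ℚ.+ δ → a ℚ.⊓ b ℚ.< c ℚ.⊓ d ℚ.+ δ
⊓-dist a b c d {δ} h₁ h₂ with ℚₚ.⊓-sel c d
... | inj₁ e = subst (λ r → a ℚ.⊓ b ℚ.< r ℚ.+ δ) (sym e) (ℚₚ.≤-<-trans (ℚₚ.p⊓q≤p a b) h₁)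
... | inj₂ e = subst (λ r → a ℚ.⊓ b ℚ.< r ℚ.+ δ) (sym e) (ℚₚ.≤-<-trans (ℚₚ.p⊓q≤q a b) h₂)

bounded : ∀ x → ∃[ B ] (0ℚ ℚ.< B × ∃[ N ] (∀ i → N ℕ.≤ i → ℚ.∣ seq x i ∣ ℚ.≤ B))
bounded x with cauchy x 1ℚ (ℚₚ.positive⁻¹ 1ℚ)
... | N , h = ℚ.∣ seq x N ∣ ℚ.+ 1ℚ ,
  ℚₚ.+-mono-≤-< (ℚₚ.0≤∣p∣ (seq x N)) (ℚₚ.positive⁻¹ 1ℚ) ,
  N , λ i N≤i → ℚₚ.<⇒≤ (∣∣-dist (seq x i) (seq x N) (h i N N≤i ℕₚ.≤-refl))

both : ∀ M N {i} → M ℕ.⊔ N ℕ.≤ i → M ℕ.≤ i × N ℕ.≤ i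
both M N h = ℕₚ.≤-trans (ℕₚ.m≤m⊔n M N) h , ℕₚ.≤-trans (ℕₚ.m≤n⊔m M N) h

fromℚ : ℚ → ℝ
fromℚ q = mkℝ (λ _ → q) λ δ 0<δ → 0 , λ _ _ _ _ →
  subst (ℚ._< δ) (sym (cong ℚ.∣_∣ (ℚₚ.+-inverseʳ q))) 0<δ

fromℕ : ℕ → ℝ
fromℕ n = fromℚ (+ n ℚ./ 1)

0ℝ 1ℝ : ℝ
0ℝ = fromℚ 0ℚ
1ℝ = fromℚ 1ℚ

_+_ : ℝ → ℝ → ℝ
x + y = mkℝ (λ n → seq x n ℚ.+ seq y n) λ δ 0<δ →
  let Nx , hx = cauchy x (½ ℚ.* δ) (half-pos 0<δ)
      Ny , hy = cauchy y (½ ℚ.* δ) (half-pos 0<δ)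
  in Nx ℕ.⊔ Ny , λ i j hi hj →
  let a = seq x i ; b = seq y i ; c = seq x j ; d = seq y j
      ix , iy = both Nx Ny hi
      jx , jy = both Nx Ny hj
  in ℚₚ.≤-<-trans
       (subst (λ r → ℚ.∣ r ∣ ℚ.≤ ℚ.∣ a ℚ.- c ∣ ℚ.+ ℚ.∣ b ℚ.- d ∣)
         (solve 4 (λ a b c d → (a :- c) :+ (b :- d) := (a :+ b) :- (c :+ d)) refl a b c d)
         (ℚₚ.∣p+q∣≤∣p∣+∣q∣ (a ℚ.- c) (b ℚ.- d)))
       (subst (ℚ.∣ a ℚ.- c ∣ ℚ.+ ℚ.∣ b ℚ.- d ∣ ℚ.<_) (half+half δ)
         (ℚₚ.+-mono-< (hx i j ix jx) (hy i j iy jy)))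

-_ : ℝ → ℝ
- x = mkℝ (λ n → ℚ.- seq x n) λ δ 0<δ →
  let N , h = cauchy x δ 0<δ
  in N , λ i j hi hj → subst (ℚ._< δ)
       (trans (dist-sym (seq x i) (seq x j))
         (cong ℚ.∣_∣ (solve 2 (λ a b → b :- a := (:- a) :- (:- b)) refl (seq x i) (seq x j))))
       (h i j hi hj)

_-_ : ℝ → ℝ → ℝ
x - y = x + (- y)

_*_ : ℝ → ℝ → ℝ
x * y = mkℝ (λ n → seq x n ℚ.* seq y n) λ δ 0<δ →
  let Bx , 0<Bx , Mx , bx = bounded x
      By , 0<By , My , by = bounded y
      ηy , 0<ηy , ey = divide Bx (½ ℚ.* δ) 0<Bx (half-pos 0<δ)
      ηx , 0<ηx , ex = divide By (½ ℚ.* δ) 0<By (half-pos 0<δ)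
      Nx , hx = cauchy x ηx 0<ηx
      Ny , hy = cauchy y ηy 0<ηy
  in (Mx ℕ.⊔ My) ℕ.⊔ (Nx ℕ.⊔ Ny) , λ i j hi hj →
  let a = seq x i ; b = seq y i ; c = seq x j ; d = seq y j
      iM , iN = both (Mx ℕ.⊔ My) (Nx ℕ.⊔ Ny) hi
      jM , jN = both (Mx ℕ.⊔ My) (Nx ℕ.⊔ Ny) hj
      iMx , _ = both Mx My iM
      _ , jMy = both Mx My jM
      iNx , iNy = both Nx Ny iN
      jNx , jNy = both Nx Ny jN
      first : ℚ.∣ a ℚ.* (b ℚ.- d) ∣ ℚ.< ½ ℚ.* δ
      first = subst₂ ℚ._<_ (sym (ℚₚ.∣p*q∣≡∣p∣*∣q∣ a (b ℚ.- d))) ey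
        (ℚₚ.≤-<-trans
          (ℚₚ.*-monoʳ-≤-nonNeg ℚ.∣ b ℚ.- d ∣ {{ℚ.nonNegative (ℚₚ.0≤∣p∣ (b ℚ.- d))}} (bx i iMx))
          (ℚₚ.*-monoʳ-<-pos Bx {{ℚ.positive 0<Bx}} (hy i j iNy jNy)))
      second : ℚ.∣ d ℚ.* (a ℚ.- c) ∣ ℚ.< ½ ℚ.* δ
      second = subst₂ ℚ._<_ (sym (ℚₚ.∣p*q∣≡∣p∣*∣q∣ d (a ℚ.- c))) ex
        (ℚₚ.≤-<-trans
          (ℚₚ.*-monoʳ-≤-nonNeg ℚ.∣ a ℚ.- c ∣ {{ℚ.nonNegative (ℚₚ.0≤∣p∣ (a ℚ.- c))}} (by j jMy))
          (ℚₚ.*-monoʳ-<-pos By {{ℚ.positive 0<By}} (hx i j iNx jNx)))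
  in ℚₚ.≤-<-trans
       (subst (λ r → ℚ.∣ r ∣ ℚ.≤ ℚ.∣ a ℚ.* (b ℚ.- d) ∣ ℚ.+ ℚ.∣ d ℚ.* (a ℚ.- c) ∣)
         (solve 4 (λ a b c d → a :* (b :- d) :+ d :* (a :- c) := a :* b :- c :* d) refl a b c d)
         (ℚₚ.∣p+q∣≤∣p∣+∣q∣ (a ℚ.* (b ℚ.- d)) (d ℚ.* (a ℚ.- c))))
       (subst (_ ℚ.<_) (half+half δ) (ℚₚ.+-mono-< first second))

∣_∣ : ℝ → ℝ
∣ x ∣ = mkℝ (λ n → ℚ.∣ seq x n ∣) λ δ 0<δ →
  let N , h = cauchy x δ 0<δ
  in N , λ i j hi hj → <⇒dist< ℚ.∣ seq x i ∣ ℚ.∣ seq x j ∣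
       (∣∣-dist (seq x i) (seq x j) (h i j hi hj)) (∣∣-dist (seq x j) (seq x i) (h j i hj hi))

_⊓_ : ℝ → ℝ → ℝ
x ⊓ y = mkℝ (λ n → seq x n ℚ.⊓ seq y n) λ δ 0<δ →
  let Nx , hx = cauchy x δ 0<δ
      Ny , hy = cauchy y δ 0<δ
  in Nx ℕ.⊔ Ny , λ i j hi hj →
  let a = seq x i ; b = seq y i ; c = seq x j ; d = seq y j
      ix , iy = both Nx Ny hi
      jx , jy = both Nx Ny hj
  in <⇒dist< (a ℚ.⊓ b) (c ℚ.⊓ d)
       (⊓-dist a b c d (dist<⇒< a c (hx i j ix jx)) (dist<⇒< b d (hy i j iy jy)))
       (⊓-dist c d a b (dist<⇒< c a (hx j i jx ix)) (dist<⇒< d b (hy j i jy iy)))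

-- The initial terms of the sequence, which might vanish, are dropped.
inverse : (x : ℝ) → 0ℝ < x → ℝ
inverse x (δ₀ , 0<δ₀ , M , lower) = mkℝ (λ n → recip (s n) (0<s n)) λ δ 0<δ →
  let K = r₀ ℚ.* r₀
      η , 0<η , e = divide K δ (*-pos 0<r₀ 0<r₀) 0<δ
      N , h = cauchy x η 0<η
  in N , λ i j hi hj →
  let a = s i ; b = s j ; a′ = recip a (0<s i) ; b′ = recip b (0<s j)
      0≤a′ = ℚₚ.<⇒≤ (recip-pos a (0<s i))
      0≤b′ = ℚₚ.<⇒≤ (recip-pos b (0<s j))
      0≤a′b′ = ℚₚ.<⇒≤ (*-pos (recip-pos a (0<s i)) (recip-pos b (0<s j)))
      difference : (a′ ℚ.* b′) ℚ.* (b ℚ.- a) ≡ a′ ℚ.- b′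
      difference = trans
        (solve 4 (λ a b a′ b′ → (a′ :* b′) :* (b :- a) := a′ :* (b :* b′) :- b′ :* (a :* a′)) refl a b a′ b′)
        (cong₂ (λ u v → u ℚ.- v)
          (trans (cong (a′ ℚ.*_) (recip-inverse b (0<s j))) (ℚₚ.*-identityʳ a′))
          (trans (cong (b′ ℚ.*_) (recip-inverse a (0<s i))) (ℚₚ.*-identityʳ b′)))
      size : ℚ.∣ a′ ℚ.- b′ ∣ ≡ (a′ ℚ.* b′) ℚ.* ℚ.∣ b ℚ.- a ∣
      size = trans (cong ℚ.∣_∣ (sym difference))
        (trans (ℚₚ.∣p*q∣≡∣p∣*∣q∣ (a′ ℚ.* b′) (b ℚ.- a))
               (cong (ℚ._* ℚ.∣ b ℚ.- a ∣) (ℚₚ.0≤p⇒∣p∣≡p 0≤a′b′)))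
      a′b′≤K : a′ ℚ.* b′ ℚ.≤ K
      a′b′≤K = *-mono-≤ 0≤b′ (ℚₚ.<⇒≤ 0<r₀)
        (recip-antimono 0<δ₀ (0<s i) (δ₀≤s i)) (recip-antimono 0<δ₀ (0<s j) (δ₀≤s j))
  in subst₂ ℚ._<_ (sym size) e
       (ℚₚ.≤-<-trans
         (ℚₚ.*-monoʳ-≤-nonNeg ℚ.∣ b ℚ.- a ∣ {{ℚ.nonNegative (ℚₚ.0≤∣p∣ (b ℚ.- a))}} a′b′≤K)
         (ℚₚ.*-monoʳ-<-pos K {{ℚ.positive (*-pos 0<r₀ 0<r₀)}}
           (h (M ℕ.+ j) (M ℕ.+ i) (ℕₚ.≤-trans hj (ℕₚ.m≤n+m j M)) (ℕₚ.≤-trans hi (ℕₚ.m≤n+m i M)))))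
  where
  s : ℕ → ℚ
  s n = seq x (M ℕ.+ n)
  δ₀≤s : ∀ n → δ₀ ℚ.≤ s n
  δ₀≤s n = subst (ℚ._≤ s n) (ℚₚ.+-identityˡ δ₀) (lower (M ℕ.+ n) (ℕₚ.m≤m+n M n))
  0<s : ∀ n → 0ℚ ℚ.< s n
  0<s n = ℚₚ.<-≤-trans 0<δ₀ (δ₀≤s n)
  r₀ : ℚ
  r₀ = recip δ₀ 0<δ₀
  0<r₀ : 0ℚ ℚ.< r₀
  0<r₀ = recip-pos δ₀ 0<δ₀

_⟶_ : (ℕ → ℝ) → ℝ → Set
f ⟶ x = ∀ δ → 0ℝ < δ → ∃[ K ] (∀ k → K ℕ.≤ k → ∣ f k - x ∣ ≤ δ)

sum : ∀ {n} → (Fin n → ℝ) → ℝ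
sum = V.foldr _+_ 0ℝ

_∈O_ _∈Ω_ : (ℕ → ℝ) → (ℕ → ℝ) → Set
f ∈O g = ∃[ C ] (0ℝ < C × ∃[ n₀ ] (∀ n → n₀ ℕ.≤ n → f n ≤ C * g n))
f ∈Ω g = ∃[ c ] (0ℝ < c × ∃[ n₀ ] (∀ n → n₀ ℕ.≤ n → c * g n ≤ f n))

record Graph (N : ℕ) : Set where
  field
    outdeg indeg  : Fin N → ℕ
    out           : (v : Fin N) → Fin (outdeg v) → Fin N
    inn           : (v : Fin N) → Fin (indeg v) → Fin N
    out-injective : ∀ v → Injective _≡_ _≡_ (out v)
    inn-injective : ∀ v → Injective _≡_ _≡_ (inn v)
    out⇔inn       : ∀ u v → (∃[ i ] out u i ≡ v) ⇔ (∃[ j ] inn v j ≡ u)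
    noDangling    : ∀ v → ℕ.NonZero (outdeg v)

edges : ∀ {N} → Graph N → ℕ
edges G = V.foldr ℕ._+_ 0 (Graph.outdeg G)

module _ {N : ℕ} (G : Graph N) (α : ℝ) where
  open Graph G

  -- The probability that the walk from s stops at t after exactly k moves,
  -- by conditioning on the first step.
  stopsAfter : ℕ → Fin N → Fin N → ℝ
  stopsAfter zero    s t = if ⌊ s Finₚ.≟ t ⌋ then α else 0ℝ
  stopsAfter (suc k) s t =
    (1ℝ - α) * (fromℚ ((+ 1 ℚ./ outdeg s) {{noDangling s}}) *
                sum (λ i → stopsAfter k (out s i) t))

  stopsWithin : ℕ → Fin N → Fin N → ℝ
  stopsWithin zero    s t = 0ℝ
  stopsWithin (suc k) s t = stopsWithin k s t + stopsAfter k s t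

  -- x = π(s,t), the sum over k of the probabilities stopsAfter k s t.
  IsPPR : Fin N → Fin N → ℝ → Set
  IsPPR s t x = (λ k → stopsWithin k s t) ⟶ x

  Accurate : ℝ → Fin N → (Fin N → ℝ) → Set
  Accurate ε s π̂ = ∀ v x → IsPPR s v x → ∣ π̂ v - x ∣ ≤ ε

data Query (N : ℕ) : Set where
  jump           : Query N
  indeg outdeg   : Fin N → Query N
  adjIn adjOut   : Fin N → ℕ → Query N

data Reply (N : ℕ) : Set where
  node   : Fin N → Reply N
  number : ℕ → Reply N

-- toss k draws one of 0, …, k uniformly at random, at no cost.
data Action (N : ℕ) : Set where
  query  : Query N → Action N
  toss   : ℕ → Action N
  output : (Fin N → ℝ) → Action N

-- A randomized algorithm chooses its next action from the number of nodes, the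
-- source and all replies so far (latest first; these include the random draws).
-- It need not terminate.
Algorithm : Set
Algorithm = (N : ℕ) → Fin N → List (Reply N) → Action N

average : List ℚ → ℚ
average []         = 0ℚ
average qs@(_ ∷ _) = foldr ℚ._+_ 0ℚ qs ℚ.* (+ 1 ℚ./ length qs)

draws : ∀ {N} → ℕ → List (Reply N)
draws k = map number (upTo (suc k))

module _ {N : ℕ} (G : Graph N) where
  open DecMembership (Finₚ._≟_ {N}) using (_∈?_)

  ifCovered : List (Fin N) → Fin N → List (Reply N) → List (Reply N)
  ifCovered covered v rs = if ⌊ v ∈? covered ⌋ then rs else []

  neighbour : ∀ {d} → (Fin d → Fin N) → ℕ → List (Reply N)
  neighbour {d} nb i with i ℕₚ.<? d
  ... | yes i<d = node (nb (fromℕ< i<d)) ∷ []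
  ... | no  _   = []

  -- The equally likely replies to a query when the nodes in the given list are
  -- covered.  A query that is not permitted has none, and the run then stops
  -- without output.  Edge indices start at 0.
  replies : List (Fin N) → Query N → List (Reply N)
  replies covered jump         = map node (allFin N)
  replies covered (indeg v)    = ifCovered covered v (number (Graph.indeg G v) ∷ [])
  replies covered (outdeg v)   = ifCovered covered v (number (Graph.outdeg G v) ∷ [])
  replies covered (adjIn v i)  = ifCovered covered v (neighbour (Graph.inn G v) i)
  replies covered (adjOut v i) = ifCovered covered v (neighbour (Graph.out G v) i)

  cover : Reply N → List (Fin N) → List (Fin N)
  cover (node v)   covered = v ∷ covered
  cover (number _) covered = covered

  module _ (A : Algorithm) (s : Fin N) where

    -- acceptance T is the probability that, in at most T actions, the run
    -- produces its output, at a history marked true.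
    acceptance : (List (Reply N) → Bool) → ℕ → List (Fin N) → List (Reply N) → ℚ
    acceptance accept zero    covered h = 0ℚ
    acceptance accept (suc T) covered h with A N s h
    ... | output _ = if accept h then 1ℚ else 0ℚ
    ... | toss k   = average (map (λ r → acceptance accept T covered (r ∷ h)) (draws k))
    ... | query q  = average (map (λ r → acceptance accept T (cover r covered) (r ∷ h)) (replies covered q))

    -- The expected number of queries among the first T actions.
    queries : ℕ → List (Fin N) → List (Reply N) → ℚ
    queries zero    covered h = 0ℚ
    queries (suc T) covered h with A N s h
    ... | output _ = 0ℚ
    ... | toss k   = average (map (λ r → queries T covered (r ∷ h)) (draws k))
    ... | query q  = 1ℚ ℚ.+ average (map (λ r → queries T (cover r covered) (r ∷ h)) (replies covered q))

    -- The output satisfies P with probability at least ρ.  As P need not be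
    -- decidable, this asks for a decidable event contained in P.
    WithProbability : ℝ → ((Fin N → ℝ) → Set) → Set
    WithProbability ρ P = Σ (List (Reply N) → Bool) λ accept →
      (∀ h π̂ → A N s h ≡ output π̂ → accept h ≡ true → P π̂) ×
      (∀ δ → 0ℝ < δ → ∃[ T ] (ρ ≤ fromℚ (acceptance accept T (s ∷ []) []) + δ))

    -- The expected total number of queries, possibly infinite, is at least r:
    -- it is the supremum over T of the (nondecreasing) expectations queries T.
    ExpectedQueries≥ : ℝ → Set
    ExpectedQueries≥ r = ∀ δ → 0ℝ < δ → ∃[ T ] (r ≤ fromℚ (queries T (s ∷ []) []) + δ)

{-# OPTIONS --safe #-}
-- The hard graphs are indexed by a k × k matrix of bits, with k² of order
-- min(m, 1/ε²).  The source points to k nodes; the i-th of these points to one of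
-- two copies of a node j, according to the bit (i, j), and the copies lead to two
-- different sinks.  Hence the PPR of one sink is α(1 − α)³ times the fraction of
-- ones.  A mirror image of the first layer, unreachable from the source, takes the
-- complementary edges, so that all degrees are independent of the bits and each
-- query reveals at most one bit.  An accurate output pins the number of ones down
-- to a window of width O(k/Q), whereas, while half of the bits are unknown, no
-- value of their sum has probability more than O(1/k), by the bound on the central
-- binomial coefficient.  Thus succeeding with probability 2/Q on a random matrix
-- takes Ω(k²/Q) queries on average, hence on some fixed matrix.
module Submission where

open import Defs
open import Data.Fin.Base using (Fin)
open import Data.Nat.Base as ℕ using (ℕ)
open import Data.Product.Base using (Σ; ∃-syntax; _×_)
open import Algebra.Bundles using (CommutativeRing)
open import Data.Bool.Base using (Bool; true; false; if_then_else_; T; _xor_)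
open import Data.Empty using (⊥-elim)
open import Data.Fin.Base using (zero; suc; combine; remQuot; _↑ˡ_; _↑ʳ_; fromℕ<)
open import Data.Fin.Patterns using (0F; 1F; 2F; 3F)
import Data.Fin.Properties as Finₚ
open import Data.Integer.Base as ℤ using (+_)
import Data.Integer.Properties as ℤₚ
open import Data.List.Base using (List; []; _∷_; map; foldr; length)
import Data.List.Membership.DecPropositional as DecMembership
open import Data.List.Properties using (length-map)
open import Data.Maybe.Base using (Maybe; just; nothing)
open import Data.Nat.Base using (zero; suc)
open import Data.Nat.Combinatorics using (_C_; nCk≡nC[n∸k]; nCn≡1; k>n⇒nCk≡0; nCk+nC[k+1]≡[n+1]C[k+1])
import Data.Nat.Properties as ℕₚ
open import Data.Nat.Tactic.RingSolver using (solve-∀)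
open import Data.Product.Base using (_,_; proj₁; proj₂)
open import Data.Rational.Base as ℚ using (ℚ; 0ℚ; 1ℚ; ½)
import Data.Rational.Properties as ℚₚ
import Data.Rational.Solver as ℚSolver
import Data.Rational.Unnormalised.Base as ℚᵘ
import Data.Rational.Unnormalised.Properties as ℚᵘₚ
open import Data.Sum.Base using (_⊎_; inj₁; inj₂)
open import Data.Vec.Base as Vec using (Vec; []; _∷_; lookup; _[_]≔_)
import Data.Vec.Functional as V
import Data.Vec.Properties as Vecₚ
open import Function.Base using (_∘_)
open import Function.Bundles using (mk⇔)
open import Function.Definitions using (Injective)
open import Relation.Binary.PropositionalEquality using (_≡_; refl; sym; trans; cong; cong₂; subst; subst₂; module ≡-Reasoning)
open import Relation.Nullary.Decidable using (yes; no)
import Algebra.Properties.Semiring.Sum (CommutativeRing.semiring ℚₚ.+-*-commutativeRing) as ℚSum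
open ℚSolver.+-*-Solver using (solve; _:+_; _:*_; :-_; _:-_; _:=_; con)

-- The scale is a number `g` with min(m, 1/ε²) of order g². An error ε in a PPR of order ones/k² is
-- an error of order ε k² in the number of ones, whose standard deviation is k/2; the two balance at
-- k of order 1/ε. With k = 6 Q g and ε ≤ 1/(h g), where h is large in terms of α and Q, the error
-- shrinks to g, a small fraction of k. The node bound needs k = O(n), which comes from k² = O(m)
-- and m = O(n²).
--
-- Probabilities are accounted as follows. An output given while fewer than half of the bits are
-- known is right with probability at most 1/Q. The remaining 1/Q is charged to the queries at the
-- price 1/L each, where L is half the number of bits; this gives L/Q queries.
--
-- Two obstacles shape the rest. Comparison of reals is undecidable, so real parameters are replaced
-- by natural bounds, and inequalities are read off at one late index of the Cauchy sequences. Runs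
-- need not terminate, so they are cut off at a common number of actions, which exists because there
-- are finitely many matrices.

-- Natural numbers and unit fractions among the rationals

ι : ℕ → ℚ
ι n = + n ℚ./ 1

toℚᵘ-ι : ∀ n → ℚ.toℚᵘ (ι n) ℚᵘ.≃ ℚᵘ.mkℚᵘ (+ n) 0
toℚᵘ-ι n = ℚₚ.toℚᵘ-fromℚᵘ (ℚᵘ.mkℚᵘ (+ n) 0)

ι-+ : ∀ m n → ι (m ℕ.+ n) ≡ ι m ℚ.+ ι n
ι-+ m n = ℚₚ.toℚᵘ-injective (begin
  ℚ.toℚᵘ (ι (m ℕ.+ n))                           ≈⟨ toℚᵘ-ι (m ℕ.+ n) ⟩
  ℚᵘ.mkℚᵘ (+ (m ℕ.+ n)) 0                        ≈⟨ ℚᵘ.*≡* (cong (ℤ._* + 1) (sym (cong₂ ℤ._+_ (ℤₚ.*-identityʳ (+ m)) (ℤₚ.*-identityʳ (+ n))))) ⟩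
  ℚᵘ.mkℚᵘ (+ m) 0 ℚᵘ.+ ℚᵘ.mkℚᵘ (+ n) 0           ≈⟨ ℚᵘₚ.+-cong (toℚᵘ-ι m) (toℚᵘ-ι n) ⟨
  ℚ.toℚᵘ (ι m) ℚᵘ.+ ℚ.toℚᵘ (ι n)                 ≈⟨ ℚₚ.toℚᵘ-homo-+ (ι m) (ι n) ⟨
  ℚ.toℚᵘ (ι m ℚ.+ ι n)                           ∎)
  where open ℚᵘₚ.≃-Reasoning

ι-* : ∀ m n → ι (m ℕ.* n) ≡ ι m ℚ.* ι n
ι-* m n = ℚₚ.toℚᵘ-injective (begin
  ℚ.toℚᵘ (ι (m ℕ.* n))                           ≈⟨ toℚᵘ-ι (m ℕ.* n) ⟩
  ℚᵘ.mkℚᵘ (+ (m ℕ.* n)) 0                        ≈⟨ ℚᵘ.*≡* (cong (ℤ._* + 1) (ℤₚ.pos-* m n)) ⟩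
  ℚᵘ.mkℚᵘ (+ m) 0 ℚᵘ.* ℚᵘ.mkℚᵘ (+ n) 0           ≈⟨ ℚᵘₚ.*-cong (toℚᵘ-ι m) (toℚᵘ-ι n) ⟨
  ℚ.toℚᵘ (ι m) ℚᵘ.* ℚ.toℚᵘ (ι n)                 ≈⟨ ℚₚ.toℚᵘ-homo-* (ι m) (ι n) ⟨
  ℚ.toℚᵘ (ι m ℚ.* ι n)                           ∎)
  where open ℚᵘₚ.≃-Reasoning

ι-mono-≤ : ∀ {m n} → m ℕ.≤ n → ι m ℚ.≤ ι n
ι-mono-≤ {m} {n} m≤n = ℚₚ.toℚᵘ-cancel-≤
  (ℚᵘₚ.≤-respˡ-≃ (ℚᵘₚ.≃-sym (toℚᵘ-ι m)) (ℚᵘₚ.≤-respʳ-≃ (ℚᵘₚ.≃-sym (toℚᵘ-ι n))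
    (ℚᵘ.*≤* (ℤₚ.*-monoʳ-≤-nonNeg (+ 1) (ℤ.+≤+ m≤n)))))

ι-cancel-≤ : ∀ {m n} → ι m ℚ.≤ ι n → m ℕ.≤ n
ι-cancel-≤ {m} {n} h
  with ℚᵘₚ.≤-respˡ-≃ (toℚᵘ-ι m) (ℚᵘₚ.≤-respʳ-≃ (toℚᵘ-ι n) (ℚₚ.toℚᵘ-mono-≤ h))
... | ℚᵘ.*≤* h′ = ℤₚ.drop‿+≤+ (ℤₚ.*-cancelʳ-≤-pos (+ m) (+ n) (+ 1) h′)

0≤ι : ∀ n → 0ℚ ℚ.≤ ι n
0≤ι n = ι-mono-≤ {0} {n} ℕ.z≤n

0<ι : ∀ n .{{_ : ℕ.NonZero n}} → 0ℚ ℚ.< ι n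
0<ι (suc n) = ℚₚ.<-≤-trans (ℚₚ.positive⁻¹ 1ℚ) (ι-mono-≤ {1} {suc n} (ℕ.s≤s ℕ.z≤n))

unit : (n : ℕ) .{{_ : ℕ.NonZero n}} → ℚ
unit n = + 1 ℚ./ n

ι*unit : ∀ n .{{_ : ℕ.NonZero n}} → ι n ℚ.* unit n ≡ 1ℚ
ι*unit n@(suc n-1) = ℚₚ.toℚᵘ-injective (begin
  ℚ.toℚᵘ (ι n ℚ.* unit n)              ≈⟨ ℚₚ.toℚᵘ-homo-* (ι n) (unit n) ⟩
  ℚ.toℚᵘ (ι n) ℚᵘ.* ℚ.toℚᵘ (unit n)    ≈⟨ ℚᵘₚ.*-cong (toℚᵘ-ι n) (ℚₚ.toℚᵘ-fromℚᵘ (ℚᵘ.mkℚᵘ (+ 1) n-1)) ⟩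
  ℚᵘ.mkℚᵘ (+ n) 0 ℚᵘ.* ℚᵘ.mkℚᵘ (+ 1) n-1 ≈⟨ ℚᵘ.*≡* (trans (ℤₚ.*-identityʳ (+ n ℤ.* + 1)) (trans (ℤₚ.*-identityʳ (+ n)) (trans (cong +_ (sym (ℕₚ.*-identityˡ n))) (sym (ℤₚ.*-identityˡ (+ (1 ℕ.* n))))))) ⟩
  ℚ.toℚᵘ 1ℚ                            ∎)
  where open ℚᵘₚ.≃-Reasoning

unit*ι : ∀ n .{{_ : ℕ.NonZero n}} → unit n ℚ.* ι n ≡ 1ℚ
unit*ι n = trans (ℚₚ.*-comm (unit n) (ι n)) (ι*unit n)

*-monoˡ : ∀ {r p q} → 0ℚ ℚ.≤ r → p ℚ.≤ q → r ℚ.* p ℚ.≤ r ℚ.* q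
*-monoˡ {r} 0≤r = ℚₚ.*-monoˡ-≤-nonNeg r {{ℚ.nonNegative 0≤r}}

*-monoʳ : ∀ {r p q} → 0ℚ ℚ.≤ r → p ℚ.≤ q → p ℚ.* r ℚ.≤ q ℚ.* r
*-monoʳ {r} 0≤r = ℚₚ.*-monoʳ-≤-nonNeg r {{ℚ.nonNegative 0≤r}}

*-cancelˡ : ∀ {r p q} → 0ℚ ℚ.< r → r ℚ.* p ℚ.≤ r ℚ.* q → p ℚ.≤ q
*-cancelˡ {r} 0<r = ℚₚ.*-cancelˡ-≤-pos r {{ℚ.positive 0<r}}

*-nonNeg : ∀ {p q} → 0ℚ ℚ.≤ p → 0ℚ ℚ.≤ q → 0ℚ ℚ.≤ p ℚ.* q
*-nonNeg {p} {q} 0≤p 0≤q = subst (ℚ._≤ p ℚ.* q) (ℚₚ.*-zeroʳ p) (*-monoˡ 0≤p 0≤q)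

+-nonNeg : ∀ {p q} → 0ℚ ℚ.≤ p → 0ℚ ℚ.≤ q → 0ℚ ℚ.≤ p ℚ.+ q
+-nonNeg = ℚₚ.+-mono-≤

0<unit : ∀ n .{{_ : ℕ.NonZero n}} → 0ℚ ℚ.< unit n
0<unit n = ℚₚ.positive⁻¹ (unit n) {{ℚₚ.normalize-pos 1 n}}

0≤unit : ∀ n .{{_ : ℕ.NonZero n}} → 0ℚ ℚ.≤ unit n
0≤unit n = ℚₚ.<⇒≤ (0<unit n)

≤-unit : ∀ {p} n .{{_ : ℕ.NonZero n}} → ι n ℚ.* p ℚ.≤ 1ℚ → p ℚ.≤ unit n
≤-unit {p} n h = *-cancelˡ (0<ι n) (subst (ι n ℚ.* p ℚ.≤_) (sym (ι*unit n)) h)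

-- Averages

total : List ℚ → ℚ
total = foldr ℚ._+_ 0ℚ

module _ {A : Set} where

  total-mono : ∀ {F G : A → ℚ} → (∀ x → F x ℚ.≤ G x) → ∀ xs → total (map F xs) ℚ.≤ total (map G xs)
  total-mono F≤G []       = ℚₚ.≤-refl
  total-mono F≤G (x ∷ xs) = ℚₚ.+-mono-≤ (F≤G x) (total-mono F≤G xs)

  total-+ : ∀ (F G : A → ℚ) xs → total (map (λ x → F x ℚ.+ G x) xs) ≡ total (map F xs) ℚ.+ total (map G xs)
  total-+ F G []       = refl
  total-+ F G (x ∷ xs) = trans (cong (F x ℚ.+ G x ℚ.+_) (total-+ F G xs))
    (solve 4 (λ a b c d → (a :+ b) :+ (c :+ d) := (a :+ c) :+ (b :+ d)) refl (F x) (G x) (total (map F xs)) (total (map G xs)))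

  total-* : ∀ c (F : A → ℚ) xs → total (map (λ x → c ℚ.* F x) xs) ≡ c ℚ.* total (map F xs)
  total-* c F []       = sym (ℚₚ.*-zeroʳ c)
  total-* c F (x ∷ xs) = trans (cong (c ℚ.* F x ℚ.+_) (total-* c F xs))
    (sym (ℚₚ.*-distribˡ-+ c (F x) (total (map F xs))))

  total-const : ∀ c (xs : List A) → total (map (λ _ → c) xs) ≡ c ℚ.* ι (length xs)
  total-const c []       = sym (ℚₚ.*-zeroʳ c)
  total-const c (x ∷ xs) = trans (cong (c ℚ.+_) (total-const c xs))
    (trans (trans (cong (ℚ._+ c ℚ.* ι (length xs)) (sym (ℚₚ.*-identityʳ c)))
           (sym (ℚₚ.*-distribˡ-+ c (ι 1) (ι (length xs)))))
      (cong (c ℚ.*_) (sym (ι-+ 1 (length xs)))))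

  -- Zero on the empty list, in accordance with `average []`, so that `average-map` has no
  -- exception.
  weight : List A → ℚ
  weight []         = 0ℚ
  weight xs@(_ ∷ _) = unit (length xs)

  0≤weight : ∀ xs → 0ℚ ℚ.≤ weight xs
  0≤weight []       = ℚₚ.≤-refl
  0≤weight (x ∷ xs) = 0≤unit (suc (length xs))

  average-map : ∀ (F : A → ℚ) xs → average (map F xs) ≡ total (map F xs) ℚ.* weight xs
  average-map F []       = refl
  average-map F (x ∷ xs) rewrite length-map F xs = refl

  average-mono : ∀ {F G : A → ℚ} → (∀ x → F x ℚ.≤ G x) → ∀ xs → average (map F xs) ℚ.≤ average (map G xs)
  average-mono {F} {G} F≤G xs = subst₂ ℚ._≤_ (sym (average-map F xs)) (sym (average-map G xs))
    (*-monoʳ (0≤weight xs) (total-mono F≤G xs))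

  average-cong : ∀ {F G : A → ℚ} → (∀ x → F x ≡ G x) → ∀ xs → average (map F xs) ≡ average (map G xs)
  average-cong F≡G xs = ℚₚ.≤-antisym (average-mono (λ x → ℚₚ.≤-reflexive (F≡G x)) xs)
                                     (average-mono (λ x → ℚₚ.≤-reflexive (sym (F≡G x))) xs)

  average-+ : ∀ (F G : A → ℚ) xs → average (map (λ x → F x ℚ.+ G x) xs) ≡ average (map F xs) ℚ.+ average (map G xs)
  average-+ F G xs = trans (average-map _ xs) (trans (cong (ℚ._* weight xs) (total-+ F G xs))
    (trans (ℚₚ.*-distribʳ-+ (weight xs) (total (map F xs)) (total (map G xs)))
      (sym (cong₂ ℚ._+_ (average-map F xs) (average-map G xs)))))

  average-* : ∀ c (F : A → ℚ) xs → average (map (λ x → c ℚ.* F x) xs) ≡ c ℚ.* average (map F xs)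
  average-* c F xs = trans (average-map _ xs) (trans (cong (ℚ._* weight xs) (total-* c F xs))
    (trans (ℚₚ.*-assoc c (total (map F xs)) (weight xs)) (cong (c ℚ.*_) (sym (average-map F xs)))))

  -- Equality holds unless the list is empty.
  average-const : ∀ {c} → 0ℚ ℚ.≤ c → (xs : List A) → average (map (λ _ → c) xs) ℚ.≤ c
  average-const 0≤c []       = 0≤c
  average-const {c} 0≤c (x ∷ xs) = ℚₚ.≤-reflexive (trans (average-map (λ _ → c) (x ∷ xs))
    (trans (cong (ℚ._* unit (suc (length xs))) (total-const c (x ∷ xs)))
    (trans (ℚₚ.*-assoc c (ι (suc (length xs))) _)
    (trans (cong (c ℚ.*_) (ι*unit (suc (length xs)))) (ℚₚ.*-identityʳ c)))))

  average-nonNeg : ∀ {F : A → ℚ} → (∀ x → 0ℚ ℚ.≤ F x) → ∀ xs → 0ℚ ℚ.≤ average (map F xs)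
  average-nonNeg {F} 0≤F xs = subst (0ℚ ℚ.≤_) (sym (average-map F xs)) (*-nonNeg (go xs) (0≤weight xs))
    where
    go : ∀ xs → 0ℚ ℚ.≤ total (map F xs)
    go []       = ℚₚ.≤-refl
    go (x ∷ xs) = +-nonNeg (0≤F x) (go xs)

  -- The form in which the potential inequality passes through a draw or a reply. Nonnegativity of
  -- `B` matters for a forbidden query, whose empty list of replies has average 0.
  average-affine : ∀ {F G : A → ℚ} {B κ} → 0ℚ ℚ.≤ B → (∀ x → F x ℚ.≤ B ℚ.+ κ ℚ.* G x) →
                   ∀ xs → average (map F xs) ℚ.≤ B ℚ.+ κ ℚ.* average (map G xs)
  average-affine {F} {G} {B} {κ} 0≤B h xs = ℚₚ.≤-trans (average-mono h xs)
    (subst (ℚ._≤ B ℚ.+ κ ℚ.* average (map G xs))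
      (sym (trans (average-+ (λ _ → B) (λ x → κ ℚ.* G x) xs) (cong (average (map (λ _ → B) xs) ℚ.+_) (average-* κ G xs))))
      (ℚₚ.+-monoˡ-≤ (κ ℚ.* average (map G xs)) (average-const 0≤B xs)))

-- Expectations over partially revealed bits

mean : ℚ → ℚ → ℚ
mean p q = ½ ℚ.* (p ℚ.+ q)

mean-mono : ∀ {p p′ q q′} → p ℚ.≤ p′ → q ℚ.≤ q′ → mean p q ℚ.≤ mean p′ q′
mean-mono p≤p′ q≤q′ = *-monoˡ (ℚₚ.nonNegative⁻¹ ½) (ℚₚ.+-mono-≤ p≤p′ q≤q′)

mean-idem : ∀ p → mean p p ≡ p
mean-idem p = trans (ℚₚ.*-distribˡ-+ ½ p p) (half+half p)

mean-+ : ∀ p p′ q q′ → mean (p ℚ.+ p′) (q ℚ.+ q′) ≡ mean p q ℚ.+ mean p′ q′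
mean-+ = solve 5 (λ h p p′ q q′ → h :* ((p :+ p′) :+ (q :+ q′)) := h :* (p :+ q) :+ h :* (p′ :+ q′)) refl ½

mean-* : ∀ c p q → mean (c ℚ.* p) (c ℚ.* q) ≡ c ℚ.* mean p q
mean-* = solve 4 (λ h c p q → h :* (c :* p :+ c :* q) := c :* (h :* (p :+ q))) refl ½

mean-interchange : ∀ p p′ q q′ → mean (mean p p′) (mean q q′) ≡ mean (mean p q) (mean p′ q′)
mean-interchange = solve 5 (λ h p p′ q q′ → h :* (h :* (p :+ p′) :+ h :* (q :+ q′)) := h :* (h :* (p :+ q) :+ h :* (p′ :+ q′))) refl ½

-- The expectation of F when the bits left open by σ are independent and uniform.
E : ∀ {M} → Vec (Maybe Bool) M → (Vec Bool M → ℚ) → ℚ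
E []            F = F []
E (just c ∷ σ)  F = E σ (λ b → F (c ∷ b))
E (nothing ∷ σ) F = mean (E σ (λ b → F (false ∷ b))) (E σ (λ b → F (true ∷ b)))

E-mono : ∀ {M} (σ : Vec (Maybe Bool) M) {F G} → (∀ b → F b ℚ.≤ G b) → E σ F ℚ.≤ E σ G
E-mono []            F≤G = F≤G []
E-mono (just c ∷ σ)  F≤G = E-mono σ (λ b → F≤G (c ∷ b))
E-mono (nothing ∷ σ) F≤G = mean-mono (E-mono σ (λ b → F≤G (false ∷ b))) (E-mono σ (λ b → F≤G (true ∷ b)))

E-cong : ∀ {M} (σ : Vec (Maybe Bool) M) {F G} → (∀ b → F b ≡ G b) → E σ F ≡ E σ G
E-cong []            F≡G = F≡G []
E-cong (just c ∷ σ)  F≡G = E-cong σ (λ b → F≡G (c ∷ b))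
E-cong (nothing ∷ σ) F≡G = cong₂ mean (E-cong σ (λ b → F≡G (false ∷ b))) (E-cong σ (λ b → F≡G (true ∷ b)))

E-const : ∀ {M} (σ : Vec (Maybe Bool) M) c → E σ (λ _ → c) ≡ c
E-const []            c = refl
E-const (just _ ∷ σ)  c = E-const σ c
E-const (nothing ∷ σ) c = trans (cong₂ mean (E-const σ c) (E-const σ c)) (mean-idem c)

E-+ : ∀ {M} (σ : Vec (Maybe Bool) M) F G → E σ (λ b → F b ℚ.+ G b) ≡ E σ F ℚ.+ E σ G
E-+ []            F G = refl
E-+ (just _ ∷ σ)  F G = E-+ σ _ _
E-+ (nothing ∷ σ) F G = trans (cong₂ mean (E-+ σ _ _) (E-+ σ _ _))
  (mean-+ (E σ (λ b → F (false ∷ b))) (E σ (λ b → G (false ∷ b))) (E σ (λ b → F (true ∷ b))) (E σ (λ b → G (true ∷ b))))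

-- Fubini for the hidden bits and the randomness of a run; the list `xs` must be the same for all
-- bit vectors.
E-average : ∀ {M} (σ : Vec (Maybe Bool) M) {A : Set} (F : Vec Bool M → A → ℚ) xs →
            E σ (λ b → average (map (F b) xs)) ≡ average (map (λ x → E σ (λ b → F b x)) xs)
E-average []            F xs = refl
E-average (just _ ∷ σ)  F xs = E-average σ _ xs
E-average (nothing ∷ σ) F xs = trans
  (cong₂ mean (E-average σ (λ b → F (false ∷ b)) xs) (E-average σ (λ b → F (true ∷ b)) xs))
  (sym (trans (average-* ½ (λ x → F₀ x ℚ.+ F₁ x) xs) (cong (½ ℚ.*_) (average-+ F₀ F₁ xs))))
  where
  F₀ F₁ : _ → ℚ
  F₀ x = E σ (λ b → F (false ∷ b) x)
  F₁ x = E σ (λ b → F (true ∷ b) x)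

-- Conditioning: only vectors that carry the bit fixed by `σ` contribute, so `F` and `G` may differ
-- elsewhere. This replaces the replies to a query by those that the known bit determines.
E-cong-known : ∀ {M} (σ : Vec (Maybe Bool) M) i {c F G} → lookup σ i ≡ just c →
               (∀ b → lookup b i ≡ c → F b ≡ G b) → E σ F ≡ E σ G
E-cong-known (just c ∷ σ)  zero    refl h = E-cong σ (λ b → h (c ∷ b) refl)
E-cong-known (just c ∷ σ)  (suc i) e    h = E-cong-known σ i e (λ b → h (c ∷ b))
E-cong-known (nothing ∷ σ) (suc i) e    h =
  cong₂ mean (E-cong-known σ i e (λ b → h (false ∷ b))) (E-cong-known σ i e (λ b → h (true ∷ b)))

-- Total expectation over one open bit. `E` averages from the front, so the mean over bit `i` has to
-- be moved outwards past the earlier ones by `mean-interchange`.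
E-split : ∀ {M} (σ : Vec (Maybe Bool) M) i {F} → lookup σ i ≡ nothing →
          E σ F ≡ mean (E (σ [ i ]≔ just false) F) (E (σ [ i ]≔ just true) F)
E-split (nothing ∷ σ) zero    e = refl
E-split (just c ∷ σ)  (suc i) e = E-split σ i e
E-split (nothing ∷ σ) (suc i) {F} e = trans (cong₂ mean (E-split σ i e) (E-split σ i e))
  (mean-interchange (E (σ [ i ]≔ just false) (λ b → F (false ∷ b))) (E (σ [ i ]≔ just true) (λ b → F (false ∷ b)))
                    (E (σ [ i ]≔ just false) (λ b → F (true ∷ b))) (E (σ [ i ]≔ just true) (λ b → F (true ∷ b))))

known unknown : ∀ {M} → Vec (Maybe Bool) M → ℕ
known []            = 0
known (just _ ∷ σ)  = suc (known σ)
known (nothing ∷ σ) = known σ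
unknown []            = 0
unknown (just _ ∷ σ)  = unknown σ
unknown (nothing ∷ σ) = suc (unknown σ)

known+unknown : ∀ {M} (σ : Vec (Maybe Bool) M) → known σ ℕ.+ unknown σ ≡ M
known+unknown []            = refl
known+unknown (just _ ∷ σ)  = cong suc (known+unknown σ)
known+unknown (nothing ∷ σ) = trans (ℕₚ.+-suc (known σ) (unknown σ)) (cong suc (known+unknown σ))

known-reveal : ∀ {M} (σ : Vec (Maybe Bool) M) i c → lookup σ i ≡ nothing → known (σ [ i ]≔ just c) ≡ suc (known σ)
known-reveal (nothing ∷ σ) zero    c e = refl
known-reveal (just _ ∷ σ)  (suc i) c e = cong suc (known-reveal σ i c e)
known-reveal (nothing ∷ σ) (suc i) c e = known-reveal σ i c e

allOpen : ∀ M → Vec (Maybe Bool) M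
allOpen M = Vec.replicate M nothing

known-allOpen : ∀ M → known (allOpen M) ≡ 0
known-allOpen zero    = refl
known-allOpen (suc M) = known-allOpen M

-- Provides one number of actions that is long enough for the runs on all matrices.
≤maximum : ∀ {M} (F : Vec Bool M → ℕ) → ∃[ T ] (∀ b → F b ℕ.≤ T)
≤maximum {zero}  F = F [] , λ { [] → ℕₚ.≤-refl }
≤maximum {suc M} F with ≤maximum (λ b → F (false ∷ b)) | ≤maximum (λ b → F (true ∷ b))
... | T₀ , h₀ | T₁ , h₁ = T₀ ℕ.⊔ T₁ , λ where
  (false ∷ b) → ℕₚ.≤-trans (h₀ b) (ℕₚ.m≤m⊔n T₀ T₁)
  (true ∷ b)  → ℕₚ.≤-trans (h₁ b) (ℕₚ.m≤n⊔m T₀ T₁)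

-- The averaging step from a random matrix to a fixed one.
E≤some : ∀ {M} (σ : Vec (Maybe Bool) M) F → ∃[ b ] (E σ F ℚ.≤ F b)
E≤some []            F = [] , ℚₚ.≤-refl
E≤some (just c ∷ σ)  F with E≤some σ (λ b → F (c ∷ b))
... | b , h = c ∷ b , h
E≤some (nothing ∷ σ) F with E≤some σ (λ b → F (false ∷ b)) | E≤some σ (λ b → F (true ∷ b))
... | b₀ , h₀ | b₁ , h₁ with ℚₚ.≤-total (F (false ∷ b₀)) (F (true ∷ b₁))
...   | inj₁ 0≤1 = true ∷ b₁ , ℚₚ.≤-trans (mean-mono (ℚₚ.≤-trans h₀ 0≤1) h₁) (ℚₚ.≤-reflexive (mean-idem _))
...   | inj₂ 1≤0 = false ∷ b₀ , ℚₚ.≤-trans (mean-mono h₀ (ℚₚ.≤-trans h₁ 1≤0)) (ℚₚ.≤-reflexive (mean-idem _))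

-- Exhaustion of the cube; it yields the reference vector around which the window of `E-close` is
-- placed.
search : ∀ {M} (P : Vec Bool M → Bool) → (∃[ b ] P b ≡ true) ⊎ (∀ b → P b ≡ false)
search {zero}  P with P [] in e
... | true  = inj₁ ([] , e)
... | false = inj₂ λ { [] → e }
search {suc M} P with search (λ b → P (false ∷ b)) | search (λ b → P (true ∷ b))
... | inj₁ (b , e) | _            = inj₁ (false ∷ b , e)
... | inj₂ _       | inj₁ (b , e) = inj₁ (true ∷ b , e)
... | inj₂ h₀      | inj₂ h₁      = inj₂ λ { (false ∷ b) → h₀ b ; (true ∷ b) → h₁ b }

-- Binomial coefficients

square-cancel-≤ : ∀ {a b} → a ℕ.* a ℕ.≤ b ℕ.* b → a ℕ.≤ b
square-cancel-≤ {a} {b} h with ℕₚ.≤-<-connex a b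
... | inj₁ a≤b = a≤b
... | inj₂ b<a = ⊥-elim (ℕₚ.<⇒≱ (ℕₚ.*-mono-< b<a b<a) h)

≡ᵇ-refl : ∀ n → (n ℕ.≡ᵇ n) ≡ true
≡ᵇ-refl zero    = refl
≡ᵇ-refl (suc n) = ≡ᵇ-refl n

≡ᵇ-shift : ∀ n k → (n ℕ.≡ᵇ n ℕ.+ suc k) ≡ false
≡ᵇ-shift zero    k = refl
≡ᵇ-shift (suc n) k = ≡ᵇ-shift n k

nC0≡1 : ∀ n → n C 0 ≡ 1
nC0≡1 n = trans (cong (n C_) (sym (ℕₚ.n∸n≡0 n))) (trans (sym (nCk≡nC[n∸k] (ℕₚ.≤-refl {n}))) (nCn≡1 n))

-- The rule (k + 1) C(n, k + 1) = (n - k) C(n, k) without its subtraction, so that k > n is covered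
-- too. In the main case Pascal's rule splits both coefficients, and the pieces regroup into two
-- instances for `n`.
C-absorption : ∀ n k → suc k ℕ.* (n C suc k) ℕ.+ k ℕ.* (n C k) ≡ n ℕ.* (n C k)
C-absorption zero    zero    = refl
C-absorption zero    (suc k) = trans (cong₂ (λ x y → suc (suc k) ℕ.* x ℕ.+ suc k ℕ.* y)
  (k>n⇒nCk≡0 {0} {suc (suc k)} (ℕ.s≤s ℕ.z≤n)) (k>n⇒nCk≡0 {0} {suc k} (ℕ.s≤s ℕ.z≤n)))
  (cong₂ ℕ._+_ (ℕₚ.*-zeroʳ (suc (suc k))) (ℕₚ.*-zeroʳ (suc k)))
C-absorption (suc n) zero    = begin
  1 ℕ.* (suc n C 1) ℕ.+ 0            ≡⟨ ℕₚ.+-identityʳ _ ⟩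
  1 ℕ.* (suc n C 1)                  ≡⟨ ℕₚ.*-identityˡ _ ⟩
  suc n C 1                          ≡⟨ nCk+nC[k+1]≡[n+1]C[k+1] n 0 ⟨
  n C 0 ℕ.+ n C 1                    ≡⟨ cong (n C 0 ℕ.+_) (trans (sym (ℕₚ.*-identityˡ (n C 1))) (sym (ℕₚ.+-identityʳ _))) ⟩
  n C 0 ℕ.+ (1 ℕ.* (n C 1) ℕ.+ 0)    ≡⟨ cong (n C 0 ℕ.+_) (C-absorption n 0) ⟩
  n C 0 ℕ.+ n ℕ.* (n C 0)            ≡⟨⟩
  suc n ℕ.* (n C 0)                  ≡⟨ cong (suc n ℕ.*_) (trans (nC0≡1 n) (sym (nC0≡1 (suc n)))) ⟩
  suc n ℕ.* (suc n C 0)              ∎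
  where open ≡-Reasoning
C-absorption (suc n) (suc k) = begin
  suc (suc k) ℕ.* (suc n C suc (suc k)) ℕ.+ suc k ℕ.* (suc n C suc k)
    ≡⟨ cong₂ (λ u v → suc (suc k) ℕ.* u ℕ.+ suc k ℕ.* v)
         (nCk+nC[k+1]≡[n+1]C[k+1] n (suc k)) (nCk+nC[k+1]≡[n+1]C[k+1] n k) ⟨
  suc (suc k) ℕ.* (y ℕ.+ z) ℕ.+ suc k ℕ.* (x ℕ.+ y)
    ≡⟨ regroup k x y z ⟩
  suc (suc k) ℕ.* z ℕ.+ suc k ℕ.* y ℕ.+ (suc k ℕ.* y ℕ.+ k ℕ.* x) ℕ.+ (x ℕ.+ y)
    ≡⟨ cong₂ (λ u v → u ℕ.+ v ℕ.+ (x ℕ.+ y)) (C-absorption n (suc k)) (C-absorption n k) ⟩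
  n ℕ.* y ℕ.+ n ℕ.* x ℕ.+ (x ℕ.+ y)
    ≡⟨ collect n x y ⟩
  suc n ℕ.* (x ℕ.+ y)
    ≡⟨ cong (suc n ℕ.*_) (nCk+nC[k+1]≡[n+1]C[k+1] n k) ⟩
  suc n ℕ.* (suc n C suc k) ∎
  where
  open ≡-Reasoning
  x = n C k
  y = n C suc k
  z = n C suc (suc k)
  regroup : ∀ k x y z → suc (suc k) ℕ.* (y ℕ.+ z) ℕ.+ suc k ℕ.* (x ℕ.+ y) ≡
            suc (suc k) ℕ.* z ℕ.+ suc k ℕ.* y ℕ.+ (suc k ℕ.* y ℕ.+ k ℕ.* x) ℕ.+ (x ℕ.+ y)
  regroup = solve-∀
  collect : ∀ n x y → n ℕ.* y ℕ.+ n ℕ.* x ℕ.+ (x ℕ.+ y) ≡ suc n ℕ.* (x ℕ.+ y)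
  collect = solve-∀

-- By absorption the ratio of the two coefficients is (n - k)/(k + 1), which is at most 1 in the
-- upper half.
C-descend : ∀ n k → n ℕ.≤ suc (k ℕ.+ k) → n C suc k ℕ.≤ n C k
C-descend n k n≤2k+1 = ℕₚ.*-cancelˡ-≤ (suc k) (ℕₚ.+-cancelʳ-≤ (k ℕ.* (n C k)) _ _ (begin
  suc k ℕ.* (n C suc k) ℕ.+ k ℕ.* (n C k) ≡⟨ C-absorption n k ⟩
  n ℕ.* (n C k)                           ≤⟨ ℕₚ.*-monoˡ-≤ (n C k) n≤2k+1 ⟩
  suc (k ℕ.+ k) ℕ.* (n C k)               ≡⟨ ℕₚ.*-distribʳ-+ (n C k) (suc k) k ⟩
  suc k ℕ.* (n C k) ℕ.+ k ℕ.* (n C k)     ∎))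
  where open ℕₚ.≤-Reasoning

C-upper-half : ∀ n d → (n ℕ.+ n) C (d ℕ.+ n) ℕ.≤ (n ℕ.+ n) C n
C-upper-half n zero    = ℕₚ.≤-refl
C-upper-half n (suc d) = ℕₚ.≤-trans
  (C-descend (n ℕ.+ n) (d ℕ.+ n) (ℕₚ.m≤n⇒m≤1+n (ℕₚ.+-mono-≤ (ℕₚ.m≤n+m n d) (ℕₚ.m≤n+m n d))))
  (C-upper-half n d)

-- The upper half descends from the centre, and the lower half is its reflection.
C-central-max : ∀ n k → (n ℕ.+ n) C k ℕ.≤ (n ℕ.+ n) C n
C-central-max n k with ℕₚ.≤-total n k
... | inj₁ n≤k = subst (λ j → (n ℕ.+ n) C j ℕ.≤ (n ℕ.+ n) C n) (ℕₚ.m∸n+n≡m n≤k) (C-upper-half n (k ℕ.∸ n))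
... | inj₂ k≤n = subst (ℕ._≤ (n ℕ.+ n) C n)
  (trans (cong ((n ℕ.+ n) C_) (sym (trans (ℕₚ.+-∸-assoc n k≤n) (ℕₚ.+-comm n (n ℕ.∸ k)))))
         (sym (nCk≡nC[n∸k] (ℕₚ.≤-trans k≤n (ℕₚ.m≤m+n n n)))))
  (C-upper-half n (n ℕ.∸ k))

central : ℕ → ℕ
central n = (n ℕ.+ n) C n

central-suc : ∀ n → suc n ℕ.* central (suc n) ≡ 2 ℕ.* (suc (n ℕ.+ n) ℕ.* central n)
central-suc n = begin
  suc n ℕ.* ((suc n ℕ.+ suc n) C suc n)   ≡⟨ cong (λ j → suc n ℕ.* (j C suc n)) (ℕₚ.+-suc (suc n) n) ⟩
  suc n ℕ.* (suc N C suc n)             ≡⟨ cong (suc n ℕ.*_) (nCk+nC[k+1]≡[n+1]C[k+1] N n) ⟨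
  suc n ℕ.* (N C n ℕ.+ N C suc n)       ≡⟨ cong (λ x → suc n ℕ.* (x ℕ.+ N C suc n)) symmetric ⟨
  suc n ℕ.* (N C suc n ℕ.+ N C suc n)   ≡⟨ double n (N C suc n) ⟩
  2 ℕ.* (suc n ℕ.* (N C suc n))         ≡⟨ cong (2 ℕ.*_) below ⟩
  2 ℕ.* (N ℕ.* central n)               ∎
  where
  open ≡-Reasoning
  N = suc (n ℕ.+ n)
  double : ∀ n x → suc n ℕ.* (x ℕ.+ x) ≡ 2 ℕ.* (suc n ℕ.* x)
  double = solve-∀
  -- The two middle coefficients of the odd row agree, because N = (n + 1) + n turns absorption into
  -- an equation with the same summand n C(N, n) on both sides.
  symmetric : N C suc n ≡ N C n
  symmetric = ℕₚ.*-cancelˡ-≡ _ _ (suc n) (ℕₚ.+-cancelʳ-≡ (n ℕ.* (N C n)) _ _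
    (trans (C-absorption N n) (ℕₚ.*-distribʳ-+ (N C n) (suc n) n)))
  below : suc n ℕ.* (N C suc n) ≡ N ℕ.* central n
  below = begin
    suc n ℕ.* (N C suc n)                                        ≡⟨ cong (suc n ℕ.*_) (nCk+nC[k+1]≡[n+1]C[k+1] (n ℕ.+ n) n) ⟨
    suc n ℕ.* (central n ℕ.+ (n ℕ.+ n) C suc n)                  ≡⟨ spread n (central n) ((n ℕ.+ n) C suc n) ⟩
    central n ℕ.+ (suc n ℕ.* ((n ℕ.+ n) C suc n) ℕ.+ n ℕ.* central n) ≡⟨ cong (central n ℕ.+_) (C-absorption (n ℕ.+ n) n) ⟩
    N ℕ.* central n                                              ∎
    where
    spread : ∀ n x y → suc n ℕ.* (x ℕ.+ y) ≡ x ℕ.+ (suc n ℕ.* y ℕ.+ n ℕ.* x)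
    spread = solve-∀

power : ℕ → ℕ
power n = 2 ℕ.^ n

-- C(2n, n) ≤ 4ⁿ/√(2n + 1) in squared form, which keeps the induction in the naturals. By
-- `central-suc` the step reduces to (2n + 1)(2n + 3) ≤ 4 (n + 1)², where the two sides differ by 1.
central-bound : ∀ n → central n ℕ.* central n ℕ.* suc (n ℕ.+ n) ℕ.≤ power (n ℕ.+ n) ℕ.* power (n ℕ.+ n)
central-bound zero    = ℕₚ.≤-refl
central-bound (suc n) = ℕₚ.*-cancelˡ-≤ (suc n ℕ.* suc n) (begin
  suc n ℕ.* suc n ℕ.* (c′ ℕ.* c′ ℕ.* suc (suc n ℕ.+ suc n))
    ≡⟨ pair (suc n) c′ (suc (suc n ℕ.+ suc n)) ⟩
  suc n ℕ.* c′ ℕ.* (suc n ℕ.* c′) ℕ.* suc (suc n ℕ.+ suc n)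
    ≡⟨ cong (λ x → x ℕ.* x ℕ.* suc (suc n ℕ.+ suc n)) (central-suc n) ⟩
  2 ℕ.* (N ℕ.* c) ℕ.* (2 ℕ.* (N ℕ.* c)) ℕ.* suc (suc n ℕ.+ suc n)
    ≡⟨ expose n c ⟩
  4 ℕ.* (c ℕ.* c ℕ.* N) ℕ.* (N ℕ.* suc (suc n ℕ.+ suc n))
    ≤⟨ ℕₚ.*-mono-≤ (ℕₚ.*-monoʳ-≤ 4 (central-bound n)) (ℕₚ.m+n≤o⇒m≤o _ (ℕₚ.≤-reflexive (square n))) ⟩
  4 ℕ.* (p ℕ.* p) ℕ.* (4 ℕ.* (suc n ℕ.* suc n))
    ≡⟨ pull p (suc n ℕ.* suc n) ⟩
  suc n ℕ.* suc n ℕ.* (2 ℕ.* (2 ℕ.* p) ℕ.* (2 ℕ.* (2 ℕ.* p)))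
    ≡⟨ cong (λ j → suc n ℕ.* suc n ℕ.* (2 ℕ.* power j ℕ.* (2 ℕ.* power j))) (ℕₚ.+-suc n n) ⟨
  suc n ℕ.* suc n ℕ.* (power (suc n ℕ.+ suc n) ℕ.* power (suc n ℕ.+ suc n)) ∎)
  where
  open ℕₚ.≤-Reasoning
  c = central n
  c′ = central (suc n)
  N = suc (n ℕ.+ n)
  p = power (n ℕ.+ n)
  pair : ∀ a b d → a ℕ.* a ℕ.* (b ℕ.* b ℕ.* d) ≡ a ℕ.* b ℕ.* (a ℕ.* b) ℕ.* d
  pair = solve-∀
  expose : ∀ n c → 2 ℕ.* (suc (n ℕ.+ n) ℕ.* c) ℕ.* (2 ℕ.* (suc (n ℕ.+ n) ℕ.* c)) ℕ.* suc (suc n ℕ.+ suc n) ≡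
           4 ℕ.* (c ℕ.* c ℕ.* suc (n ℕ.+ n)) ℕ.* (suc (n ℕ.+ n) ℕ.* suc (suc n ℕ.+ suc n))
  expose = solve-∀
  square : ∀ n → suc (n ℕ.+ n) ℕ.* suc (suc n ℕ.+ suc n) ℕ.+ 1 ≡ 4 ℕ.* (suc n ℕ.* suc n)
  square = solve-∀
  pull : ∀ p a → 4 ℕ.* (p ℕ.* p) ℕ.* (4 ℕ.* a) ≡ a ℕ.* (2 ℕ.* (2 ℕ.* p) ℕ.* (2 ℕ.* (2 ℕ.* p)))
  pull = solve-∀

central-sqrt : ∀ n q → q ℕ.* q ℕ.≤ suc (n ℕ.+ n) → q ℕ.* central n ℕ.≤ power (n ℕ.+ n)
central-sqrt n q q²≤ = square-cancel-≤ (begin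
  q ℕ.* c ℕ.* (q ℕ.* c)       ≡⟨ swap q c ⟩
  c ℕ.* c ℕ.* (q ℕ.* q)       ≤⟨ ℕₚ.*-monoʳ-≤ (c ℕ.* c) q²≤ ⟩
  c ℕ.* c ℕ.* suc (n ℕ.+ n)   ≤⟨ central-bound n ⟩
  power (n ℕ.+ n) ℕ.* power (n ℕ.+ n) ∎)
  where
  open ℕₚ.≤-Reasoning
  c = central n
  swap : ∀ q c → q ℕ.* c ℕ.* (q ℕ.* c) ≡ c ℕ.* c ℕ.* (q ℕ.* q)
  swap = solve-∀

-- Anticoncentration

indicator : Bool → ℚ
indicator c = if c then 1ℚ else 0ℚ

ones : ∀ {M} → Vec Bool M → ℕ
ones []          = 0
ones (false ∷ b) = ones b
ones (true ∷ b)  = suc (ones b)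

-- The probability that c plus a sum of u independent uniform bits is x.
point : ℕ → ℕ → ℕ → ℚ
point zero    c x = indicator (c ℕ.≡ᵇ x)
point (suc u) c x = mean (point u c x) (point u (suc c) x)

knownOnes : ∀ {M} → Vec (Maybe Bool) M → ℕ
knownOnes []               = 0
knownOnes (nothing ∷ σ)    = knownOnes σ
knownOnes (just false ∷ σ) = knownOnes σ
knownOnes (just true ∷ σ)  = suc (knownOnes σ)

-- The law of the number of ones sees only how many bits are open and how many known bits are ones;
-- the offset `c` collects the ones already passed in the recursion.
E-point : ∀ {M} (σ : Vec (Maybe Bool) M) c x →
          E σ (λ b → indicator (c ℕ.+ ones b ℕ.≡ᵇ x)) ≡ point (unknown σ) (c ℕ.+ knownOnes σ) x
E-point []               c x = refl
E-point (just false ∷ σ) c x = E-point σ c x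
E-point (just true ∷ σ)  c x = trans
  (E-cong σ (λ b → cong (λ s → indicator (s ℕ.≡ᵇ x)) (ℕₚ.+-suc c (ones b))))
  (trans (E-point σ (suc c) x) (cong (λ s → point (unknown σ) s x) (sym (ℕₚ.+-suc c (knownOnes σ)))))
E-point (nothing ∷ σ)    c x = cong₂ mean (E-point σ c x) (trans
  (E-cong σ (λ b → cong (λ s → indicator (s ℕ.≡ᵇ x)) (ℕₚ.+-suc c (ones b)))) (E-point σ (suc c) x))

point-past : ∀ u c x → x ℕ.< c → point u c x ≡ 0ℚ
point-past zero    c x x<c with c ℕ.≡ᵇ x in e
... | false = refl
... | true  = ⊥-elim (ℕₚ.<-irrefl (sym (ℕₚ.≡ᵇ⇒≡ c x (subst T (sym e) _))) x<c)
point-past (suc u) c x x<c = trans (cong₂ mean (point-past u c x x<c) (point-past u (suc c) x (ℕₚ.m<n⇒m<1+n x<c))) (mean-idem 0ℚ)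

mean-double : ∀ w p q → (ι 2 ℚ.* w) ℚ.* mean p q ≡ w ℚ.* p ℚ.+ w ℚ.* q
mean-double w p q = trans
  (solve 5 (λ t h w p q → (t :* w) :* (h :* (p :+ q)) := (t :* h) :* (w :* p :+ w :* q)) refl (ι 2) ½ w p q)
  (ℚₚ.*-identityˡ _)

-- The recursion of `point` is Pascal's rule: after the next bit, `k` or `k − 1` ones are still to
-- come. For `k = 0` the second case has overshot and contributes nothing.
point-C : ∀ u c k → ι (power u) ℚ.* point u c (c ℕ.+ k) ≡ ι (u C k)
point-C zero c zero = trans (ℚₚ.*-identityˡ _) (cong indicator (trans (cong (c ℕ.≡ᵇ_) (ℕₚ.+-identityʳ c)) (≡ᵇ-refl c)))
point-C zero c (suc k) = trans (ℚₚ.*-identityˡ _)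
  (trans (cong indicator (≡ᵇ-shift c k)) (cong ι (sym (k>n⇒nCk≡0 {0} {suc k} (ℕ.s≤s ℕ.z≤n)))))
point-C (suc u) c k = trans (cong (ℚ._* point (suc u) c (c ℕ.+ k)) (ι-* 2 (power u)))
  (trans (mean-double (ι (power u)) (point u c (c ℕ.+ k)) (point u (suc c) (c ℕ.+ k)))
  (trans (cong (ℚ._+ ι (power u) ℚ.* point u (suc c) (c ℕ.+ k)) (point-C u c k)) (rest k)))
  where
  rest : ∀ k → ι (u C k) ℚ.+ ι (power u) ℚ.* point u (suc c) (c ℕ.+ k) ≡ ι (suc u C k)
  rest zero = trans (cong (λ p → ι (u C 0) ℚ.+ ι (power u) ℚ.* p) (point-past u (suc c) (c ℕ.+ 0) (ℕ.s≤s (ℕₚ.≤-reflexive (ℕₚ.+-identityʳ c)))))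
    (trans (cong (ι (u C 0) ℚ.+_) (ℚₚ.*-zeroʳ (ι (power u)))) (trans (ℚₚ.+-identityʳ (ι (u C 0))) (cong ι (trans (nC0≡1 u) (sym (nC0≡1 (suc u)))))))
  rest (suc k) = trans (cong (λ x → ι (u C suc k) ℚ.+ ι (power u) ℚ.* point u (suc c) x) (ℕₚ.+-suc c k))
    (trans (cong (ι (u C suc k) ℚ.+_) (point-C u (suc c) k))
    (trans (sym (ι-+ (u C suc k) (u C k))) (cong ι (trans (ℕₚ.+-comm (u C suc k) (u C k)) (nCk+nC[k+1]≡[n+1]C[k+1] u k)))))

-- Values below `c` are never attained; any other has a binomial coefficient divided by a power of
-- two, at most the central one. The number `q` stands for a square root of 2n + 1 rounded down, or
-- anything smaller.
point-bound : ∀ n q .{{_ : ℕ.NonZero q}} → q ℕ.* q ℕ.≤ suc (n ℕ.+ n) → ∀ c x → point (n ℕ.+ n) c x ℚ.≤ unit q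
point-bound n q q²≤ c x with ℕₚ.<-≤-connex x c
... | inj₁ x<c = subst (ℚ._≤ unit q) (sym (point-past (n ℕ.+ n) c x x<c)) (0≤unit q)
... | inj₂ c≤x = ≤-unit q (*-cancelˡ (0<ι (power (n ℕ.+ n)) {{ℕₚ.m^n≢0 2 (n ℕ.+ n)}}) (begin
  ι (power (n ℕ.+ n)) ℚ.* (ι q ℚ.* point (n ℕ.+ n) c x)
    ≡⟨ solve 3 (λ a b d → a :* (b :* d) := b :* (a :* d)) refl (ι (power (n ℕ.+ n))) (ι q) (point (n ℕ.+ n) c x) ⟩
  ι q ℚ.* (ι (power (n ℕ.+ n)) ℚ.* point (n ℕ.+ n) c x)
    ≡⟨ cong (λ y → ι q ℚ.* (ι (power (n ℕ.+ n)) ℚ.* point (n ℕ.+ n) c y)) (ℕₚ.m+[n∸m]≡n c≤x) ⟨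
  ι q ℚ.* (ι (power (n ℕ.+ n)) ℚ.* point (n ℕ.+ n) c (c ℕ.+ (x ℕ.∸ c)))
    ≡⟨ cong (ι q ℚ.*_) (point-C (n ℕ.+ n) c (x ℕ.∸ c)) ⟩
  ι q ℚ.* ι ((n ℕ.+ n) C (x ℕ.∸ c))
    ≤⟨ *-monoˡ (0≤ι q) (ι-mono-≤ (C-central-max n (x ℕ.∸ c))) ⟩
  ι q ℚ.* ι (central n)
    ≡⟨ ι-* q (central n) ⟨
  ι (q ℕ.* central n)
    ≤⟨ ι-mono-≤ (central-sqrt n q q²≤) ⟩
  ι (power (n ℕ.+ n))
    ≡⟨ ℚₚ.*-identityʳ _ ⟨
  ι (power (n ℕ.+ n)) ℚ.* 1ℚ ∎))
  where open ℚₚ.≤-Reasoning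

-- One more bit averages two laws under the same bound, so a bound obtained for an even number of
-- bits survives any further ones.
point-bound-+ : ∀ {u P} → (∀ c x → point u c x ℚ.≤ P) → ∀ v c x → point (v ℕ.+ u) c x ℚ.≤ P
point-bound-+ h zero    c x = h c x
point-bound-+ {P = P} h (suc v) c x = ℚₚ.≤-trans
  (mean-mono (point-bound-+ h v c x) (point-bound-+ h v (suc c) x)) (ℚₚ.≤-reflexive (mean-idem P))

-- The window of `W` values starting at `x`, as a sum of indicators, so that its expectation splits
-- by linearity into point probabilities.
inWindow : ℕ → ℕ → ℕ → ℚ
inWindow x zero    s = 0ℚ
inWindow x (suc W) s = indicator (s ℕ.≡ᵇ x ℕ.+ W) ℚ.+ inWindow x W s

0≤indicator : ∀ c → 0ℚ ℚ.≤ indicator c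
0≤indicator false = ℚₚ.≤-refl
0≤indicator true  = ℚₚ.nonNegative⁻¹ 1ℚ

indicator≤1 : ∀ c → indicator c ℚ.≤ 1ℚ
indicator≤1 false = ℚₚ.nonNegative⁻¹ 1ℚ
indicator≤1 true  = ℚₚ.≤-refl

0≤inWindow : ∀ x W s → 0ℚ ℚ.≤ inWindow x W s
0≤inWindow x zero    s = ℚₚ.≤-refl
0≤inWindow x (suc W) s = +-nonNeg (0≤indicator (s ℕ.≡ᵇ x ℕ.+ W)) (0≤inWindow x W s)

1≤inWindow : ∀ x W s → x ℕ.≤ s → s ℕ.< x ℕ.+ W → 1ℚ ℚ.≤ inWindow x W s
1≤inWindow x zero    s x≤s s<x   = ⊥-elim (ℕₚ.<-irrefl refl (ℕₚ.<-≤-trans (subst (s ℕ.<_) (ℕₚ.+-identityʳ x) s<x) x≤s))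
1≤inWindow x (suc W) s x≤s s<x+W with ℕₚ.m≤n⇒m<n∨m≡n (ℕ.s≤s⁻¹ (subst (s ℕ.<_) (ℕₚ.+-suc x W) s<x+W))
... | inj₁ lt   = ℚₚ.≤-trans (1≤inWindow x W s x≤s lt)
  (subst (ℚ._≤ inWindow x (suc W) s) (ℚₚ.+-identityˡ _) (ℚₚ.+-monoˡ-≤ (inWindow x W s) (0≤indicator (s ℕ.≡ᵇ x ℕ.+ W))))
... | inj₂ refl = subst (ℚ._≤ inWindow x (suc W) s) (ℚₚ.+-identityʳ 1ℚ)
  (ℚₚ.+-mono-≤ (ℚₚ.≤-reflexive (sym (cong indicator (≡ᵇ-refl (x ℕ.+ W))))) (0≤inWindow x W (x ℕ.+ W)))

E-window : ∀ {M} (σ : Vec (Maybe Bool) M) {P} → (∀ c x → point (unknown σ) c x ℚ.≤ P) →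
           ∀ x W → E σ (λ b → inWindow x W (ones b)) ℚ.≤ ι W ℚ.* P
E-window σ {P} h x zero    = ℚₚ.≤-reflexive (trans (E-const σ 0ℚ) (sym (ℚₚ.*-zeroˡ P)))
E-window σ {P} h x (suc W) = subst₂ ℚ._≤_
  (sym (E-+ σ (λ b → indicator (ones b ℕ.≡ᵇ x ℕ.+ W)) (λ b → inWindow x W (ones b))))
  (trans (cong (ℚ._+ ι W ℚ.* P) (sym (ℚₚ.*-identityˡ P))) (trans (sym (ℚₚ.*-distribʳ-+ P (ι 1) (ι W))) (cong (ℚ._* P) (sym (ι-+ 1 W)))))
  (ℚₚ.+-mono-≤ (subst (ℚ._≤ P) (sym (E-point σ 0 (x ℕ.+ W))) (h (knownOnes σ) (x ℕ.+ W))) (E-window σ h x W))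

-- All accepted vectors have counts within `w` of the count of any single one of them, hence in a
-- window of 2w + 1 values around it. If none is accepted, any window will do.
E-close : ∀ {M} (σ : Vec (Maybe Bool) M) {P} → (∀ c x → point (unknown σ) c x ℚ.≤ P) →
          ∀ w (accept : Vec Bool M → Bool) →
          (∀ b b′ → accept b ≡ true → accept b′ ≡ true → ones b ℕ.≤ ones b′ ℕ.+ w) →
          E σ (λ b → indicator (accept b)) ℚ.≤ ι (suc (w ℕ.+ w)) ℚ.* P
E-close σ {P} h w accept close with search accept
... | inj₂ none = ℚₚ.≤-trans (E-mono σ {G = λ b → inWindow 0 (suc (w ℕ.+ w)) (ones b)} λ b →
    subst (λ c → indicator c ℚ.≤ inWindow 0 (suc (w ℕ.+ w)) (ones b)) (sym (none b)) (0≤inWindow 0 (suc (w ℕ.+ w)) (ones b)))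
    (E-window σ h 0 (suc (w ℕ.+ w)))
... | inj₁ (b₀ , e₀) = ℚₚ.≤-trans (E-mono σ below) (E-window σ h x₀ (suc (w ℕ.+ w)))
  where
  x₀ = ones b₀ ℕ.∸ w
  below : ∀ b → indicator (accept b) ℚ.≤ inWindow x₀ (suc (w ℕ.+ w)) (ones b)
  below b with accept b in e
  ... | false = 0≤inWindow x₀ (suc (w ℕ.+ w)) (ones b)
  ... | true  = 1≤inWindow x₀ (suc (w ℕ.+ w)) (ones b)
    (ℕₚ.m≤n+o⇒m∸n≤o (ones b₀) w (subst (ones b₀ ℕ.≤_) (ℕₚ.+-comm (ones b) w) (close b₀ b e₀ e)))
    (ℕₚ.≤-trans (ℕ.s≤s (ℕₚ.≤-trans (close b b₀ e e₀) (ℕₚ.+-monoˡ-≤ w (ℕₚ.m≤n+m∸n (ones b₀) w)))) (ℕₚ.≤-reflexive (rearrange w x₀)))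
    where
    rearrange : ∀ w x → suc (w ℕ.+ x ℕ.+ w) ≡ x ℕ.+ suc (w ℕ.+ w)
    rearrange = solve-∀

-- Runs of one algorithm on different graphs

module Runs {N : ℕ} (A : Algorithm) (s : Fin N) where

  -- A copy of `cover` that is not indexed by the graph, so that runs on different matrices share
  -- their covered list.
  coverReply : Reply N → List (Fin N) → List (Fin N)
  coverReply (node v)   covered = v ∷ covered
  coverReply (number _) covered = covered

  cover≡ : ∀ (G : Graph N) r covered → cover G r covered ≡ coverReply r covered
  cover≡ G (node v)   covered = refl
  cover≡ G (number _) covered = refl

  module _ (G : Graph N) where

    -- Like the unfoldings below, this takes the next action as an equation. The action depends on
    -- the history and not on the graph, so one equation serves all matrices under `E σ`.
    acceptance-output : ∀ accept T covered {h π̂} → A N s h ≡ output π̂ →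
      acceptance G A s accept (suc T) covered h ≡ indicator (accept h)
    acceptance-output accept T covered e rewrite e = refl

    acceptance-toss : ∀ accept T covered {h k} → A N s h ≡ toss k →
      acceptance G A s accept (suc T) covered h ≡
      average (map (λ r → acceptance G A s accept T covered (r ∷ h)) (draws k))
    acceptance-toss accept T covered e rewrite e = refl

    acceptance-query : ∀ accept T covered {h q} → A N s h ≡ query q →
      acceptance G A s accept (suc T) covered h ≡
      average (map (λ r → acceptance G A s accept T (coverReply r covered) (r ∷ h)) (replies G covered q))
    acceptance-query accept T covered {h} {q} e rewrite e =
      average-cong (λ r → cong (λ c → acceptance G A s accept T c (r ∷ h)) (cover≡ G r covered)) (replies G covered q)

    queries-toss : ∀ T covered {h k} → A N s h ≡ toss k →
      queries G A s (suc T) covered h ≡ average (map (λ r → queries G A s T covered (r ∷ h)) (draws k))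
    queries-toss T covered e rewrite e = refl

    queries-query : ∀ T covered {h q} → A N s h ≡ query q →
      queries G A s (suc T) covered h ≡
      1ℚ ℚ.+ average (map (λ r → queries G A s T (coverReply r covered) (r ∷ h)) (replies G covered q))
    queries-query T covered {h} {q} e rewrite e = cong (1ℚ ℚ.+_)
      (average-cong (λ r → cong (λ c → queries G A s T c (r ∷ h)) (cover≡ G r covered)) (replies G covered q))

    0≤acceptance : ∀ accept T covered h → 0ℚ ℚ.≤ acceptance G A s accept T covered h
    0≤acceptance accept zero    covered h = ℚₚ.≤-refl
    0≤acceptance accept (suc T) covered h with A N s h
    ... | output _ = 0≤indicator (accept h)
    ... | toss k   = average-nonNeg (λ r → 0≤acceptance accept T covered (r ∷ h)) (draws k)
    ... | query q  = average-nonNeg (λ r → 0≤acceptance accept T (cover G r covered) (r ∷ h)) (replies G covered q)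

    acceptance≤1 : ∀ accept T covered h → acceptance G A s accept T covered h ℚ.≤ 1ℚ
    acceptance≤1 accept zero    covered h = ℚₚ.nonNegative⁻¹ 1ℚ
    acceptance≤1 accept (suc T) covered h with A N s h
    ... | output _ = indicator≤1 (accept h)
    ... | toss k   = ℚₚ.≤-trans (average-mono (λ r → acceptance≤1 accept T covered (r ∷ h)) (draws k))
      (average-const (ℚₚ.nonNegative⁻¹ 1ℚ) (draws {N} k))
    ... | query q  = ℚₚ.≤-trans (average-mono (λ r → acceptance≤1 accept T (cover G r covered) (r ∷ h)) (replies G covered q))
      (average-const (ℚₚ.nonNegative⁻¹ 1ℚ) (replies G covered q))

    0≤queries : ∀ T covered h → 0ℚ ℚ.≤ queries G A s T covered h
    0≤queries zero    covered h = ℚₚ.≤-refl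
    0≤queries (suc T) covered h with A N s h
    ... | output _ = ℚₚ.≤-refl
    ... | toss k   = average-nonNeg (λ r → 0≤queries T covered (r ∷ h)) (draws k)
    ... | query q  = +-nonNeg (ℚₚ.nonNegative⁻¹ 1ℚ)
      (average-nonNeg (λ r → 0≤queries T (cover G r covered) (r ∷ h)) (replies G covered q))

    -- Lets the numbers of actions for the individual matrices be raised to a common one.
    acceptance-mono : ∀ accept {T T′} → T ℕ.≤ T′ → ∀ covered h →
      acceptance G A s accept T covered h ℚ.≤ acceptance G A s accept T′ covered h
    acceptance-mono accept {T′ = T′} ℕ.z≤n covered h = 0≤acceptance accept T′ covered h
    acceptance-mono accept (ℕ.s≤s T≤T′) covered h with A N s h
    ... | output _ = ℚₚ.≤-refl
    ... | toss k   = average-mono (λ r → acceptance-mono accept T≤T′ covered (r ∷ h)) (draws k)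
    ... | query q  = average-mono (λ r → acceptance-mono accept T≤T′ (cover G r covered) (r ∷ h)) (replies G covered q)

-- The game of revealing hidden bits

-- The index `i` may depend on the covered nodes and the query, but not on `b`. As `f` gives the
-- whole list of equally likely replies, random replies as to `jump` are included.
ReadsOneBit : ∀ {M N} → (Vec Bool M → Graph N) → Set
ReadsOneBit {M} {N} G = ∀ covered q → ∃[ i ] Σ (Bool → List (Reply N)) λ f →
  ∀ b → replies (G b) covered q ≡ f (lookup b i)

-- The hypothesis `unsure` concerns a single history: the output is then fixed, and `B` bounds the
-- chance that it suits a matrix drawn conditionally on the fewer than `L` bits in `σ`.
module Game {M N : ℕ} (G : Vec Bool M → Graph N) (readsOne : ReadsOneBit G) (A : Algorithm) (s : Fin N)
            (accept : Vec Bool M → List (Reply N) → Bool)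
            (L : ℕ) .{{L≢0 : ℕ.NonZero L}} (B : ℚ) (0≤B : 0ℚ ℚ.≤ B)
            (unsure : ∀ (σ : Vec (Maybe Bool) M) h π̂ → A N s h ≡ output π̂ → known σ ℕ.< L →
                      E σ (λ b → indicator (accept b h)) ℚ.≤ B)
  where
  open Runs A s

  κ : ℚ
  κ = unit L

  budget : Vec (Maybe Bool) M → ℚ
  budget σ = B ℚ.+ κ ℚ.* ι (known σ)

  0≤budget : ∀ σ → 0ℚ ℚ.≤ budget σ
  0≤budget σ = +-nonNeg 0≤B (*-nonNeg (0≤unit L) (0≤ι (known σ)))

  acc qs : ℕ → List (Fin N) → List (Reply N) → Vec Bool M → ℚ
  acc T covered h b = acceptance (G b) A s (accept b) T covered h
  qs T covered h b = queries (G b) A s T covered h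

  0≤Eqs : ∀ σ T covered h → 0ℚ ℚ.≤ E σ (qs T covered h)
  0≤Eqs σ T covered h = subst (ℚ._≤ E σ (qs T covered h)) (E-const σ 0ℚ) (E-mono σ (λ b → 0≤queries (G b) T covered h))

  budget≤ : ∀ σ {q} → 0ℚ ℚ.≤ q → budget σ ℚ.≤ budget σ ℚ.+ κ ℚ.* q
  budget≤ σ {q} 0≤q = subst (ℚ._≤ budget σ ℚ.+ κ ℚ.* q) (ℚₚ.+-identityʳ (budget σ))
    (ℚₚ.+-monoʳ-≤ (budget σ) (*-nonNeg (0≤unit L) 0≤q))

  -- Every query pays κ for the one bit that it can reveal, and the claim is
  -- trivial as soon as L bits are known.
  potential : ∀ T σ covered h → E σ (acc T covered h) ℚ.≤ budget σ ℚ.+ κ ℚ.* E σ (qs T covered h)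
  potential zero σ covered h = subst (ℚ._≤ budget σ ℚ.+ κ ℚ.* E σ (λ _ → 0ℚ)) (sym (E-const σ 0ℚ))
    (+-nonNeg (0≤budget σ) (*-nonNeg (0≤unit L) (ℚₚ.≤-reflexive (sym (E-const σ 0ℚ)))))
  potential (suc T) σ covered h with ℕₚ.<-≤-connex (known σ) L
  ... | inj₂ L≤known = begin
    E σ (acc (suc T) covered h)      ≤⟨ E-mono σ (λ b → acceptance≤1 (G b) (accept b) (suc T) covered h) ⟩
    E σ (λ _ → 1ℚ)                   ≡⟨ E-const σ 1ℚ ⟩
    1ℚ                               ≡⟨ unit*ι L ⟨
    κ ℚ.* ι L                        ≤⟨ *-monoˡ (0≤unit L) (ι-mono-≤ L≤known) ⟩
    κ ℚ.* ι (known σ)                ≡⟨ ℚₚ.+-identityˡ (κ ℚ.* ι (known σ)) ⟨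
    0ℚ ℚ.+ κ ℚ.* ι (known σ)         ≤⟨ ℚₚ.+-monoˡ-≤ (κ ℚ.* ι (known σ)) 0≤B ⟩
    budget σ                         ≤⟨ budget≤ σ (0≤Eqs σ (suc T) covered h) ⟩
    budget σ ℚ.+ κ ℚ.* E σ (qs (suc T) covered h) ∎
    where open ℚₚ.≤-Reasoning
  ... | inj₁ known<L = go (A N s h) refl
    where
    open ℚₚ.≤-Reasoning
    go : ∀ a → A N s h ≡ a → E σ (acc (suc T) covered h) ℚ.≤ budget σ ℚ.+ κ ℚ.* E σ (qs (suc T) covered h)
    go (output π̂) e = begin
      E σ (acc (suc T) covered h)        ≡⟨ E-cong σ (λ b → acceptance-output (G b) (accept b) T covered e) ⟩
      E σ (λ b → indicator (accept b h)) ≤⟨ unsure σ h π̂ e known<L ⟩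
      B                                  ≡⟨ ℚₚ.+-identityʳ B ⟨
      B ℚ.+ 0ℚ                           ≤⟨ ℚₚ.+-monoʳ-≤ B (*-nonNeg (0≤unit L) (0≤ι (known σ))) ⟩
      budget σ                           ≤⟨ budget≤ σ (0≤Eqs σ (suc T) covered h) ⟩
      budget σ ℚ.+ κ ℚ.* E σ (qs (suc T) covered h) ∎
    go (toss k) e = begin
      E σ (acc (suc T) covered h)
        ≡⟨ E-cong σ (λ b → acceptance-toss (G b) (accept b) T covered e) ⟩
      E σ (λ b → average (map (λ r → acc T covered (r ∷ h) b) (draws k)))
        ≡⟨ E-average σ (λ b r → acc T covered (r ∷ h) b) (draws k) ⟩
      average (map (λ r → E σ (acc T covered (r ∷ h))) (draws k))
        ≤⟨ average-affine {G = λ r → E σ (qs T covered (r ∷ h))} {κ = κ} (0≤budget σ) (λ r → potential T σ covered (r ∷ h)) (draws k) ⟩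
      budget σ ℚ.+ κ ℚ.* average (map (λ r → E σ (qs T covered (r ∷ h))) (draws k))
        ≡⟨ cong (λ q → budget σ ℚ.+ κ ℚ.* q) (E-average σ (λ b r → qs T covered (r ∷ h) b) (draws k)) ⟨
      budget σ ℚ.+ κ ℚ.* E σ (λ b → average (map (λ r → qs T covered (r ∷ h) b) (draws k)))
        ≡⟨ cong (λ q → budget σ ℚ.+ κ ℚ.* q) (E-cong σ (λ b → queries-toss (G b) T covered e)) ⟨
      budget σ ℚ.+ κ ℚ.* E σ (qs (suc T) covered h) ∎
    go (query q) e with readsOne covered q
    ... | i , f , reads = split (lookup σ i) refl
      where
      answered : Bool → Vec (Maybe Bool) M → ℚ
      answered c τ = average (map (λ r → E τ (qs T (coverReply r covered) (r ∷ h))) (f c))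

      -- With bit `i` fixed in `τ`, the replies are the same list `f c` for every matrix that
      -- counts, so their average can be taken outside `E τ`.
      answered-acc : ∀ τ {c} → lookup τ i ≡ just c → E τ (acc (suc T) covered h) ℚ.≤ budget τ ℚ.+ κ ℚ.* answered c τ
      answered-acc τ {c} known-i = begin
        E τ (acc (suc T) covered h)
          ≡⟨ E-cong-known τ i known-i (λ b b≡c → trans (acceptance-query (G b) (accept b) T covered e)
               (cong (λ rs → average (map (λ r → acc T (coverReply r covered) (r ∷ h) b) rs)) (trans (reads b) (cong f b≡c)))) ⟩
        E τ (λ b → average (map (λ r → acc T (coverReply r covered) (r ∷ h) b) (f c)))
          ≡⟨ E-average τ (λ b r → acc T (coverReply r covered) (r ∷ h) b) (f c) ⟩
        average (map (λ r → E τ (acc T (coverReply r covered) (r ∷ h))) (f c))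
          ≤⟨ average-affine {G = λ r → E τ (qs T (coverReply r covered) (r ∷ h))} {κ = κ} (0≤budget τ) (λ r → potential T τ (coverReply r covered) (r ∷ h)) (f c) ⟩
        budget τ ℚ.+ κ ℚ.* answered c τ ∎

      answered-qs : ∀ τ {c} → lookup τ i ≡ just c → E τ (qs (suc T) covered h) ≡ 1ℚ ℚ.+ answered c τ
      answered-qs τ {c} known-i = trans
        (E-cong-known τ i known-i (λ b b≡c → trans (queries-query (G b) T covered e)
          (cong (λ rs → 1ℚ ℚ.+ average (map (λ r → qs T (coverReply r covered) (r ∷ h) b) rs)) (trans (reads b) (cong f b≡c)))))
        (trans (E-+ τ (λ _ → 1ℚ) (λ b → average (map (λ r → qs T (coverReply r covered) (r ∷ h) b) (f c))))
          (cong₂ ℚ._+_ (E-const τ 1ℚ) (E-average τ (λ b r → qs T (coverReply r covered) (r ∷ h) b) (f c))))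

      revealed : ∀ c → lookup σ i ≡ nothing →
        E (σ [ i ]≔ just c) (acc (suc T) covered h) ℚ.≤ budget σ ℚ.+ κ ℚ.* E (σ [ i ]≔ just c) (qs (suc T) covered h)
      revealed c unknown-i = begin
        E τ (acc (suc T) covered h)
          ≤⟨ answered-acc τ known-i ⟩
        B ℚ.+ κ ℚ.* ι (known τ) ℚ.+ κ ℚ.* answered c τ
          ≡⟨ cong (λ x → B ℚ.+ κ ℚ.* x ℚ.+ κ ℚ.* answered c τ) (trans (cong ι (known-reveal σ i c unknown-i)) (ι-+ 1 (known σ))) ⟩
        B ℚ.+ κ ℚ.* (1ℚ ℚ.+ ι (known σ)) ℚ.+ κ ℚ.* answered c τ
          ≡⟨ solve 5 (λ b k o x y → b :+ k :* (o :+ x) :+ k :* y := b :+ k :* x :+ k :* (o :+ y)) refl B κ 1ℚ (ι (known σ)) (answered c τ) ⟩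
        budget σ ℚ.+ κ ℚ.* (1ℚ ℚ.+ answered c τ)
          ≡⟨ cong (λ x → budget σ ℚ.+ κ ℚ.* x) (answered-qs τ known-i) ⟨
        budget σ ℚ.+ κ ℚ.* E τ (qs (suc T) covered h) ∎
        where
        τ = σ [ i ]≔ just c
        known-i : lookup τ i ≡ just c
        known-i = Vecₚ.lookup∘updateAt i σ

      split : ∀ x → lookup σ i ≡ x → E σ (acc (suc T) covered h) ℚ.≤ budget σ ℚ.+ κ ℚ.* E σ (qs (suc T) covered h)
      -- A query about a known bit is charged as well, which only weakens the bound.
      split (just c) known-i = begin
        E σ (acc (suc T) covered h)               ≤⟨ answered-acc σ known-i ⟩
        budget σ ℚ.+ κ ℚ.* answered c σ           ≤⟨ ℚₚ.+-monoʳ-≤ (budget σ) (*-monoˡ (0≤unit L)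
             (subst (ℚ._≤ 1ℚ ℚ.+ answered c σ) (ℚₚ.+-identityˡ (answered c σ)) (ℚₚ.+-monoˡ-≤ (answered c σ) (ℚₚ.nonNegative⁻¹ 1ℚ)))) ⟩
        budget σ ℚ.+ κ ℚ.* (1ℚ ℚ.+ answered c σ)  ≡⟨ cong (λ x → budget σ ℚ.+ κ ℚ.* x) (answered-qs σ known-i) ⟨
        budget σ ℚ.+ κ ℚ.* E σ (qs (suc T) covered h) ∎
      split nothing unknown-i = begin
        E σ (acc (suc T) covered h)
          ≡⟨ E-split σ i unknown-i ⟩
        mean (E (σ [ i ]≔ just false) (acc (suc T) covered h)) (E (σ [ i ]≔ just true) (acc (suc T) covered h))
          ≤⟨ mean-mono (revealed false unknown-i) (revealed true unknown-i) ⟩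
        mean (budget σ ℚ.+ κ ℚ.* Q₀) (budget σ ℚ.+ κ ℚ.* Q₁)
          ≡⟨ mean-+ (budget σ) (κ ℚ.* Q₀) (budget σ) (κ ℚ.* Q₁) ⟩
        mean (budget σ) (budget σ) ℚ.+ mean (κ ℚ.* Q₀) (κ ℚ.* Q₁)
          ≡⟨ cong₂ ℚ._+_ (mean-idem (budget σ)) (mean-* κ Q₀ Q₁) ⟩
        budget σ ℚ.+ κ ℚ.* mean Q₀ Q₁
          ≡⟨ cong (λ x → budget σ ℚ.+ κ ℚ.* x) (E-split σ i unknown-i) ⟨
        budget σ ℚ.+ κ ℚ.* E σ (qs (suc T) covered h) ∎
        where
        Q₀ = E (σ [ i ]≔ just false) (qs (suc T) covered h)
        Q₁ = E (σ [ i ]≔ just true) (qs (suc T) covered h)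

  -- The potential is applied with no bit revealed. Success is assumed on every matrix and hence on
  -- average, while for the cost a matrix at least as expensive as the average is picked.
  costly-instance : ∀ T {ρ} → (∀ b → ρ ℚ.≤ acc T (s ∷ []) [] b) → ∃[ b ] (ρ ℚ.≤ B ℚ.+ κ ℚ.* qs T (s ∷ []) [] b)
  costly-instance T {ρ} success with E≤some (allOpen M) (qs T (s ∷ []) [])
  ... | b , h = b , (begin
    ρ                                                ≡⟨ E-const (allOpen M) ρ ⟨
    E (allOpen M) (λ _ → ρ)                          ≤⟨ E-mono (allOpen M) success ⟩
    E (allOpen M) (acc T (s ∷ []) [])                ≤⟨ potential T (allOpen M) (s ∷ []) [] ⟩
    budget (allOpen M) ℚ.+ κ ℚ.* E (allOpen M) (qs T (s ∷ []) [])
      ≡⟨ cong (ℚ._+ κ ℚ.* E (allOpen M) (qs T (s ∷ []) [])) (trans (cong (λ r → B ℚ.+ κ ℚ.* ι r) (known-allOpen M))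
           (trans (cong (B ℚ.+_) (ℚₚ.*-zeroʳ κ)) (ℚₚ.+-identityʳ B))) ⟩
    B ℚ.+ κ ℚ.* E (allOpen M) (qs T (s ∷ []) [])     ≤⟨ ℚₚ.+-monoʳ-≤ B (*-monoˡ (0≤unit L) h) ⟩
    B ℚ.+ κ ℚ.* qs T (s ∷ []) [] b                   ∎)
    where open ℚₚ.≤-Reasoning

-- Finite sums

Σℚ : ∀ {n} → (Fin n → ℚ) → ℚ
Σℚ = V.foldr ℚ._+_ 0ℚ

Σℚ-cong : ∀ {n} {f g : Fin n → ℚ} → (∀ i → f i ≡ g i) → Σℚ f ≡ Σℚ g
Σℚ-cong = ℚSum.sum-cong-≗

Σℚ-zero : ∀ {n} {f : Fin n → ℚ} → (∀ i → f i ≡ 0ℚ) → Σℚ f ≡ 0ℚ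
Σℚ-zero {zero}  f≡0 = refl
Σℚ-zero {suc n} f≡0 = cong₂ ℚ._+_ (f≡0 zero) (Σℚ-zero (f≡0 ∘ suc))

Σℚ-* : ∀ {n} c (f : Fin n → ℚ) → Σℚ (λ i → c ℚ.* f i) ≡ c ℚ.* Σℚ f
Σℚ-* c f = sym (ℚSum.*-distribˡ-sum c f)

Σℚ-split : ∀ m {n} (f : Fin (m ℕ.+ n) → ℚ) → Σℚ f ≡ Σℚ (λ i → f (i ↑ˡ n)) ℚ.+ Σℚ (λ j → f (m ↑ʳ j))
Σℚ-split zero        f = sym (ℚₚ.+-identityˡ (Σℚ f))
Σℚ-split (suc m) {n} f = trans (cong (f zero ℚ.+_) (Σℚ-split m (f ∘ suc)))
  (sym (ℚₚ.+-assoc (f zero) (Σℚ (λ i → f (suc (i ↑ˡ n)))) (Σℚ (λ j → f (suc (m ↑ʳ j))))))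

Σℚ-combine : ∀ m {n} (f : Fin (m ℕ.* n) → ℚ) → Σℚ (λ i → Σℚ (λ j → f (combine {m} {n} i j))) ≡ Σℚ f
Σℚ-combine zero        f = refl
Σℚ-combine (suc m) {n} f = trans
  (cong (Σℚ (λ j → f (j ↑ˡ (m ℕ.* n))) ℚ.+_) (Σℚ-combine m (λ x → f (n ↑ʳ x)))) (sym (Σℚ-split n f))

Σℚ-ones : ∀ {M} (b : Vec Bool M) → Σℚ (λ i → indicator (lookup b i)) ≡ ι (ones b)
Σℚ-ones []          = refl
Σℚ-ones (false ∷ b) = trans (ℚₚ.+-identityˡ (Σℚ (λ i → indicator (lookup b i)))) (Σℚ-ones b)
Σℚ-ones (true ∷ b)  = trans (cong (1ℚ ℚ.+_) (Σℚ-ones b)) (sym (ι-+ 1 (ones b)))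

seq-sum : ∀ {n} (f : Fin n → ℝ) i → seq (sum f) i ≡ Σℚ (λ j → seq (f j) i)
seq-sum {zero}  f i = refl
seq-sum {suc n} f i = cong (seq (f zero) i ℚ.+_) (seq-sum (f ∘ suc) i)

Σℕ-bound : ∀ {n} c (f : Fin n → ℕ) → (∀ i → f i ℕ.≤ c) → V.foldr ℕ._+_ 0 f ℕ.≤ n ℕ.* c
Σℕ-bound {zero}  c f f≤c = ℕ.z≤n
Σℕ-bound {suc n} c f f≤c = ℕₚ.+-mono-≤ (f≤c zero) (Σℕ-bound c (f ∘ suc) (f≤c ∘ suc))

xor-cancelʳ : ∀ c d → (c xor d) xor d ≡ c
xor-cancelʳ false false = refl
xor-cancelʳ false true  = refl
xor-cancelʳ true  false = refl
xor-cancelʳ true  true  = refl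

-- The hard family of graphs

module Family (k : ℕ) {{k≢0 : ℕ.NonZero k}} where

  -- left true i is the mirror image of left false i; it is not reachable from src.
  data Node : Set where
    src        : Node
    sink       : Bool → Node
    left right : Bool → Fin k → Node

  order : ℕ
  order = 3 ℕ.+ 4 ℕ.* k

  enc : Node → Fin order
  enc src             = 0F
  enc (sink false)    = 1F
  enc (sink true)     = 2F
  enc (left false i)  = suc (suc (suc (combine {4} 0F i)))
  enc (left true i)   = suc (suc (suc (combine {4} 1F i)))
  enc (right false i) = suc (suc (suc (combine {4} 2F i)))
  enc (right true i)  = suc (suc (suc (combine {4} 3F i)))

  inner : Fin 4 × Fin k → Node
  inner (0F , i) = left false i
  inner (1F , i) = left true i
  inner (2F , i) = right false i
  inner (3F , i) = right true i

  dec : Fin order → Node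
  dec 0F                  = src
  dec 1F                  = sink false
  dec 2F                  = sink true
  dec (suc (suc (suc r))) = inner (remQuot {4} k r)

  dec-enc : ∀ w → dec (enc w) ≡ w
  dec-enc src             = refl
  dec-enc (sink false)    = refl
  dec-enc (sink true)     = refl
  dec-enc (left false i)  = cong inner (Finₚ.remQuot-combine {4} 0F i)
  dec-enc (left true i)   = cong inner (Finₚ.remQuot-combine {4} 1F i)
  dec-enc (right false i) = cong inner (Finₚ.remQuot-combine {4} 2F i)
  dec-enc (right true i)  = cong inner (Finₚ.remQuot-combine {4} 3F i)

  enc-inner : ∀ x → enc (inner x) ≡ suc (suc (suc (combine (proj₁ x) (proj₂ x))))
  enc-inner (0F , i) = refl
  enc-inner (1F , i) = refl
  enc-inner (2F , i) = refl
  enc-inner (3F , i) = refl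

  enc-dec : ∀ v → enc (dec v) ≡ v
  enc-dec 0F                  = refl
  enc-dec 1F                  = refl
  enc-dec 2F                  = refl
  enc-dec (suc (suc (suc r))) = trans (enc-inner (remQuot {4} k r)) (cong (λ x → suc (suc (suc x))) (Finₚ.combine-remQuot {4} k r))

  enc-injective : ∀ {w w′} → enc w ≡ enc w′ → w ≡ w′
  enc-injective {w} {w′} e = trans (sym (dec-enc w)) (trans (cong dec e) (dec-enc w′))

  left-injective : ∀ {c c′ i i′} → left c i ≡ left c′ i′ → i ≡ i′
  left-injective refl = refl

  right-injective : ∀ {c c′ i i′} → right c i ≡ right c′ i′ → i ≡ i′
  right-injective refl = refl

  outdegᴺ indegᴺ : Node → ℕ
  outdegᴺ src         = k
  outdegᴺ (sink _)    = 1
  outdegᴺ (left _ _)  = k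
  outdegᴺ (right _ _) = 1

  indegᴺ src            = 0
  indegᴺ (sink false)   = 2 ℕ.+ k
  indegᴺ (sink true)    = k
  indegᴺ (left false _) = 1
  indegᴺ (left true _)  = 0
  indegᴺ (right _ _)    = k

  noDanglingᴺ : ∀ w → ℕ.NonZero (outdegᴺ w)
  noDanglingᴺ src         = k≢0
  noDanglingᴺ (sink _)    = _
  noDanglingᴺ (left _ _)  = k≢0
  noDanglingᴺ (right _ _) = _

  module _ (b : Vec Bool (k ℕ.* k)) where

    bit : Fin k → Fin k → Bool
    bit i j = lookup b (combine i j)

    -- Both sinks lead to `sink false`, which carries a loop. Thus no node is dangling, and a walk
    -- from the source visits `sink true` at most once, after exactly three moves, so that its PPR
    -- is a single term.
    outᴺ : ∀ w → Fin (outdegᴺ w) → Node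
    outᴺ src         i = left false i
    outᴺ (sink _)    _ = sink false
    outᴺ (left c i)  j = right (c xor bit i j) j
    outᴺ (right c _) _ = sink c

    -- For each row `i`, exactly one of the two copies of `i` points to `right c j`, namely the one
    -- with label `c xor bit i j`. Listing these by `i` makes the in-degree `k` and ties each
    -- in-edge index to one bit.
    innᴺ : ∀ w → Fin (indegᴺ w) → Node
    innᴺ (sink false)   0F            = sink false
    innᴺ (sink false)   1F            = sink true
    innᴺ (sink false)   (suc (suc j)) = right false j
    innᴺ (sink true)    j             = right true j
    innᴺ (left false _) _             = src
    innᴺ (right c j)    i             = left (c xor bit i j) i

    outᴺ-injective : ∀ w → Injective _≡_ _≡_ (outᴺ w)
    outᴺ-injective src         e = left-injective e
    outᴺ-injective (sink _)    {0F} {0F} e = refl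
    outᴺ-injective (left c i)  e = right-injective e
    outᴺ-injective (right _ _) {0F} {0F} e = refl

    innᴺ-injective : ∀ w → Injective _≡_ _≡_ (innᴺ w)
    innᴺ-injective (sink false)   {0F} {0F} e = refl
    innᴺ-injective (sink false)   {1F} {1F} e = refl
    innᴺ-injective (sink false)   {0F} {1F} ()
    innᴺ-injective (sink false)   {1F} {0F} ()
    innᴺ-injective (sink false)   {0F} {suc (suc _)} ()
    innᴺ-injective (sink false)   {1F} {suc (suc _)} ()
    innᴺ-injective (sink false)   {suc (suc _)} {0F} ()
    innᴺ-injective (sink false)   {suc (suc _)} {1F} ()
    innᴺ-injective (sink false)   {suc (suc i)} {suc (suc j)} e = cong (λ x → suc (suc x)) (right-injective e)
    innᴺ-injective (sink true)    e = right-injective e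
    innᴺ-injective (left false _) {0F} {0F} e = refl
    innᴺ-injective (right c j)    e = left-injective e

    out⇒inn : ∀ u i → ∃[ j ] innᴺ (outᴺ u i) j ≡ u
    out⇒inn src          i = 0F , refl
    out⇒inn (sink false) _ = 0F , refl
    out⇒inn (sink true)  _ = 1F , refl
    out⇒inn (left c i)   j = i , cong (λ d → left d i) (xor-cancelʳ c (bit i j))
    out⇒inn (right false j) _ = suc (suc j) , refl
    out⇒inn (right true j)  _ = j , refl

    inn⇒out : ∀ v j → ∃[ i ] outᴺ (innᴺ v j) i ≡ v
    inn⇒out (sink false)   0F            = 0F , refl
    inn⇒out (sink false)   1F            = 0F , refl
    inn⇒out (sink false)   (suc (suc j)) = 0F , refl
    inn⇒out (sink true)    j             = 0F , refl
    inn⇒out (left false i) _             = i , refl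
    inn⇒out (right c j)    i             = j , cong (λ d → right d j) (xor-cancelʳ c (bit i j))

    -- The equation `dec (enc w) ≡ w` holds only propositionally; taking it as an argument with a
    -- variable side lets it be matched, so that the edge index changes its type along.
    transport : ∀ {degᴺ : Node → ℕ} (nb : ∀ w → Fin (degᴺ w) → Node) {w u} v → dec v ≡ w →
                ∃[ j ] nb w j ≡ dec u → ∃[ j ] enc (nb (dec v) j) ≡ u
    transport nb {u = u} v refl (j , e) = j , trans (cong enc e) (enc-dec u)

    graph : Graph order
    graph = record
      { outdeg        = outdegᴺ ∘ dec
      ; indeg         = indegᴺ ∘ dec
      ; out           = λ v → enc ∘ outᴺ (dec v)
      ; inn           = λ v → enc ∘ innᴺ (dec v)
      ; out-injective = λ v → outᴺ-injective (dec v) ∘ enc-injective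
      ; inn-injective = λ v → innᴺ-injective (dec v) ∘ enc-injective
      ; out⇔inn       = λ u v → mk⇔
          (λ { (i , refl) → transport innᴺ (enc (outᴺ (dec u) i)) (dec-enc (outᴺ (dec u) i)) (out⇒inn (dec u) i) })
          (λ { (j , refl) → transport outᴺ (enc (innᴺ (dec v) j)) (dec-enc (innᴺ (dec v) j)) (inn⇒out (dec v) j) })
      ; noDangling    = noDanglingᴺ ∘ dec
      }

    outdeg≤k : ∀ v → outdegᴺ (dec (suc (suc (suc v)))) ℕ.≤ k
    outdeg≤k v with remQuot {4} k v
    ... | 0F , _ = ℕₚ.≤-refl
    ... | 1F , _ = ℕₚ.≤-refl
    ... | 2F , _ = ℕ.>-nonZero⁻¹ k
    ... | 3F , _ = ℕ.>-nonZero⁻¹ k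

    -- The source contributes `k`, the sinks 2, and each of the 4k other nodes at most `k`.
    edges≤ : edges graph ℕ.≤ k ℕ.+ (2 ℕ.+ 4 ℕ.* k ℕ.* k)
    edges≤ = ℕₚ.+-monoʳ-≤ k (ℕₚ.+-monoʳ-≤ 2 (Σℕ-bound k (λ v → outdegᴺ (dec (suc (suc (suc v))))) outdeg≤k))

  -- Reading one bit per query

  Reads : ∀ {X : Set} → (Vec Bool (k ℕ.* k) → X) → Set
  Reads {X} F = ∃[ i ] Σ (Bool → X) λ f → ∀ b → F b ≡ f (lookup b i)

  -- A default index for replies that depend on no bit.
  anyBit : Fin (k ℕ.* k)
  anyBit = combine (fromℕ< (ℕ.>-nonZero⁻¹ k)) (fromℕ< (ℕ.>-nonZero⁻¹ k))

  reads-const : ∀ {X : Set} (x : X) → Reads (λ _ → x)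
  reads-const x = anyBit , (λ _ → x) , λ _ → refl

  reads-map : ∀ {X Y : Set} (g : X → Y) {F} → Reads F → Reads (g ∘ F)
  reads-map g (i , f , h) = i , g ∘ f , cong g ∘ h

  reads-out : ∀ w i → Reads (λ b → outᴺ b w i)
  reads-out src         i = reads-const _
  reads-out (sink _)    i = reads-const _
  reads-out (left c i)  j = combine i j , (λ d → right (c xor d) j) , λ _ → refl
  reads-out (right _ _) i = reads-const _

  reads-inn : ∀ w i → Reads (λ b → innᴺ b w i)
  reads-inn (sink false)   0F            = reads-const _
  reads-inn (sink false)   1F            = reads-const _
  reads-inn (sink false)   (suc (suc j)) = reads-const _
  reads-inn (sink true)    j             = reads-const _
  reads-inn (left false _) i             = reads-const _
  reads-inn (right c j)    i             = combine i j , (λ d → left (c xor d) i) , λ _ → refl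

  reads-neighbour : ∀ {d} (nb : Vec Bool (k ℕ.* k) → Fin d → Fin order) → (∀ i → Reads (λ b → nb b i)) →
                    ∀ i → Reads (λ b → neighbour (graph b) (nb b) i)
  reads-neighbour {d} nb reads i with i ℕₚ.<? d
  ... | yes i<d = reads-map (λ v → node v ∷ []) (reads (fromℕ< i<d))
  ... | no  _   = reads-const []

  open DecMembership (Finₚ._≟_ {order}) using (_∈?_)

  readsOneBit : ReadsOneBit graph
  readsOneBit covered jump         = reads-const _
  readsOneBit covered (indeg v)    = reads-const _
  readsOneBit covered (outdeg v)   = reads-const _
  readsOneBit covered (adjIn v i)  with v ∈? covered
  ... | yes _ = reads-neighbour (λ b → enc ∘ innᴺ b (dec v)) (λ j → reads-map enc (reads-inn (dec v) j)) i
  ... | no  _ = reads-const []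
  readsOneBit covered (adjOut v i) with v ∈? covered
  ... | yes _ = reads-neighbour (λ b → enc ∘ outᴺ b (dec v)) (λ j → reads-map enc (reads-out (dec v) j)) i
  ... | no  _ = reads-const []

  -- The PPR of the target

  source target : Fin order
  source = enc src
  target = enc (sink true)

  module _ (b : Vec Bool (k ℕ.* k)) where

    -- The n-th approximation to stopsAfter m w (sink true), where a is that to α.
    module _ (a : ℚ) where

      isTarget : Node → Bool
      isTarget (sink c) = c
      isTarget _        = false

      stops : ℕ → Node → ℚ
      stops zero    w = a ℚ.* indicator (isTarget w)
      stops (suc m) w = (1ℚ ℚ.- a) ℚ.* (unit (outdegᴺ w) {{noDanglingᴺ w}} ℚ.* Σℚ (λ i → stops m (outᴺ b w i)))

      stops-zero : ∀ m w → (∀ i → stops m (outᴺ b w i) ≡ 0ℚ) → stops (suc m) w ≡ 0ℚ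
      stops-zero m w h = trans (cong (λ x → (1ℚ ℚ.- a) ℚ.* (unit (outdegᴺ w) {{noDanglingᴺ w}} ℚ.* x)) (Σℚ-zero h))
        (trans (cong ((1ℚ ℚ.- a) ℚ.*_) (ℚₚ.*-zeroʳ (unit (outdegᴺ w) {{noDanglingᴺ w}}))) (ℚₚ.*-zeroʳ (1ℚ ℚ.- a)))

      -- A walk never leaves `sink false`. The lemmas on late stops carry this backwards through the
      -- layers, with one more move for each.
      stops-false : ∀ m → stops m (sink false) ≡ 0ℚ
      stops-false zero    = ℚₚ.*-zeroʳ a
      stops-false (suc m) = stops-zero m (sink false) (λ _ → stops-false m)

      stops-sink-late : ∀ m c → stops (suc m) (sink c) ≡ 0ℚ
      stops-sink-late m c = stops-zero m (sink c) (λ _ → stops-false m)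

      stops-right-late : ∀ m c j → stops (2 ℕ.+ m) (right c j) ≡ 0ℚ
      stops-right-late m c j = stops-zero (suc m) (right c j) (λ _ → stops-sink-late m c)

      stops-left-late : ∀ m c i → stops (3 ℕ.+ m) (left c i) ≡ 0ℚ
      stops-left-late m c i = stops-zero (2 ℕ.+ m) (left c i) (λ j → stops-right-late m (c xor bit b i j) j)

      stops-src-late : ∀ m → stops (4 ℕ.+ m) src ≡ 0ℚ
      stops-src-late m = stops-zero (3 ℕ.+ m) src (λ i → stops-left-late m false i)

      stops-src-0 : stops 0 src ≡ 0ℚ
      stops-src-0 = ℚₚ.*-zeroʳ a

      stops-src-1 : stops 1 src ≡ 0ℚ
      stops-src-1 = stops-zero 0 src (λ _ → ℚₚ.*-zeroʳ a)

      stops-src-2 : stops 2 src ≡ 0ℚ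
      stops-src-2 = stops-zero 1 src (λ i → stops-zero 0 (left false i) (λ _ → ℚₚ.*-zeroʳ a))

      factor : ℚ
      factor = (1ℚ ℚ.- a) ℚ.* (1ℚ ℚ.- a) ℚ.* (1ℚ ℚ.- a) ℚ.* a ℚ.* (unit k ℚ.* unit k)

      stops-right-1 : ∀ c j → stops 1 (right c j) ≡ (1ℚ ℚ.- a) ℚ.* a ℚ.* indicator c
      stops-right-1 c j = trans (cong ((1ℚ ℚ.- a) ℚ.*_) (trans (ℚₚ.*-identityˡ (stops 0 (sink c) ℚ.+ 0ℚ)) (ℚₚ.+-identityʳ (stops 0 (sink c)))))
        (sym (ℚₚ.*-assoc (1ℚ ℚ.- a) a (indicator c)))

      stops-left-2 : ∀ i → stops 2 (left false i) ≡
        (1ℚ ℚ.- a) ℚ.* (unit k ℚ.* ((1ℚ ℚ.- a) ℚ.* a)) ℚ.* Σℚ (λ j → indicator (bit b i j))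
      stops-left-2 i = trans
        (cong (λ x → (1ℚ ℚ.- a) ℚ.* (unit k ℚ.* x))
          (trans (Σℚ-cong (λ j → stops-right-1 (bit b i j) j)) (Σℚ-* ((1ℚ ℚ.- a) ℚ.* a) (λ j → indicator (bit b i j)))))
        (solve 4 (λ o u d s → o :* (u :* (d :* s)) := (o :* (u :* d)) :* s) refl (1ℚ ℚ.- a) (unit k) ((1ℚ ℚ.- a) ℚ.* a) (Σℚ (λ j → indicator (bit b i j))))

      stops-src-3 : stops 3 src ≡ factor ℚ.* ι (ones b)
      stops-src-3 = trans
        (cong (λ x → (1ℚ ℚ.- a) ℚ.* (unit k ℚ.* x))
          (trans (Σℚ-cong stops-left-2)
          (trans (Σℚ-* ((1ℚ ℚ.- a) ℚ.* (unit k ℚ.* ((1ℚ ℚ.- a) ℚ.* a))) (λ i → Σℚ (λ j → indicator (bit b i j))))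
                 (cong ((1ℚ ℚ.- a) ℚ.* (unit k ℚ.* ((1ℚ ℚ.- a) ℚ.* a)) ℚ.*_)
                   (trans (Σℚ-combine k (λ x → indicator (lookup b x))) (Σℚ-ones b))))))
        (solve 4 (λ o u a s → o :* (u :* ((o :* (u :* (o :* a))) :* s)) := (o :* o :* o :* a :* (u :* u)) :* s) refl
          (1ℚ ℚ.- a) (unit k) a (ι (ones b)))

    module _ (α : ℝ) where

      private
        G = graph b

      stops-inner : ∀ a x → stops a 0 (inner x) ≡ 0ℚ
      stops-inner a (0F , i) = ℚₚ.*-zeroʳ a
      stops-inner a (1F , i) = ℚₚ.*-zeroʳ a
      stops-inner a (2F , i) = ℚₚ.*-zeroʳ a
      stops-inner a (3F , i) = ℚₚ.*-zeroʳ a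

      seq-stopsAfter : ∀ n m v → seq (stopsAfter G α m v target) n ≡ stops (seq α n) m (dec v)
      seq-stopsAfter n zero    0F = sym (ℚₚ.*-zeroʳ (seq α n))
      seq-stopsAfter n zero    1F = sym (ℚₚ.*-zeroʳ (seq α n))
      seq-stopsAfter n zero    2F = sym (ℚₚ.*-identityʳ (seq α n))
      seq-stopsAfter n zero    (suc (suc (suc r))) = sym (stops-inner (seq α n) (remQuot {4} k r))
      seq-stopsAfter n (suc m) v =
        cong (λ x → (1ℚ ℚ.- seq α n) ℚ.* (unit (outdegᴺ (dec v)) {{noDanglingᴺ (dec v)}} ℚ.* x))
          (trans (seq-sum (λ i → stopsAfter G α m (enc (outᴺ b (dec v) i)) target) n)
            (Σℚ-cong λ i → trans (seq-stopsAfter n m (enc (outᴺ b (dec v) i)))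
              (cong (stops (seq α n) m) (dec-enc (outᴺ b (dec v) i)))))

      -- Three is the only number of moves with which a walk from the source can stop at the target.
      ppr : ℝ
      ppr = stopsAfter G α 3 source target

      seq-ppr : ∀ n → seq ppr n ≡ factor (seq α n) ℚ.* ι (ones b)
      seq-ppr n = trans (seq-stopsAfter n 3 source) (stops-src-3 (seq α n))

      seq-stopsWithin-suc : ∀ n m → seq (stopsWithin G α (suc m) source target) n ≡
        seq (stopsWithin G α m source target) n ℚ.+ stops (seq α n) m src
      seq-stopsWithin-suc n m = cong (seq (stopsWithin G α m source target) n ℚ.+_) (seq-stopsAfter n m source)

      stopsWithin-idle : ∀ n m {x} → seq (stopsWithin G α m source target) n ≡ x → stops (seq α n) m src ≡ 0ℚ →
                         seq (stopsWithin G α (suc m) source target) n ≡ x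
      stopsWithin-idle n m {x} e e₀ = trans (seq-stopsWithin-suc n m) (trans (cong₂ ℚ._+_ e e₀) (ℚₚ.+-identityʳ x))

      seq-stopsWithin : ∀ n m → seq (stopsWithin G α (4 ℕ.+ m) source target) n ≡ stops (seq α n) 3 src
      seq-stopsWithin n zero    = trans (seq-stopsWithin-suc n 3) (trans
        (cong (ℚ._+ stops (seq α n) 3 src)
          (stopsWithin-idle n 2 (stopsWithin-idle n 1 (stopsWithin-idle n 0 refl
            (stops-src-0 (seq α n))) (stops-src-1 (seq α n))) (stops-src-2 (seq α n))))
        (ℚₚ.+-identityˡ (stops (seq α n) 3 src)))
      seq-stopsWithin n (suc m) = stopsWithin-idle n (4 ℕ.+ m) (seq-stopsWithin n m) (stops-src-late (seq α n) m)

      isPPR : IsPPR G α source target ppr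
      -- `stopsWithin 4` is the first partial sum to include the stop after three moves. From there
      -- on the difference vanishes at every index, and `N` only ensures that `seq δ` is
      -- nonnegative.
      isPPR δ (δ₀ , 0<δ₀ , N , h) = 4 , λ m 4≤m η 0<η → N , λ n N≤n → begin
        ℚ.∣ seq (stopsWithin G α m source target) n ℚ.- seq ppr n ∣
          ≡⟨ cong ℚ.∣_∣ (trans (cong (ℚ._- seq ppr n) (trans
               (cong (λ m → seq (stopsWithin G α m source target) n) (sym (ℕₚ.m+[n∸m]≡n 4≤m)))
               (trans (seq-stopsWithin n (m ℕ.∸ 4)) (sym (seq-stopsAfter n 3 source))))) (ℚₚ.+-inverseʳ (seq ppr n))) ⟩
        0ℚ
          ≤⟨ +-nonNeg (ℚₚ.<⇒≤ (ℚₚ.<-≤-trans 0<δ₀ (subst (ℚ._≤ seq δ n) (ℚₚ.+-identityˡ δ₀) (h n N≤n)))) (ℚₚ.<⇒≤ 0<η) ⟩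
        seq δ n ℚ.+ η ∎
        where open ℚₚ.≤-Reasoning

-- The query bound for a window of width g

module _ (Q g : ℕ) {{Q≢0 : ℕ.NonZero Q}} {{g≢0 : ℕ.NonZero g}} where

  -- The factor 3 comes from 2g + 1 ≤ 3g: a window of 2g + 1 values, each of probability at most
  -- 1/`halfSide`, has probability at most 1/Q.
  halfSide side : ℕ
  halfSide = 3 ℕ.* Q ℕ.* g
  side = halfSide ℕ.+ halfSide

  halfSide≢0 : ℕ.NonZero halfSide
  halfSide≢0 = ℕₚ.m*n≢0 (3 ℕ.* Q) g {{ℕₚ.m*n≢0 3 Q}}

  side≢0 : ℕ.NonZero side
  side≢0 = ℕ.>-nonZero (ℕₚ.≤-trans (ℕ.>-nonZero⁻¹ halfSide {{halfSide≢0}}) (ℕₚ.m≤m+n halfSide halfSide))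

  open Family side {{side≢0}}

  -- Of the success 2/Q, at most 1/Q stems from outputs given with fewer than `L` known bits. The
  -- rest costs L/Q = 18 Q g² queries, of which only g² is kept.
  lower-bound : (A : Algorithm) (accept : Vec Bool (side ℕ.* side) → List (Reply order) → Bool) →
    (∀ h π̂ → A order source h ≡ output π̂ → ∀ b b′ → accept b h ≡ true → accept b′ h ≡ true → ones b ℕ.≤ ones b′ ℕ.+ g) →
    ∀ T → (∀ b → unit Q ℚ.+ unit Q ℚ.≤ acceptance (graph b) A source (accept b) T (source ∷ []) []) →
    ∃[ b ] (ι (g ℕ.* g) ℚ.≤ queries (graph b) A source T (source ∷ []) [])
  lower-bound A accept close T success = b , (begin
    ι (g ℕ.* g)                                   ≤⟨ ι-mono-≤ g²≤ ⟩
    ι (6 ℕ.* g ℕ.* halfSide)                      ≡⟨ ℚₚ.*-identityʳ (ι (6 ℕ.* g ℕ.* halfSide)) ⟨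
    ι (6 ℕ.* g ℕ.* halfSide) ℚ.* 1ℚ               ≡⟨ cong (ι (6 ℕ.* g ℕ.* halfSide) ℚ.*_) (ι*unit Q) ⟨
    ι (6 ℕ.* g ℕ.* halfSide) ℚ.* (ι Q ℚ.* unit Q) ≡⟨ ℚₚ.*-assoc (ι (6 ℕ.* g ℕ.* halfSide)) (ι Q) (unit Q) ⟨
    ι (6 ℕ.* g ℕ.* halfSide) ℚ.* ι Q ℚ.* unit Q   ≡⟨ cong (ℚ._* unit Q) (trans (sym (ι-* (6 ℕ.* g ℕ.* halfSide) Q)) (cong ι (L-eq Q g))) ⟩
    ι L ℚ.* unit Q                                ≤⟨ *-monoˡ (0≤ι L) unit≤ ⟩
    ι L ℚ.* (unit L ℚ.* cost)                     ≡⟨ ℚₚ.*-assoc (ι L) (unit L) cost ⟨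
    ι L ℚ.* unit L ℚ.* cost                       ≡⟨ cong (ℚ._* cost) (ι*unit L) ⟩
    1ℚ ℚ.* cost                                   ≡⟨ ℚₚ.*-identityˡ cost ⟩
    cost                                          ∎)
    where
    open ℚₚ.≤-Reasoning
    q = halfSide
    -- There are 4 q² bits, so `L` is half of them. While fewer than `L` are known, at least 2n bits
    -- are open, and q² ≤ 2n + 1 gives point probabilities of at most 1/q.
    n = q ℕ.* q
    L = n ℕ.+ n
    instance
      _ = halfSide≢0
      L≢0 : ℕ.NonZero L
      L≢0 = ℕ.>-nonZero (ℕₚ.≤-trans (ℕ.>-nonZero⁻¹ n {{ℕₚ.m*n≢0 q q}}) (ℕₚ.m≤m+n n n))
    B = ι (suc (g ℕ.+ g)) ℚ.* unit q
    0≤B : 0ℚ ℚ.≤ B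
    0≤B = *-nonNeg (0≤ι (suc (g ℕ.+ g))) (0≤unit q)

    B≤ : B ℚ.≤ unit Q
    B≤ = ≤-unit Q (begin
      ι Q ℚ.* (ι (suc (g ℕ.+ g)) ℚ.* unit q)     ≡⟨ ℚₚ.*-assoc (ι Q) (ι (suc (g ℕ.+ g))) (unit q) ⟨
      ι Q ℚ.* ι (suc (g ℕ.+ g)) ℚ.* unit q       ≡⟨ cong (ℚ._* unit q) (ι-* Q (suc (g ℕ.+ g))) ⟨
      ι (Q ℕ.* suc (g ℕ.+ g)) ℚ.* unit q         ≤⟨ *-monoʳ (0≤unit q) (ι-mono-≤ Q[1+2g]≤q) ⟩
      ι q ℚ.* unit q                             ≡⟨ ι*unit q ⟩
      1ℚ                                         ∎)
      where
      triple : ∀ Q g → Q ℕ.* (g ℕ.+ (g ℕ.+ g)) ≡ 3 ℕ.* Q ℕ.* g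
      triple = solve-∀
      Q[1+2g]≤q : Q ℕ.* suc (g ℕ.+ g) ℕ.≤ q
      Q[1+2g]≤q = ℕₚ.≤-trans (ℕₚ.*-monoʳ-≤ Q (ℕₚ.+-monoˡ-≤ (g ℕ.+ g) (ℕ.>-nonZero⁻¹ g))) (ℕₚ.≤-reflexive (triple Q g))

    size : ∀ q → (q ℕ.+ q) ℕ.* (q ℕ.+ q) ≡ (q ℕ.* q ℕ.+ q ℕ.* q) ℕ.+ (q ℕ.* q ℕ.+ q ℕ.* q)
    size = solve-∀

    manyUnknown : ∀ (σ : Vec (Maybe Bool) (side ℕ.* side)) → known σ ℕ.< L → (unknown σ ℕ.∸ (n ℕ.+ n)) ℕ.+ (n ℕ.+ n) ≡ unknown σ
    manyUnknown σ known<L = ℕₚ.m∸n+n≡m (ℕₚ.+-cancelˡ-≤ (known σ) (n ℕ.+ n) (unknown σ)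
      (ℕₚ.≤-trans (ℕₚ.+-monoˡ-≤ (n ℕ.+ n) (ℕₚ.<⇒≤ known<L)) (ℕₚ.≤-reflexive (trans (sym (size q)) (sym (known+unknown σ))))))

    unsure : ∀ (σ : Vec (Maybe Bool) (side ℕ.* side)) h π̂ → A order source h ≡ output π̂ → known σ ℕ.< L →
             E σ (λ b → indicator (accept b h)) ℚ.≤ B
    unsure σ h π̂ e known<L = E-close σ
      (subst (λ u → ∀ c x → point u c x ℚ.≤ unit q) (manyUnknown σ known<L)
        (point-bound-+ (point-bound n q (ℕₚ.≤-trans (ℕₚ.m≤m+n n n) (ℕₚ.n≤1+n (n ℕ.+ n)))) (unknown σ ℕ.∸ (n ℕ.+ n))))
      g (λ b → accept b h) (close h π̂ e)

    module P = Game graph readsOneBit A source accept L B 0≤B unsure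
    found = P.costly-instance T success
    b = proj₁ found
    cost = queries (graph b) A source T (source ∷ []) []

    unit≤ : unit Q ℚ.≤ unit L ℚ.* cost
    unit≤ = subst₂ ℚ._≤_ (cancel (unit Q) (unit Q)) (cancel (unit Q) (unit L ℚ.* cost))
      (ℚₚ.+-monoʳ-≤ (ℚ.- unit Q) (ℚₚ.≤-trans (proj₂ found) (ℚₚ.+-monoˡ-≤ (unit L ℚ.* cost) B≤)))
      where
      cancel : ∀ x y → ℚ.- x ℚ.+ (x ℚ.+ y) ≡ y
      cancel = solve 2 (λ x y → :- x :+ (x :+ y) := y) refl

    L-eq : ∀ Q g → 6 ℕ.* g ℕ.* (3 ℕ.* Q ℕ.* g) ℕ.* Q ≡ 3 ℕ.* Q ℕ.* g ℕ.* (3 ℕ.* Q ℕ.* g) ℕ.+ 3 ℕ.* Q ℕ.* g ℕ.* (3 ℕ.* Q ℕ.* g)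
    L-eq = solve-∀

    g²≤ : g ℕ.* g ℕ.≤ 6 ℕ.* g ℕ.* halfSide
    g²≤ = ℕₚ.*-mono-≤ (ℕₚ.m≤n*m g 6) (ℕₚ.m≤n*m g (3 ℕ.* Q) {{ℕₚ.m*n≢0 3 Q}})

-- From accuracy to closeness

-- The argument ranges over indices of Cauchy sequences, not over the size parameter of the theorem.
Eventually : (ℕ → Set) → Set
Eventually P = ∃[ N ] (∀ n → N ℕ.≤ n → P n)

eventually-map : ∀ {P R : ℕ → Set} → (∀ n → P n → R n) → Eventually P → Eventually R
eventually-map f (N , h) = N , λ n N≤n → f n (h n N≤n)

eventually-× : ∀ {P R : ℕ → Set} → Eventually P → Eventually R → Eventually (λ n → P n × R n)
eventually-× (N , h) (N′ , h′) = N ℕ.⊔ N′ , λ n N≤n → let l , r = both N N′ N≤n in h n l , h′ n r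

eventually-some : ∀ {P : ℕ → Set} → Eventually P → ∃[ n ] P n
eventually-some (N , h) = N , h N ℕₚ.≤-refl

-- The PPR of the target is reach α times the fraction of ones.
reach : ℝ → ℕ → ℚ
reach α n = (1ℚ ℚ.- seq α n) ℚ.* (1ℚ ℚ.- seq α n) ℚ.* (1ℚ ℚ.- seq α n) ℚ.* seq α n

module _ (k : ℕ) {{k≢0 : ℕ.NonZero k}} (g h X : ℕ) {{g≢0 : ℕ.NonZero g}} {{h≢0 : ℕ.NonZero h}}
         (h-large : 4 ℕ.* X ℕ.* (k ℕ.* k) ℕ.≤ h ℕ.* (g ℕ.* g))
         (α ε : ℝ)
         (α-large : Eventually λ n → 1ℚ ℚ.≤ ι X ℚ.* reach α n)
         (ε-small : Eventually λ n → ι (h ℕ.* g) ℚ.* seq ε n ℚ.≤ 1ℚ)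
  where
  open Family k

  private
    hg≢0 : ℕ.NonZero (h ℕ.* g)
    hg≢0 = ℕₚ.m*n≢0 h g
    η = unit (h ℕ.* g) {{hg≢0}}

  accurate⇒near : ∀ b π̂ → Accurate (graph b) α ε source π̂ →
    Eventually λ n → ℚ.∣ seq (π̂ target) n ℚ.- factor b (seq α n) ℚ.* ι (ones b) ∣ ℚ.≤ seq ε n ℚ.+ η
  accurate⇒near b π̂ accurate = eventually-map
    (λ n → subst (λ x → ℚ.∣ seq (π̂ target) n ℚ.- x ∣ ℚ.≤ seq ε n ℚ.+ η) (seq-ppr b α n))
    (accurate target (ppr b α) (isPPR b α) η (0<unit (h ℕ.* g) {{hg≢0}}))

  triangle : ∀ x y z e → ℚ.∣ x ℚ.- y ∣ ℚ.≤ e → ℚ.∣ x ℚ.- z ∣ ℚ.≤ e → y ℚ.- z ℚ.≤ e ℚ.+ e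
  triangle x y z e hy hz = subst (ℚ._≤ e ℚ.+ e) (solve 3 (λ x y z → (y :- x) :+ (x :- z) := y :- z) refl x y z)
    (ℚₚ.+-mono-≤ (ℚₚ.≤-trans (p≤∣p∣ (y ℚ.- x)) (subst (ℚ._≤ e) (dist-sym x y) hy)) (ℚₚ.≤-trans (p≤∣p∣ (x ℚ.- z)) hz))

  -- Both PPRs are within ε + η of the same estimate, where η = 1/(h g) is the slack in the order on
  -- the reals and ε ≤ 1/(h g). Each one in the matrix adds at least 1/(X k²) to the PPR, so the
  -- counts differ by at most 4 X k²/(h g) ≤ g.
  accurate⇒close : ∀ π̂ b b′ → Accurate (graph b) α ε source π̂ → Accurate (graph b′) α ε source π̂ →
                   ones b ℕ.≤ ones b′ ℕ.+ g
  accurate⇒close π̂ b b′ accurate accurate′ with ℕₚ.≤-total (ones b) (ones b′)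
  ... | inj₁ b≤b′ = ℕₚ.≤-trans b≤b′ (ℕₚ.m≤m+n (ones b′) g)
  ... | inj₂ b′≤b = subst (ℕ._≤ ones b′ ℕ.+ g) (ℕₚ.m+[n∸m]≡n b′≤b) (ℕₚ.+-monoʳ-≤ (ones b′)
      (ℕₚ.*-cancelˡ-≤ (h ℕ.* g) {{hg≢0}} (ι-cancel-≤ (begin
        ι (h ℕ.* g ℕ.* d)                       ≡⟨ ι-* (h ℕ.* g) d ⟩
        ι (h ℕ.* g) ℚ.* ι d                     ≡⟨ cong (ι (h ℕ.* g) ℚ.*_) (ℚₚ.*-identityˡ (ι d)) ⟨
        ι (h ℕ.* g) ℚ.* (1ℚ ℚ.* ι d)            ≤⟨ *-monoˡ (0≤ι (h ℕ.* g)) (*-monoʳ (0≤ι d) X-large) ⟩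
        ι (h ℕ.* g) ℚ.* (ι X ℚ.* β ℚ.* ι d)     ≡⟨ expose ⟩
        ι X ℚ.* ι (k ℕ.* k) ℚ.* (ι (h ℕ.* g) ℚ.* (f ℚ.* ι d))
          ≤⟨ *-monoˡ 0≤Xk² (*-monoˡ (0≤ι (h ℕ.* g)) diff) ⟩
        ι X ℚ.* ι (k ℕ.* k) ℚ.* (ι (h ℕ.* g) ℚ.* ((e ℚ.+ η) ℚ.+ (e ℚ.+ η)))
          ≡⟨ cong (ι X ℚ.* ι (k ℕ.* k) ℚ.*_) (solve 3 (λ u e n → u :* ((e :+ n) :+ (e :+ n)) := (u :* e :+ u :* n) :+ (u :* e :+ u :* n)) refl (ι (h ℕ.* g)) e η) ⟩
        ι X ℚ.* ι (k ℕ.* k) ℚ.* ((ι (h ℕ.* g) ℚ.* e ℚ.+ ι (h ℕ.* g) ℚ.* η) ℚ.+ (ι (h ℕ.* g) ℚ.* e ℚ.+ ι (h ℕ.* g) ℚ.* η))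
          ≤⟨ *-monoˡ 0≤Xk² (ℚₚ.+-mono-≤ one+one one+one) ⟩
        ι X ℚ.* ι (k ℕ.* k) ℚ.* ι 4             ≡⟨ trans (cong (ℚ._* ι 4) (sym (ι-* X (k ℕ.* k)))) (sym (ι-* (X ℕ.* (k ℕ.* k)) 4)) ⟩
        ι (X ℕ.* (k ℕ.* k) ℕ.* 4)               ≤⟨ ι-mono-≤ (ℕₚ.≤-trans (ℕₚ.≤-reflexive (four X (k ℕ.* k))) h-large) ⟩
        ι (h ℕ.* (g ℕ.* g))                     ≡⟨ cong ι (ℕₚ.*-assoc h g g) ⟨
        ι (h ℕ.* g ℕ.* g)                       ∎))))
    where
    open ℚₚ.≤-Reasoning
    -- At a common index of the four facts, only rational numbers are left.
    facts = eventually-some (eventually-× (eventually-× α-large ε-small)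
              (eventually-× (accurate⇒near b π̂ accurate) (accurate⇒near b′ π̂ accurate′)))
    n = proj₁ facts
    e = seq ε n
    d = ones b ℕ.∸ ones b′
    β = reach α n
    f = β ℚ.* (unit k ℚ.* unit k)
    X-large = proj₁ (proj₁ (proj₂ facts))
    0≤Xk² = *-nonNeg (0≤ι X) (0≤ι (k ℕ.* k))
    four : ∀ X K → X ℕ.* K ℕ.* 4 ≡ 4 ℕ.* X ℕ.* K
    four = solve-∀
    one+one : ι (h ℕ.* g) ℚ.* e ℚ.+ ι (h ℕ.* g) ℚ.* η ℚ.≤ 1ℚ ℚ.+ 1ℚ
    one+one = ℚₚ.+-mono-≤ (proj₂ (proj₁ (proj₂ facts))) (ℚₚ.≤-reflexive (ι*unit (h ℕ.* g) {{hg≢0}}))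
    diff : f ℚ.* ι d ℚ.≤ (e ℚ.+ η) ℚ.+ (e ℚ.+ η)
    diff = subst (ℚ._≤ (e ℚ.+ η) ℚ.+ (e ℚ.+ η))
      (trans (cong (λ x → f ℚ.* x ℚ.- f ℚ.* ι (ones b′)) (trans (cong ι (sym (ℕₚ.m+[n∸m]≡n b′≤b))) (ι-+ (ones b′) d)))
        (solve 3 (λ f s d → f :* (s :+ d) :- f :* s := f :* d) refl f (ι (ones b′)) (ι d)))
      (triangle (seq (π̂ target) n) (f ℚ.* ι (ones b)) (f ℚ.* ι (ones b′)) (e ℚ.+ η)
        (proj₁ (proj₂ (proj₂ facts))) (proj₂ (proj₂ (proj₂ facts))))
    -- Inserts the factor k² (1/k)² = 1, which turns `β` into `f`.
    expose : ι (h ℕ.* g) ℚ.* (ι X ℚ.* β ℚ.* ι d) ≡ ι X ℚ.* ι (k ℕ.* k) ℚ.* (ι (h ℕ.* g) ℚ.* (f ℚ.* ι d))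
    expose = trans (trans (sym (ℚₚ.*-identityʳ _)) (cong ((ι (h ℕ.* g) ℚ.* (ι X ℚ.* β ℚ.* ι d)) ℚ.*_)
        (sym (trans (cong (ℚ._* (unit k ℚ.* unit k)) (ι-* k k))
          (trans (solve 2 (λ x u → (x :* x) :* (u :* u) := (x :* u) :* (x :* u)) refl (ι k) (unit k))
            (cong₂ ℚ._*_ (ι*unit k) (ι*unit k)))))))
      (solve 6 (λ w x β d K u → (w :* (x :* β :* d)) :* (K :* u) := x :* K :* (w :* (β :* u :* d))) refl
        (ι (h ℕ.* g)) (ι X) β (ι d) (ι (k ℕ.* k)) (unit k ℚ.* unit k))

-- Constants extracted from real parameters

archimedean : ∀ q → ∃[ n ] (q ℚ.≤ ι n)
archimedean q@(ℚ.mkℚ i d-1 _) = ℤ.∣ i ∣ , ℚₚ.toℚᵘ-cancel-≤ (ℚᵘₚ.≤-respʳ-≃ (ℚᵘₚ.≃-sym (toℚᵘ-ι ℤ.∣ i ∣))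
  (ℚᵘ.*≤* (begin
    i ℤ.* + 1                 ≡⟨ ℤₚ.*-identityʳ i ⟩
    i                         ≤⟨ i≤∣i∣ i ⟩
    + ℤ.∣ i ∣                 ≤⟨ ℤ.+≤+ (ℕₚ.m≤m*n ℤ.∣ i ∣ (suc d-1)) ⟩
    + (ℤ.∣ i ∣ ℕ.* suc d-1)   ≡⟨ ℤₚ.pos-* ℤ.∣ i ∣ (suc d-1) ⟩
    + ℤ.∣ i ∣ ℤ.* + suc d-1   ∎)))
  where
  open ℤₚ.≤-Reasoning
  i≤∣i∣ : ∀ i → i ℤ.≤ + ℤ.∣ i ∣
  i≤∣i∣ (+ n)          = ℤₚ.≤-refl
  i≤∣i∣ (ℤ.-[1+ n ])   = ℤ.-≤+

positive-scale : ∀ q → 0ℚ ℚ.< q → ∃[ n ] (ℕ.NonZero n × 1ℚ ℚ.≤ ι n ℚ.* q)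
positive-scale q 0<q with archimedean (recip q 0<q)
... | n , h = suc n , _ , (begin
  1ℚ                   ≡⟨ recip-inverse q 0<q ⟨
  q ℚ.* recip q 0<q    ≤⟨ *-monoˡ (ℚₚ.<⇒≤ 0<q) (ℚₚ.≤-trans h (ι-mono-≤ (ℕₚ.n≤1+n n))) ⟩
  q ℚ.* ι (suc n)      ≡⟨ ℚₚ.*-comm q (ι (suc n)) ⟩
  ι (suc n) ℚ.* q      ∎)
  where open ℚₚ.≤-Reasoning

-- A natural upper bound for 1/x; in this form the positive real constants enter the estimates.
scale : ∀ x → 0ℝ < x → ∃[ n ] (ℕ.NonZero n × Eventually λ j → 1ℚ ℚ.≤ ι n ℚ.* seq x j)
scale x (δ , 0<δ , N , h) =
  let n , n≢0 , 1≤ = positive-scale δ 0<δ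
  in n , n≢0 , N , λ j N≤j → ℚₚ.≤-trans 1≤
       (*-monoˡ (0≤ι n) (subst (ℚ._≤ seq x j) (ℚₚ.+-identityˡ δ) (h j N≤j)))

upper : ∀ x → ∃[ n ] Eventually λ j → seq x j ℚ.≤ ι n
upper x =
  let B , _ , N , h = bounded x
      n , B≤n = archimedean B
  in n , N , λ j N≤j → ℚₚ.≤-trans (p≤∣p∣ (seq x j)) (ℚₚ.≤-trans (h j N≤j) B≤n)

-- As c ≥ 1/V, an inequality with the natural factor `V` on the left implies the one with `c` on the
-- right.
unscale : ∀ V N c y .{{_ : ℕ.NonZero V}} → 1ℚ ℚ.≤ ι V ℚ.* c → ι (V ℕ.* N) ℚ.≤ y → ι N ℚ.≤ c ℚ.* y
unscale V N c y 1≤Vc VN≤y = begin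
  ι N                   ≡⟨ ℚₚ.*-identityˡ (ι N) ⟨
  1ℚ ℚ.* ι N            ≤⟨ *-monoʳ (0≤ι N) 1≤Vc ⟩
  ι V ℚ.* c ℚ.* ι N     ≡⟨ solve 3 (λ v c n → v :* c :* n := c :* (v :* n)) refl (ι V) c (ι N) ⟩
  c ℚ.* (ι V ℚ.* ι N)   ≡⟨ cong (c ℚ.*_) (ι-* V N) ⟨
  c ℚ.* ι (V ℕ.* N)     ≤⟨ *-monoˡ 0≤c VN≤y ⟩
  c ℚ.* y               ∎
  where
  open ℚₚ.≤-Reasoning
  0≤c : 0ℚ ℚ.≤ c
  0≤c = *-cancelˡ (0<ι V) (subst (ℚ._≤ ι V ℚ.* c) (sym (ℚₚ.*-zeroʳ (ι V))) (ℚₚ.≤-trans (ℚₚ.nonNegative⁻¹ 1ℚ) 1≤Vc))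

eventually-0≤ : ∀ x → 0ℝ < x → Eventually λ j → 0ℚ ℚ.≤ seq x j
eventually-0≤ x (δ , 0<δ , N , h) = N , λ j N≤j → ℚₚ.<⇒≤ (ℚₚ.<-≤-trans 0<δ (subst (ℚ._≤ seq x j) (ℚₚ.+-identityˡ δ) (h j N≤j)))

-- Absorbs a slack of 1, be it from the order on the reals or from the variation of a Cauchy
-- sequence, by starting from a natural number larger by 1.
drop-1 : ∀ {x y} → ι (suc x) ℚ.≤ y ℚ.+ 1ℚ → ι x ℚ.≤ y
drop-1 {x} {y} h = subst₂ ℚ._≤_
  (trans (cong (ℚ._- 1ℚ) (ι-+ 1 x)) (solve 2 (λ o x → (o :+ x) :- o := x) refl 1ℚ (ι x)))
  (solve 2 (λ y o → (y :+ o) :- o := y) refl y 1ℚ)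
  (ℚₚ.+-monoˡ-≤ (ℚ.- 1ℚ) h)

eventually⇒≤ : ∀ x y → Eventually (λ j → seq x j ℚ.≤ seq y j) → x ≤ y
eventually⇒≤ x y (N , h) δ 0<δ = N , λ j N≤j → ℚₚ.≤-trans (h j N≤j)
  (subst (ℚ._≤ seq y j ℚ.+ δ) (ℚₚ.+-identityʳ (seq y j)) (ℚₚ.+-monoʳ-≤ (seq y j) (ℚₚ.<⇒≤ 0<δ)))

-- The shift `M` is the number of initial terms that `inverse` drops.
inverse-seq : ∀ x (0<x : 0ℝ < x) → ∃[ M ] (∀ j → 0ℚ ℚ.< seq x (M ℕ.+ j) × seq x (M ℕ.+ j) ℚ.* seq (inverse x 0<x) j ≡ 1ℚ)
inverse-seq x (δ , 0<δ , M , h) = M , λ j →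
  let 0<xⱼ = ℚₚ.<-≤-trans 0<δ (subst (ℚ._≤ seq x (M ℕ.+ j)) (ℚₚ.+-identityˡ δ) (h (M ℕ.+ j) (ℕₚ.m≤m+n M j)))
  in 0<xⱼ , recip-inverse (seq x (M ℕ.+ j)) 0<xⱼ

square≤1 : ∀ {p} → p ℚ.* p ℚ.≤ 1ℚ → p ℚ.≤ 1ℚ
square≤1 {p} h with ℚₚ.≤-total p 1ℚ
... | inj₁ p≤1 = p≤1
... | inj₂ 1≤p = ℚₚ.≤-trans (subst (ℚ._≤ p ℚ.* p) (ℚₚ.*-identityʳ p)
  (*-monoˡ (ℚₚ.≤-trans (ℚₚ.nonNegative⁻¹ 1ℚ) 1≤p) 1≤p)) h

-- Multiplication by x² gives (w x)² ≤ 1. Term `i` of the inverse belongs to term `M + i` of `x`,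
-- hence the threshold `M + N`.
inverse²-large : ∀ x (0<x : 0ℝ < x) w →
  Eventually (λ j → ι w ℚ.* ι w ℚ.≤ seq (inverse x 0<x * inverse x 0<x) j) → Eventually (λ j → ι w ℚ.* seq x j ℚ.≤ 1ℚ)
inverse²-large x 0<x w (N , h) = M ℕ.+ N , λ j M+N≤j →
  let i = j ℕ.∸ M
      M≤j = ℕₚ.≤-trans (ℕₚ.m≤m+n M N) M+N≤j
  in subst (λ j → ι w ℚ.* seq x j ℚ.≤ 1ℚ) (ℕₚ.m+[n∸m]≡n M≤j)
       (small i (h i (subst (ℕ._≤ i) (ℕₚ.m+n∸m≡n M N) (ℕₚ.∸-monoˡ-≤ M M+N≤j))))
  where
  open ℚₚ.≤-Reasoning
  M = proj₁ (inverse-seq x 0<x)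
  inv = proj₂ (inverse-seq x 0<x)
  small : ∀ i → ι w ℚ.* ι w ℚ.≤ seq (inverse x 0<x * inverse x 0<x) i → ι w ℚ.* seq x (M ℕ.+ i) ℚ.≤ 1ℚ
  small i h = square≤1 (begin
    ι w ℚ.* y ℚ.* (ι w ℚ.* y)    ≡⟨ solve 2 (λ w y → w :* y :* (w :* y) := y :* y :* (w :* w)) refl (ι w) y ⟩
    y ℚ.* y ℚ.* (ι w ℚ.* ι w)    ≤⟨ *-monoˡ (*-nonNeg 0≤y 0≤y) h ⟩
    y ℚ.* y ℚ.* (z ℚ.* z)        ≡⟨ solve 2 (λ y z → y :* y :* (z :* z) := (y :* z) :* (y :* z)) refl y z ⟩
    y ℚ.* z ℚ.* (y ℚ.* z)        ≡⟨ cong₂ ℚ._*_ (proj₂ (inv i)) (proj₂ (inv i)) ⟩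
    1ℚ                           ∎)
    where
    y = seq x (M ℕ.+ i)
    z = seq (inverse x 0<x) i
    0≤y = ℚₚ.<⇒≤ (proj₁ (inv i))

-- The scale g and the size of the graphs

-- In effect `g` is √(r/H) rounded down, reached by descent from a natural upper bound for `r`; the
-- case `g ≡ 0` takes up all small and negative `r`.
scaled-square : ∀ H r {{_ : ℕ.NonZero H}} →
  ∃[ g ] (r ℚ.≤ ι (H ℕ.* (suc g ℕ.* suc g)) × (g ≡ 0 ⊎ (ℕ.NonZero g × ι (H ℕ.* (g ℕ.* g)) ℚ.≤ r)))
scaled-square H r = descend (proj₁ (archimedean r)) (ℚₚ.≤-trans (proj₂ (archimedean r)) (ι-mono-≤ (start (proj₁ (archimedean r)))))
  where
  start : ∀ X → X ℕ.≤ H ℕ.* (suc X ℕ.* suc X)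
  start X = ℕₚ.≤-trans (ℕₚ.≤-trans (ℕₚ.n≤1+n X) (ℕₚ.m≤m*n (suc X) (suc X))) (ℕₚ.m≤n*m (suc X ℕ.* suc X) H)
  descend : ∀ X → r ℚ.≤ ι (H ℕ.* (suc X ℕ.* suc X)) →
    ∃[ g ] (r ℚ.≤ ι (H ℕ.* (suc g ℕ.* suc g)) × (g ≡ 0 ⊎ (ℕ.NonZero g × ι (H ℕ.* (g ℕ.* g)) ℚ.≤ r)))
  descend zero    r≤ = 0 , r≤ , inj₁ refl
  descend (suc X) r≤ with ℚₚ.≤-total (ι (H ℕ.* (suc X ℕ.* suc X))) r
  ... | inj₁ ≤r  = suc X , r≤ , inj₂ (_ , ≤r)
  ... | inj₂ r≤′ = descend X r≤′

order≤ : ∀ k {{_ : ℕ.NonZero k}} → Family.order k ℕ.≤ 7 ℕ.* k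
order≤ k = ℕₚ.≤-trans (ℕₚ.+-monoˡ-≤ (4 ℕ.* k) (ℕₚ.m≤m*n 3 k)) (ℕₚ.≤-reflexive (sym (ℕₚ.*-distribʳ-+ k 3 4)))

edges≤7k² : ∀ k {{_ : ℕ.NonZero k}} b → edges (Family.graph k b) ℕ.≤ 7 ℕ.* (k ℕ.* k)
edges≤7k² k b = begin
  edges (Family.graph k b)                                  ≤⟨ Family.edges≤ k b ⟩
  k ℕ.+ (2 ℕ.+ 4 ℕ.* k ℕ.* k)                               ≤⟨ ℕₚ.+-mono-≤ (ℕₚ.m≤m*n k k) (ℕₚ.+-monoˡ-≤ (4 ℕ.* k ℕ.* k) (ℕₚ.m≤m*n 2 (k ℕ.* k) {{ℕₚ.m*n≢0 k k}})) ⟩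
  k ℕ.* k ℕ.+ (2 ℕ.* (k ℕ.* k) ℕ.+ 4 ℕ.* k ℕ.* k)           ≡⟨ total7 k ⟩
  7 ℕ.* (k ℕ.* k)                                           ∎
  where
  open ℕₚ.≤-Reasoning
  total7 : ∀ k → k ℕ.* k ℕ.+ (2 ℕ.* (k ℕ.* k) ℕ.+ 4 ℕ.* k ℕ.* k) ≡ 7 ℕ.* (k ℕ.* k)
  total7 = solve-∀

complement : ∀ x → x < 1ℝ → 0ℝ < 1ℝ - x
complement x (δ , 0<δ , N , h) = δ , 0<δ , N , λ n N≤n →
  subst (ℚ._≤ 1ℚ ℚ.- seq x n) (solve 2 (λ x d → (x :+ d) :+ :- x := con 0ℚ :+ d) refl (seq x n) δ) (ℚₚ.+-monoˡ-≤ (ℚ.- seq x n) (h n N≤n))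

1≤* : ∀ {p q} → 1ℚ ℚ.≤ p → 1ℚ ℚ.≤ q → 1ℚ ℚ.≤ p ℚ.* q
1≤* {p} {q} 1≤p 1≤q = ℚₚ.≤-trans 1≤p (subst (ℚ._≤ p ℚ.* q) (ℚₚ.*-identityʳ p)
  (*-monoˡ (ℚₚ.≤-trans (ℚₚ.nonNegative⁻¹ 1ℚ) 1≤p) 1≤q))

-- The bound is y³ x, with x at least 1/α and y at least 1/(1 - α).
reach-scale : ∀ α → 0ℝ < α → α < 1ℝ → ∃[ X ] (Eventually λ n → 1ℚ ℚ.≤ ι X ℚ.* reach α n)
reach-scale α 0<α α<1 =
  let x , _ , hx = scale α 0<α
      y , _ , hy = scale (1ℝ - α) (complement α α<1)
  in y ℕ.* y ℕ.* y ℕ.* x ,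
     eventually-map (λ n h → subst (1ℚ ℚ.≤_) (regroup x y (1ℚ ℚ.- seq α n) (seq α n))
       (1≤* (1≤* (1≤* (proj₁ h) (proj₁ h)) (proj₁ h)) (proj₂ h))) (eventually-× hy hx)
  where
  regroup : ∀ x y b a → (ι y ℚ.* b) ℚ.* (ι y ℚ.* b) ℚ.* (ι y ℚ.* b) ℚ.* (ι x ℚ.* a) ≡ ι (y ℕ.* y ℕ.* y ℕ.* x) ℚ.* (b ℚ.* b ℚ.* b ℚ.* a)
  regroup x y b a = trans
    (solve 4 (λ y x b a → (y :* b) :* (y :* b) :* (y :* b) :* (x :* a) := (y :* y :* y :* x) :* (b :* b :* b :* a)) refl (ι y) (ι x) b a)
    (cong (ℚ._* (b ℚ.* b ℚ.* b ℚ.* a))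
      (sym (trans (ι-* (y ℕ.* y ℕ.* y) x) (cong (ℚ._* ι x) (trans (ι-* (y ℕ.* y) y) (cong (ℚ._* ι y) (ι-* y y)))))))

-- The successor of `W` in the demand on `n` pays for the slack 1 in the real inequality.
Ω-large : ∀ (x c : ℝ) n D W {{_ : ℕ.NonZero D}} → Eventually (λ j → 1ℚ ℚ.≤ ι D ℚ.* seq c j) → c * fromℕ n ≤ x →
          D ℕ.* suc W ℕ.≤ n → Eventually λ j → ι W ℚ.≤ seq x j
Ω-large x c n D W D-scale cn≤x D≤n = eventually-map
  (λ j h → drop-1 {W} (ℚₚ.≤-trans (unscale D (suc W) (seq c j) (ι n) (proj₁ h) (ι-mono-≤ D≤n)) (proj₂ h)))
  (eventually-× D-scale (cn≤x 1ℚ (ℚₚ.positive⁻¹ 1ℚ)))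

-- The slack 1 is at most n², which accounts for the successor of `K`.
O-small : ∀ (x c : ℝ) n K → 1 ℕ.≤ n → Eventually (λ j → seq c j ℚ.≤ ι K) → x ≤ c * (fromℕ n * fromℕ n) →
          Eventually λ j → seq x j ℚ.≤ ι (suc K ℕ.* (n ℕ.* n))
O-small x c n K 1≤n K-upper x≤ = eventually-map (λ j h → begin
  seq x j                                 ≤⟨ proj₂ h ⟩
  seq c j ℚ.* (ι n ℚ.* ι n) ℚ.+ 1ℚ        ≤⟨ ℚₚ.+-mono-≤ (*-monoʳ (*-nonNeg (0≤ι n) (0≤ι n)) (proj₁ h)) (ι-mono-≤ (ℕₚ.*-mono-≤ 1≤n 1≤n)) ⟩
  ι K ℚ.* (ι n ℚ.* ι n) ℚ.+ ι (n ℕ.* n)   ≡⟨ cong (λ y → ι K ℚ.* y ℚ.+ ι (n ℕ.* n)) (ι-* n n) ⟨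
  ι K ℚ.* ι (n ℕ.* n) ℚ.+ ι (n ℕ.* n)     ≡⟨ cong (ℚ._+ ι (n ℕ.* n)) (ι-* K (n ℕ.* n)) ⟨
  ι (K ℕ.* (n ℕ.* n)) ℚ.+ ι (n ℕ.* n)     ≡⟨ ℚₚ.+-comm (ι (K ℕ.* (n ℕ.* n))) (ι (n ℕ.* n)) ⟩
  ι (n ℕ.* n) ℚ.+ ι (K ℕ.* (n ℕ.* n))     ≡⟨ ι-+ (n ℕ.* n) (K ℕ.* (n ℕ.* n)) ⟨
  ι (suc K ℕ.* (n ℕ.* n))                 ∎)
  (eventually-× K-upper (x≤ 1ℚ (ℚₚ.positive⁻¹ 1ℚ)))
  where open ℚₚ.≤-Reasoning

-- Rests on (g + 1)² ≤ 4 (g² + 1), where the summand 1 is what makes g = 0 possible.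
absorb : ∀ H g → H ℕ.* (suc g ℕ.* suc g) ℕ.+ 1 ℕ.≤ suc (4 ℕ.* H) ℕ.* suc (g ℕ.* g)
absorb H g = begin
  H ℕ.* (suc g ℕ.* suc g) ℕ.+ 1                       ≤⟨ ℕₚ.+-mono-≤ (ℕₚ.*-monoʳ-≤ H (four g)) (ℕ.s≤s ℕ.z≤n) ⟩
  H ℕ.* (4 ℕ.* suc (g ℕ.* g)) ℕ.+ suc (g ℕ.* g)       ≡⟨ rearrange H (suc (g ℕ.* g)) ⟩
  suc (4 ℕ.* H) ℕ.* suc (g ℕ.* g)                     ∎
  where
  open ℕₚ.≤-Reasoning
  rearrange : ∀ H x → H ℕ.* (4 ℕ.* x) ℕ.+ x ≡ suc (4 ℕ.* H) ℕ.* x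
  rearrange = solve-∀
  square : ∀ g → suc g ℕ.* suc g ≡ suc (g ℕ.* g) ℕ.+ 2 ℕ.* g
  square = solve-∀
  g≤1+g² : ∀ g → g ℕ.≤ suc (g ℕ.* g)
  g≤1+g² zero    = ℕ.z≤n
  g≤1+g² (suc g) = ℕₚ.m≤n⇒m≤1+n (ℕₚ.m≤m*n (suc g) (suc g))
  add : ∀ x → x ℕ.+ 2 ℕ.* x ℕ.+ x ≡ 4 ℕ.* x
  add = solve-∀
  four : ∀ g → suc g ℕ.* suc g ℕ.≤ 4 ℕ.* suc (g ℕ.* g)
  four g = begin
    suc g ℕ.* suc g                                    ≡⟨ square g ⟩
    suc (g ℕ.* g) ℕ.+ 2 ℕ.* g                          ≤⟨ ℕₚ.+-monoʳ-≤ (suc (g ℕ.* g)) (ℕₚ.*-monoʳ-≤ 2 (g≤1+g² g)) ⟩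
    suc (g ℕ.* g) ℕ.+ 2 ℕ.* suc (g ℕ.* g)              ≤⟨ ℕₚ.m≤m+n _ (suc (g ℕ.* g)) ⟩
    suc (g ℕ.* g) ℕ.+ 2 ℕ.* suc (g ℕ.* g) ℕ.+ suc (g ℕ.* g) ≡⟨ add (suc (g ℕ.* g)) ⟩
    4 ℕ.* suc (g ℕ.* g)                                ∎

-- The constant of the final lower bound: by `absorb`, it scales a quantity bounded by H (g + 1)² +
-- 1 down to at most g² + 1.
coefficient : ℕ → ℚ
coefficient H = unit (suc (4 ℕ.* H))

scaled-back : ∀ H g x → x ℚ.≤ ι (H ℕ.* (suc g ℕ.* suc g)) ℚ.+ 1ℚ → coefficient H ℚ.* x ℚ.+ ℚ.- 1ℚ ℚ.≤ ι (g ℕ.* g)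
scaled-back H g x x≤ = begin
  c ℚ.* x ℚ.+ ℚ.- 1ℚ                                            ≤⟨ ℚₚ.+-monoˡ-≤ (ℚ.- 1ℚ) (*-monoˡ (0≤unit d) x≤) ⟩
  c ℚ.* (ι (H ℕ.* (suc g ℕ.* suc g)) ℚ.+ ι 1) ℚ.+ ℚ.- 1ℚ        ≡⟨ cong (λ y → c ℚ.* y ℚ.+ ℚ.- 1ℚ) (ι-+ (H ℕ.* (suc g ℕ.* suc g)) 1) ⟨
  c ℚ.* ι (H ℕ.* (suc g ℕ.* suc g) ℕ.+ 1) ℚ.+ ℚ.- 1ℚ            ≤⟨ ℚₚ.+-monoˡ-≤ (ℚ.- 1ℚ) (*-monoˡ (0≤unit d) (ι-mono-≤ (absorb H g))) ⟩
  c ℚ.* ι (d ℕ.* suc (g ℕ.* g)) ℚ.+ ℚ.- 1ℚ                      ≡⟨ cong (λ y → c ℚ.* y ℚ.+ ℚ.- 1ℚ) (ι-* d (suc (g ℕ.* g))) ⟩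
  c ℚ.* (ι d ℚ.* ι (suc (g ℕ.* g))) ℚ.+ ℚ.- 1ℚ                  ≡⟨ cong (ℚ._+ ℚ.- 1ℚ) (ℚₚ.*-assoc c (ι d) (ι (suc (g ℕ.* g)))) ⟨
  c ℚ.* ι d ℚ.* ι (suc (g ℕ.* g)) ℚ.+ ℚ.- 1ℚ                    ≡⟨ cong (λ y → y ℚ.* ι (suc (g ℕ.* g)) ℚ.+ ℚ.- 1ℚ) (unit*ι d) ⟩
  1ℚ ℚ.* ι (suc (g ℕ.* g)) ℚ.+ ℚ.- 1ℚ                           ≡⟨ cong (ℚ._+ ℚ.- 1ℚ) (trans (ℚₚ.*-identityˡ (ι (suc (g ℕ.* g)))) (ι-+ 1 (g ℕ.* g))) ⟩
  1ℚ ℚ.+ ι (g ℕ.* g) ℚ.+ ℚ.- 1ℚ                                 ≡⟨ solve 2 (λ o y → (o :+ y) :+ :- o := y) refl 1ℚ (ι (g ℕ.* g)) ⟩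
  ι (g ℕ.* g)                                                   ∎
  where
  open ℚₚ.≤-Reasoning
  d = suc (4 ℕ.* H)
  c = coefficient H

fromℚ-pos : ∀ q → 0ℚ ℚ.< q → 0ℝ < fromℚ q
fromℚ-pos q 0<q = q , 0<q , 0 , λ _ _ → ℚₚ.≤-reflexive (ℚₚ.+-identityˡ q)

-- Of the probability 1 − p ≥ 4 / Q, the two error terms cost 1 / Q each.
success⇒acceptance : ∀ (p : ℝ) Q₀ {{_ : ℕ.NonZero Q₀}} {{_ : ℕ.NonZero (4 ℕ.* Q₀)}} a →
  Eventually (λ j → 1ℚ ℚ.≤ ι Q₀ ℚ.* (1ℚ ℚ.- seq p j)) → 1ℝ - p ≤ fromℚ a + fromℚ (unit (4 ℕ.* Q₀)) →
  unit (4 ℕ.* Q₀) ℚ.+ unit (4 ℕ.* Q₀) ℚ.≤ a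
success⇒acceptance p Q₀ a p-scale success = subst₂ ℚ._≤_
  (trans (cong (λ y → y ℚ.- (u ℚ.+ u)) (split4 u)) (solve 1 (λ u → ((u :+ u) :+ (u :+ u)) :- (u :+ u) := u :+ u) refl u))
  (solve 2 (λ a u → ((a :+ u) :+ u) :- (u :+ u) := a) refl a u)
  (ℚₚ.+-monoˡ-≤ (ℚ.- (u ℚ.+ u)) (ℚₚ.≤-trans (*-cancelˡ (0<ι Q₀) (begin
    ι Q₀ ℚ.* (ι 4 ℚ.* u)         ≡⟨ trans (sym (ℚₚ.*-assoc (ι Q₀) (ι 4) u)) (cong (ℚ._* u) (trans (ℚₚ.*-comm (ι Q₀) (ι 4)) (sym (ι-* 4 Q₀)))) ⟩
    ι (4 ℕ.* Q₀) ℚ.* u           ≡⟨ ι*unit (4 ℕ.* Q₀) ⟩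
    1ℚ                           ≤⟨ proj₁ (proj₂ facts) ⟩
    ι Q₀ ℚ.* (1ℚ ℚ.- seq p j)    ∎)) (proj₂ (proj₂ facts))))
  where
  open ℚₚ.≤-Reasoning
  u = unit (4 ℕ.* Q₀)
  facts = eventually-some (eventually-× p-scale (success u (0<unit (4 ℕ.* Q₀))))
  j = proj₁ facts
  split4 : ∀ u → ι 4 ℚ.* u ≡ (u ℚ.+ u) ℚ.+ (u ℚ.+ u)
  split4 u = trans (ℚₚ.*-distribʳ-+ u (ι 2) (ι 2)) (cong₂ ℚ._+_ (twice u) (twice u))
    where
    twice : ∀ u → ι 2 ℚ.* u ≡ u ℚ.+ u
    twice u = trans (ℚₚ.*-distribʳ-+ u 1ℚ 1ℚ) (cong₂ ℚ._+_ (ℚₚ.*-identityˡ u) (ℚₚ.*-identityˡ u))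

-- The −1 of the statement is needed because H (g + 1)² is not O(g²) at g = 0.
expectedQueries : ∀ {N} (U : Graph N) (A : Algorithm) (s : Fin N) (R : ℝ) H g i →
  (∀ j → i ℕ.≤ j → seq R j ℚ.≤ ι (H ℕ.* (suc g ℕ.* suc g)) ℚ.+ 1ℚ) →
  ∀ T → ι (g ℕ.* g) ℚ.≤ queries U A s T (s ∷ []) [] →
  ExpectedQueries≥ U A s (fromℚ (coefficient H) * R - 1ℝ)
expectedQueries U A s R H g i R≤ T g²≤ δ 0<δ = T , eventually⇒≤ (fromℚ (coefficient H) * R - 1ℝ) (fromℚ q + δ)
  (eventually-map (λ j h → begin
    coefficient H ℚ.* seq R j ℚ.+ ℚ.- 1ℚ   ≤⟨ scaled-back H g (seq R j) (proj₁ h) ⟩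
    ι (g ℕ.* g)                            ≤⟨ g²≤ ⟩
    q                                      ≡⟨ ℚₚ.+-identityʳ q ⟨
    q ℚ.+ 0ℚ                               ≤⟨ ℚₚ.+-monoʳ-≤ q (proj₂ h) ⟩
    q ℚ.+ seq δ j                          ∎) (eventually-× (i , R≤) (eventually-0≤ δ 0<δ)))
  where
  open ℚₚ.≤-Reasoning
  q = queries U A s T (s ∷ []) []

-- The hard instance for one value of n

side-square : ∀ P g → (P ℕ.* g ℕ.+ P ℕ.* g) ℕ.* (P ℕ.* g ℕ.+ P ℕ.* g) ≡ 4 ℕ.* (P ℕ.* P) ℕ.* (g ℕ.* g)
side-square = solve-∀

-- X, Q₀, V and W are bounds for the inverses of reach α, 1 − p, Cᵥ and Cₑ.
module Instance (α p mₙ εₙ Cᵥ Cₑ : ℝ) (0<εₙ : 0ℝ < εₙ) (n X Q₀ V W K h : ℕ)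
         {{Q₀≢0 : ℕ.NonZero Q₀}} {{V≢0 : ℕ.NonZero V}} {{W≢0 : ℕ.NonZero W}} {{K≢0 : ℕ.NonZero K}} {{h≢0 : ℕ.NonZero h}}
         (α-scale : Eventually λ j → 1ℚ ℚ.≤ ι X ℚ.* reach α j)
         (p-scale : Eventually λ j → 1ℚ ℚ.≤ ι Q₀ ℚ.* (1ℚ ℚ.- seq p j))
         (Cᵥ-scale : Eventually λ j → 1ℚ ℚ.≤ ι V ℚ.* seq Cᵥ j)
         (Cₑ-scale : Eventually λ j → 1ℚ ℚ.≤ ι W ℚ.* seq Cₑ j)
         (m-large : Eventually λ j → ι (W ℕ.* 7) ℚ.≤ seq mₙ j)
         (m-small : Eventually λ j → seq mₙ j ℚ.≤ ι (K ℕ.* (n ℕ.* n)))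
         (7V≤n : V ℕ.* 7 ℕ.≤ n)
  where

  Q P H : ℕ
  Q = 4 ℕ.* Q₀
  P = 3 ℕ.* Q
  -- The sequence of `R` varies by less than 1 from the chosen index on. The summand 1 covers this:
  -- H g² - 1 ≥ h² g² for g ≥ 1.
  H = suc (h ℕ.* h)

  -- The coefficients come from k = 2 P g. There are at most 7 k² = 28 P² g² edges, to be compared
  -- with h² g² ≤ m, and at most 7 k = 14 P g nodes, to be compared with n through h² g² ≤ K n².
  -- Closeness needs 4 X k² = 16 P² X g² ≤ h g², with a single `h`, as ε ≤ 1/(h g).
  module _ (h-edges : 28 ℕ.* (P ℕ.* P) ℕ.* W ℕ.≤ h) (h-nodes : 14 ℕ.* P ℕ.* V ℕ.* K ℕ.≤ h)
           (h-close : 16 ℕ.* (P ℕ.* P) ℕ.* X ℕ.≤ h)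
    where

    few-nodes : ∀ N → V ℕ.* N ℕ.≤ n → fromℕ N ≤ Cᵥ * fromℕ n
    few-nodes N VN≤n = eventually⇒≤ (fromℕ N) (Cᵥ * fromℕ n)
      (eventually-map (λ j 1≤ → unscale V N (seq Cᵥ j) (ι n) 1≤ (ι-mono-≤ VN≤n)) Cᵥ-scale)

    few-edges : ∀ N M → N ℕ.≤ M → Eventually (λ j → ι (W ℕ.* M) ℚ.≤ seq mₙ j) → fromℕ N ≤ Cₑ * mₙ
    few-edges N M N≤M large = eventually⇒≤ (fromℕ N) (Cₑ * mₙ)
      (eventually-map (λ j h → unscale W N (seq Cₑ j) (seq mₙ j) (proj₁ h)
         (ℚₚ.≤-trans (ι-mono-≤ (ℕₚ.*-monoʳ-≤ W N≤M)) (proj₂ h))) (eventually-× Cₑ-scale large))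

    ε⁻² R : ℝ
    ε⁻² = inverse εₙ 0<εₙ * inverse εₙ 0<εₙ
    R = mₙ ⊓ ε⁻²

    Hard : Algorithm → Set
    Hard A = ∃[ N ] Σ (Graph N) λ U → Σ (Fin N) λ s →
      (fromℕ N ≤ Cᵥ * fromℕ n × fromℕ (edges U) ≤ Cₑ * mₙ) ×
      ExpectedQueries≥ U A s (fromℚ (coefficient H) * R - 1ℝ)

    -- For g = 0 the demanded number of queries is at most 0, so any graph of admissible size
    -- serves. The smallest of the family has 7 nodes and at most 7 edges, whence the 7 in `7V≤n`
    -- and `m-large`.
    trivial-case : ∀ A i → (∀ j → i ℕ.≤ j → seq R j ℚ.≤ ι (H ℕ.* (1 ℕ.* 1)) ℚ.+ 1ℚ) → Hard A
    trivial-case A i R≤ = F.order , F.graph b , F.source ,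
      (few-nodes F.order 7V≤n , few-edges (edges (F.graph b)) 7 (edges≤7k² 1 b) m-large) ,
      expectedQueries (F.graph b) A F.source R H 0 i R≤ 0 ℚₚ.≤-refl
      where
      module F = Family 1
      b = Vec.replicate 1 false

    module Main (A : Algorithm)
        (correct : ∀ N (G : Graph N) → fromℕ N ≤ Cᵥ * fromℕ n → fromℕ (edges G) ≤ Cₑ * mₙ →
                   ∀ s → WithProbability G A s (1ℝ - p) (Accurate G α εₙ s))
        (g i : ℕ) {{g≢0 : ℕ.NonZero g}}
        (R≤ : ∀ j → i ℕ.≤ j → seq R j ℚ.≤ ι (H ℕ.* (suc g ℕ.* suc g)) ℚ.+ 1ℚ)
        (R≥ : ∀ j → i ℕ.≤ j → ι (h ℕ.* h ℕ.* (g ℕ.* g)) ℚ.≤ seq R j)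
      where

      instance
        Q≢0 : ℕ.NonZero Q
        Q≢0 = ℕₚ.m*n≢0 4 Q₀

      k : ℕ
      k = side Q g

      instance
        k≢0 : ℕ.NonZero k
        k≢0 = side≢0 Q g

      module F = Family k

      kk≡ : k ℕ.* k ≡ 4 ℕ.* (P ℕ.* P) ℕ.* (g ℕ.* g)
      kk≡ = side-square P g

      m≥ : Eventually λ j → ι (h ℕ.* h ℕ.* (g ℕ.* g)) ℚ.≤ seq mₙ j
      m≥ = i , λ j i≤j → ℚₚ.≤-trans (R≥ j i≤j) (ℚₚ.p⊓q≤p (seq mₙ j) (seq ε⁻² j))

      ε-small : Eventually λ j → ι (h ℕ.* g) ℚ.* seq εₙ j ℚ.≤ 1ℚ
      ε-small = inverse²-large εₙ 0<εₙ (h ℕ.* g) (i , λ j i≤j → subst (ℚ._≤ seq ε⁻² j)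
        (trans (cong ι (shuffle h g)) (ι-* (h ℕ.* g) (h ℕ.* g)))
        (ℚₚ.≤-trans (R≥ j i≤j) (ℚₚ.p⊓q≤q (seq mₙ j) (seq ε⁻² j))))
        where
        shuffle : ∀ h g → h ℕ.* h ℕ.* (g ℕ.* g) ≡ h ℕ.* g ℕ.* (h ℕ.* g)
        shuffle = solve-∀

      edges-ok : ∀ b → fromℕ (edges (F.graph b)) ≤ Cₑ * mₙ
      edges-ok b = few-edges (edges (F.graph b)) (7 ℕ.* (k ℕ.* k)) (edges≤7k² k b)
        (eventually-map (λ j → ℚₚ.≤-trans (ι-mono-≤ (begin
          W ℕ.* (7 ℕ.* (k ℕ.* k))                            ≡⟨ cong (λ x → W ℕ.* (7 ℕ.* x)) kk≡ ⟩
          W ℕ.* (7 ℕ.* (4 ℕ.* (P ℕ.* P) ℕ.* (g ℕ.* g)))      ≡⟨ shuffle W (P ℕ.* P) (g ℕ.* g) ⟩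
          28 ℕ.* (P ℕ.* P) ℕ.* W ℕ.* (g ℕ.* g)               ≤⟨ ℕₚ.*-monoˡ-≤ (g ℕ.* g) (ℕₚ.≤-trans h-edges (ℕₚ.m≤m*n h h)) ⟩
          h ℕ.* h ℕ.* (g ℕ.* g)                              ∎))) m≥)
        where
        open ℕₚ.≤-Reasoning
        shuffle : ∀ W x y → W ℕ.* (7 ℕ.* (4 ℕ.* x ℕ.* y)) ≡ 28 ℕ.* x ℕ.* W ℕ.* y
        shuffle = solve-∀

      -- Here m = O(n²) enters: h² g² ≤ m ≤ K n² bounds `g`, and with it the side `k`, in terms of
      -- `n`.
      nodes-ok : fromℕ F.order ≤ Cᵥ * fromℕ n
      nodes-ok = few-nodes F.order (ℕₚ.≤-trans (ℕₚ.*-monoʳ-≤ V (order≤ k)) (square-cancel-≤ (ℕₚ.*-cancelˡ-≤ K (begin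
        K ℕ.* (z ℕ.* z)                            ≤⟨ ℕₚ.m≤m*n (K ℕ.* (z ℕ.* z)) K ⟩
        K ℕ.* (z ℕ.* z) ℕ.* K                      ≡⟨ shuffle K V P g ⟩
        14 ℕ.* P ℕ.* V ℕ.* K ℕ.* (14 ℕ.* P ℕ.* V ℕ.* K) ℕ.* (g ℕ.* g)  ≤⟨ ℕₚ.*-monoˡ-≤ (g ℕ.* g) (ℕₚ.*-mono-≤ h-nodes h-nodes) ⟩
        h ℕ.* h ℕ.* (g ℕ.* g)                      ≤⟨ ι-cancel-≤ (ℚₚ.≤-trans (proj₁ (proj₂ facts)) (proj₂ (proj₂ facts))) ⟩
        K ℕ.* (n ℕ.* n)                            ∎))))
        where
        open ℕₚ.≤-Reasoning
        z = V ℕ.* (7 ℕ.* k)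
        facts = eventually-some (eventually-× m≥ m-small)
        shuffle : ∀ K V P g → K ℕ.* (V ℕ.* (7 ℕ.* (P ℕ.* g ℕ.+ P ℕ.* g)) ℕ.* (V ℕ.* (7 ℕ.* (P ℕ.* g ℕ.+ P ℕ.* g)))) ℕ.* K ≡
                  14 ℕ.* P ℕ.* V ℕ.* K ℕ.* (14 ℕ.* P ℕ.* V ℕ.* K) ℕ.* (g ℕ.* g)
        shuffle = solve-∀

      close-ok : 4 ℕ.* X ℕ.* (k ℕ.* k) ℕ.≤ h ℕ.* (g ℕ.* g)
      close-ok = begin
        4 ℕ.* X ℕ.* (k ℕ.* k)                              ≡⟨ cong (4 ℕ.* X ℕ.*_) kk≡ ⟩
        4 ℕ.* X ℕ.* (4 ℕ.* (P ℕ.* P) ℕ.* (g ℕ.* g))        ≡⟨ shuffle X (P ℕ.* P) (g ℕ.* g) ⟩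
        16 ℕ.* (P ℕ.* P) ℕ.* X ℕ.* (g ℕ.* g)               ≤⟨ ℕₚ.*-monoˡ-≤ (g ℕ.* g) h-close ⟩
        h ℕ.* (g ℕ.* g)                                    ∎
        where
        open ℕₚ.≤-Reasoning
        shuffle : ∀ X x y → 4 ℕ.* X ℕ.* (4 ℕ.* x ℕ.* y) ≡ 16 ℕ.* x ℕ.* X ℕ.* y
        shuffle = solve-∀

      guarantee : ∀ b → WithProbability (F.graph b) A F.source (1ℝ - p) (Accurate (F.graph b) α εₙ F.source)
      guarantee b = correct F.order (F.graph b) nodes-ok (edges-ok b) F.source

      accept : Vec Bool (k ℕ.* k) → List (Reply F.order) → Bool
      accept b = proj₁ (guarantee b)

      -- Each matrix has its own accepting event, but the output depends on the history alone; two
      -- matrices that accept the same history therefore share an accurate estimate.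
      close : ∀ hist π̂ → A F.order F.source hist ≡ output π̂ →
              ∀ b b′ → accept b hist ≡ true → accept b′ hist ≡ true → ones b ℕ.≤ ones b′ ℕ.+ g
      close hist π̂ e b b′ yes-b yes-b′ = accurate⇒close k g h X close-ok α εₙ α-scale ε-small π̂ b b′
        (proj₁ (proj₂ (guarantee b)) hist π̂ e yes-b) (proj₁ (proj₂ (guarantee b′)) hist π̂ e yes-b′)

      enough : ∀ b → ∃[ T ] (1ℝ - p ≤ fromℚ (acceptance (F.graph b) A F.source (accept b) T (F.source ∷ []) []) + fromℚ (unit Q))
      enough b = proj₂ (proj₂ (guarantee b)) (fromℚ (unit Q)) (fromℚ-pos (unit Q) (0<unit Q))

      horizon : ℕ
      horizon = proj₁ (≤maximum (λ b → proj₁ (enough b)))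

      success : ∀ b → unit Q ℚ.+ unit Q ℚ.≤ acceptance (F.graph b) A F.source (accept b) horizon (F.source ∷ []) []
      success b = ℚₚ.≤-trans (success⇒acceptance p Q₀ _ p-scale (proj₂ (enough b)))
        (Runs.acceptance-mono A F.source (F.graph b) (accept b) (proj₂ (≤maximum (λ b → proj₁ (enough b))) b) (F.source ∷ []) [])

      hard : Hard A
      hard = let b , g²≤ = lower-bound Q g A accept close horizon success in
        F.order , F.graph b , F.source , (nodes-ok , edges-ok b) , expectedQueries (F.graph b) A F.source R H g i R≤ horizon g²≤

    hard-instance : ∀ A → (∀ N (G : Graph N) → fromℕ N ≤ Cᵥ * fromℕ n → fromℕ (edges G) ≤ Cₑ * mₙ →
                           ∀ s → WithProbability G A s (1ℝ - p) (Accurate G α εₙ s)) → Hard A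
    hard-instance A correct = go (scaled-square H (seq R i))
      where
      -- Past this index `R` is known up to 1, so the rational `seq R i` can select `g` and decide
      -- whether it is 0.
      i = proj₁ (cauchy R 1ℚ (ℚₚ.positive⁻¹ 1ℚ))
      near : ∀ j j′ → i ℕ.≤ j → i ℕ.≤ j′ → seq R j ℚ.< seq R j′ ℚ.+ 1ℚ
      near j j′ i≤j i≤j′ = dist<⇒< (seq R j) (seq R j′) (proj₂ (cauchy R 1ℚ (ℚₚ.positive⁻¹ 1ℚ)) j j′ i≤j i≤j′)
      R≤ : ∀ g → seq R i ℚ.≤ ι (H ℕ.* (suc g ℕ.* suc g)) → ∀ j → i ℕ.≤ j → seq R j ℚ.≤ ι (H ℕ.* (suc g ℕ.* suc g)) ℚ.+ 1ℚ
      R≤ g above j i≤j = ℚₚ.≤-trans (ℚₚ.<⇒≤ (near j i i≤j ℕₚ.≤-refl)) (ℚₚ.+-monoˡ-≤ 1ℚ above)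
      R≥ : ∀ g {{_ : ℕ.NonZero g}} → ι (H ℕ.* (g ℕ.* g)) ℚ.≤ seq R i → ∀ j → i ℕ.≤ j → ι (h ℕ.* h ℕ.* (g ℕ.* g)) ℚ.≤ seq R j
      R≥ g below j i≤j = drop-1 {h ℕ.* h ℕ.* (g ℕ.* g)} (ℚₚ.≤-trans
        (ι-mono-≤ (ℕₚ.+-monoˡ-≤ (h ℕ.* h ℕ.* (g ℕ.* g)) (ℕ.>-nonZero⁻¹ (g ℕ.* g) {{ℕₚ.m*n≢0 g g}})))
        (ℚₚ.≤-trans below (ℚₚ.<⇒≤ (near i j ℕₚ.≤-refl i≤j))))
      go : ∃[ g ] (seq R i ℚ.≤ ι (H ℕ.* (suc g ℕ.* suc g)) × (g ≡ 0 ⊎ (ℕ.NonZero g × ι (H ℕ.* (g ℕ.* g)) ℚ.≤ seq R i))) → Hard A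
      go (g , above , inj₁ refl)          = trivial-case A i (R≤ 0 above)
      go (g , above , inj₂ (g≢0 , below)) = Main.hard A correct g i {{g≢0}} (R≤ g above) (R≥ g {{g≢0}} below)

theorem1p8 : (α p : ℝ) → 0ℝ < α → α < 1ℝ → 0ℝ < p → p < 1ℝ →
    (ε m : ℕ → ℝ) (0<ε : ∀ n → 0ℝ < ε n) → (∀ n → ε n < 1ℝ) →
    m ∈Ω fromℕ → m ∈O (λ n → fromℕ n * fromℕ n) →
    (Cᵥ Cₑ : ℝ) → 0ℝ < Cᵥ → 0ℝ < Cₑ →
    ∃[ c ] (0ℝ < c × ∃[ n₀ ] (∀ n → n₀ ℕ.≤ n → (A : Algorithm) →
    (∀ N (G : Graph N) → fromℕ N ≤ Cᵥ * fromℕ n → fromℕ (edges G) ≤ Cₑ * m n →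
    ∀ s → WithProbability G A s (1ℝ - p) (Accurate G α (ε n) s)) →
    ∃[ N ] Σ (Graph N) λ U → Σ (Fin N) λ s →
    (fromℕ N ≤ Cᵥ * fromℕ n × fromℕ (edges U) ≤ Cₑ * m n) ×
    ExpectedQueries≥ U A s
    (c * (m n ⊓ (inverse (ε n) (0<ε n) * inverse (ε n) (0<ε n))) - 1ℝ)))
theorem1p8 α p 0<α α<1 0<p p<1 ε m 0<ε ε<1 (cΩ , 0<cΩ , nΩ , mΩ) (cO , 0<cO , nO , mO) Cᵥ Cₑ 0<Cᵥ 0<Cₑ =
  combineAll (reach-scale α 0<α α<1) (scale (1ℝ - p) (complement p p<1)) (scale Cᵥ 0<Cᵥ) (scale Cₑ 0<Cₑ) (scale cΩ 0<cΩ) (upper cO)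
  where
  Goal : Set
  Goal = ∃[ c ] (0ℝ < c × ∃[ n₀ ] (∀ n → n₀ ℕ.≤ n → (A : Algorithm) →
    (∀ N (G : Graph N) → fromℕ N ≤ Cᵥ * fromℕ n → fromℕ (edges G) ≤ Cₑ * m n →
    ∀ s → WithProbability G A s (1ℝ - p) (Accurate G α (ε n) s)) →
    ∃[ N ] Σ (Graph N) λ U → Σ (Fin N) λ s →
    (fromℕ N ≤ Cᵥ * fromℕ n × fromℕ (edges U) ≤ Cₑ * m n) ×
    ExpectedQueries≥ U A s
    (c * (m n ⊓ (inverse (ε n) (0<ε n) * inverse (ε n) (0<ε n))) - 1ℝ)))

  combineAll : ∃[ X ] (Eventually λ j → 1ℚ ℚ.≤ ι X ℚ.* reach α j) →
    ∃[ Q₀ ] (ℕ.NonZero Q₀ × Eventually λ j → 1ℚ ℚ.≤ ι Q₀ ℚ.* seq (1ℝ - p) j) →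
    ∃[ V ] (ℕ.NonZero V × Eventually λ j → 1ℚ ℚ.≤ ι V ℚ.* seq Cᵥ j) →
    ∃[ W ] (ℕ.NonZero W × Eventually λ j → 1ℚ ℚ.≤ ι W ℚ.* seq Cₑ j) →
    ∃[ D ] (ℕ.NonZero D × Eventually λ j → 1ℚ ℚ.≤ ι D ℚ.* seq cΩ j) →
    ∃[ K ] (Eventually λ j → seq cO j ℚ.≤ ι K) → Goal
  combineAll (X , α-scale) (Q₀ , Q₀≢0 , p-scale) (V , V≢0 , Cᵥ-scale) (W , W≢0 , Cₑ-scale) (D , D≢0 , cΩ-scale) (K , cO-upper) =
    -- As `h` is made from `X`, `Q₀`, `V`, `W` and `K` only, the constant is fixed before `n` and
    -- the algorithm.
    fromℚ (coefficient (suc (h ℕ.* h))) , fromℚ-pos (coefficient (suc (h ℕ.* h))) (0<unit (suc (4 ℕ.* suc (h ℕ.* h)))) ,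
    n₁ ℕ.+ n₂ , λ n n₀≤n →
      let n₁≤n = ℕₚ.≤-trans (ℕₚ.m≤m+n n₁ n₂) n₀≤n
          n₂≤n = ℕₚ.≤-trans (ℕₚ.m≤n+m n₂ n₁) n₀≤n
          nΩ≤n = ℕₚ.≤-trans (ℕₚ.m≤m+n nΩ nO) n₁≤n
          nO≤n = ℕₚ.≤-trans (ℕₚ.m≤n+m nO nΩ) n₁≤n
          V7≤n = ℕₚ.≤-trans (ℕₚ.m≤m+n (V ℕ.* 7) (D ℕ.* suc (W ℕ.* 7))) n₂≤n
          D≤n  = ℕₚ.≤-trans (ℕₚ.m≤n+m (D ℕ.* suc (W ℕ.* 7)) (V ℕ.* 7)) n₂≤n
          1≤n  = ℕₚ.≤-trans (ℕ.>-nonZero⁻¹ (V ℕ.* 7) {{ℕₚ.m*n≢0 V 7}}) V7≤n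
      in Instance.hard-instance α p (m n) (ε n) Cᵥ Cₑ (0<ε n) n X Q₀ V W (suc K) h
           α-scale p-scale Cᵥ-scale Cₑ-scale
           (Ω-large (m n) cΩ n D (W ℕ.* 7) cΩ-scale (mΩ n nΩ≤n) D≤n)
           (O-small (m n) cO n K 1≤n cO-upper (mO n nO≤n)) V7≤n h-edges h-nodes h-close
    where
    instance
      _ = Q₀≢0
      _ = V≢0
      _ = W≢0
      _ = D≢0
    P = 3 ℕ.* (4 ℕ.* Q₀)
    e = 28 ℕ.* (P ℕ.* P) ℕ.* W
    v = 14 ℕ.* P ℕ.* V ℕ.* suc K
    w = 16 ℕ.* (P ℕ.* P) ℕ.* X
    -- The sum stands in for the maximum of the three demands, and the successor makes `h` nonzero.
    h = suc (e ℕ.+ v ℕ.+ w)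
    h-edges : e ℕ.≤ h
    h-edges = ℕₚ.m≤n⇒m≤1+n (ℕₚ.≤-trans (ℕₚ.m≤m+n e v) (ℕₚ.m≤m+n (e ℕ.+ v) w))
    h-nodes : v ℕ.≤ h
    h-nodes = ℕₚ.m≤n⇒m≤1+n (ℕₚ.≤-trans (ℕₚ.m≤n+m v e) (ℕₚ.m≤m+n (e ℕ.+ v) w))
    h-close : w ℕ.≤ h
    h-close = ℕₚ.m≤n⇒m≤1+n (ℕₚ.m≤n+m w (e ℕ.+ v))
    n₁ = nΩ ℕ.+ nO
    -- Leaves room for the smallest graph of the family: the first summand for its 7 nodes, the
    -- second to force m ≥ 7 W for its edges.
    n₂ = V ℕ.* 7 ℕ.+ D ℕ.* suc (W ℕ.* 7)
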